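{- Let $G=(V,E)$ be a connected graph. Then $\mathcal{H}_3(G)$ is Mengerian if and only if $|V|=4$, or $G=C_8$ (the cycle on $8$ vertices), or $G$ is a path with double stars, or $G$ is a star with an additional edge between two of its leaves.
   Context: All graphs are finite, simple and undirected; as a standing assumption $|V|\ge 4$. For a graph $G$, $\mathcal{H}_3(G)$ is the $4$-uniform hypergraph on $V(G)$ whose hyperedges are the $4$-element subsets of $V(G)$ that contain a path of length $3$ in $G$ (the vertices can be ordered $v_1,\dots,v_4$ with $\{v_i,v_{i+1}\}\in E(G)$ for $i=1,2,3$). A tree $T$ is a path with double stars if at most two vertices of $T$ are adjacent to leaves (this includes stars and paths). A star with an additional edge between two of its leaves is $K_{1,n}$ with one extra edge joining two of its leaves. A clutter with incidence matrix $A$ on $n$ vertices is Mengerian if for every $c\in\mathbb{Z}_{\ge0}^n$, $\min\{\langle c,x\rangle: x\ge0 \text{ integral}, Ax\ge\mathbf 1\}=\max\{\langle y,\mathbf 1\rangle : y\ge 0\text{ integral}, y^\top A\le c^\top\}$ (equivalently, its edge ideal is normally torsion-free); the empty clutter is Mengerian. -}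

module Defs where

open import Data.Nat using (ℕ; zero; suc; _+_; _*_; _≤_; _%_)
open import Data.Fin using (Fin; toℕ)
open import Data.Fin.Subset using (Subset; _∈_; ∣_∣)
open import Data.Bool using (Bool; true; false; if_then_else_; _∨_)
open import Data.Vec using (Vec; []; _∷_; lookup)
open import Data.List using (List; []; _∷_; _++_; map; allFin; filterᵇ; length)
open import Data.Nat.ListAction using (sum)
import Data.List as L
open import Data.Product using (Σ; ∃; ∃-syntax; _×_; _,_)
open import Data.Sum using (_⊎_)
open import Data.Empty using (⊥)
open import Relation.Nullary using (¬_)
open import Relation.Nullary.Decidable using (⌊_⌋)
open import Relation.Binary.PropositionalEquality using (_≡_; _≢_)
open import Function.Definitions using (Bijective)
import Data.Nat as N

Graph : ℕ → Set
Graph n = Fin n → Fin n → Bool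

Adj : ∀ {n} → Graph n → Fin n → Fin n → Set
Adj G u v = G u v ≡ true

IsSimple : ∀ {n} → Graph n → Set
IsSimple {n} G = (∀ u v → G u v ≡ G v u) × (∀ v → G v v ≡ false)

data Walk {n} (G : Graph n) : Fin n → Fin n → Set where
  stop : ∀ {u} → Walk G u u
  step : ∀ {u v w} → Adj G u v → Walk G v w → Walk G u w

Connected : ∀ {n} → Graph n → Set
Connected {n} G = ∀ (u v : Fin n) → Walk G u v

Chain : ∀ {n} → Graph n → List (Fin n) → Set
Chain G [] = Data.Unit.⊤
  where import Data.Unit
Chain G (x ∷ []) = Data.Unit.⊤
  where import Data.Unit
Chain G (x ∷ y ∷ r) = Adj G x y × Chain G (y ∷ r)

Distinct : ∀ {n} → List (Fin n) → Set
Distinct [] = Data.Unit.⊤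
  where import Data.Unit
Distinct (x ∷ xs) = (∀ y → y Data.List.Membership.Propositional.∈ xs → x ≢ y) × Distinct xs
  where import Data.List.Membership.Propositional

HasCycle : ∀ {n} → Graph n → Set
HasCycle {n} G = Σ (Fin n) λ v → Σ (List (Fin n)) λ ws →
  (2 ≤ length ws) × Distinct (v ∷ ws) × Chain G ((v ∷ ws) ++ (v ∷ []))

IsTree : ∀ {n} → Graph n → Set
IsTree G = Connected G × ¬ HasCycle G

degree : ∀ {n} → Graph n → Fin n → ℕ
degree {n} G u = length (filterᵇ (G u) (allFin n))

IsLeaf : ∀ {n} → Graph n → Fin n → Set
IsLeaf G u = degree G u ≡ 1

AdjToLeaf : ∀ {n} → Graph n → Fin n → Set
AdjToLeaf {n} G u = Σ (Fin n) λ w → Adj G u w × IsLeaf G w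

PathWithDoubleStars : ∀ {n} → Graph n → Set
PathWithDoubleStars {n} G = IsTree G ×
  Σ (Fin n) λ p → Σ (Fin n) λ q → ∀ u → AdjToLeaf G u → (u ≡ p ⊎ u ≡ q)

StarPlusEdge : ∀ {n} → Graph n → Set
StarPlusEdge {n} G = Σ (Fin n) λ c → Σ (Fin n) λ a → Σ (Fin n) λ b →
  (a ≢ c) × (b ≢ c) × (a ≢ b) ×
  (∀ u v → Adj G u v ⇔′
     ((u ≡ c × v ≢ c) ⊎ (v ≡ c × u ≢ c) ⊎ (u ≡ a × v ≡ b) ⊎ (u ≡ b × v ≡ a)))
  where
  _⇔′_ : Set → Set → Set
  A ⇔′ B = (A → B) × (B → A)

Iso : ∀ {n m} → Graph n → Graph m → Set
Iso {n} {m} G H = Σ (Fin n → Fin m) λ f →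
  Bijective _≡_ _≡_ f × (∀ u v → G u v ≡ H (f u) (f v))

cycleGraph : (m : ℕ) → Graph m
cycleGraph zero i j = false
cycleGraph (suc k) i j =
  ⌊ toℕ j N.≟ (suc (toℕ i)) % (suc k) ⌋ ∨ ⌊ toℕ i N.≟ (suc (toℕ j)) % (suc k) ⌋

C8 : Graph 8
C8 = cycleGraph 8

Hypergraph : ℕ → Set₁
Hypergraph n = Subset n → Set

H3 : ∀ {n} → Graph n → Hypergraph n
H3 {n} G s = (∣ s ∣ ≡ 4) × Σ (Fin n) λ v₁ → Σ (Fin n) λ v₂ → Σ (Fin n) λ v₃ → Σ (Fin n) λ v₄ →
  Distinct (v₁ ∷ v₂ ∷ v₃ ∷ v₄ ∷ []) ×
  (v₁ ∈ s) × (v₂ ∈ s) × (v₃ ∈ s) × (v₄ ∈ s) ×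
  Adj G v₁ v₂ × Adj G v₂ v₃ × Adj G v₃ v₄

allSubsets : ∀ n → List (Subset n)
allSubsets zero = [] ∷ []
allSubsets (suc n) = map (true ∷_) (allSubsets n) ++ map (false ∷_) (allSubsets n)

sumV : ∀ {n} → (Fin n → ℕ) → ℕ
sumV {n} f = sum (map f (allFin n))

sumS : ∀ {n} → (Subset n → ℕ) → ℕ
sumS {n} g = sum (map g (allSubsets n))

IsCover : ∀ {n} → Hypergraph n → (Fin n → ℕ) → Set
IsCover {n} H x = ∀ s → H s → 1 ≤ sumV (λ v → if lookup s v then x v else 0)

-- y (a vector indexed by the hyperedges, extended by 0 to all subsets) is an
-- integral nonnegative packing: yᵀ A ≤ cᵀ
IsPacking : ∀ {n} → Hypergraph n → (Fin n → ℕ) → (Subset n → ℕ) → Set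
IsPacking {n} H c y = (∀ s → y s ≢ 0 → H s) ×
  (∀ v → sumS (λ s → if lookup s v then y s else 0) ≤ c v)

cost : ∀ {n} → (Fin n → ℕ) → (Fin n → ℕ) → ℕ
cost c x = sumV (λ v → c v * x v)

Mengerian : ∀ {n} → Hypergraph n → Set
Mengerian {n} H = ∀ (c : Fin n → ℕ) →
  Σ (Fin n → ℕ) λ x → Σ (Subset n → ℕ) λ y →
    (IsCover H x × (∀ x′ → IsCover H x′ → cost c x ≤ cost c x′)) ×
    (IsPacking H c y × (∀ y′ → IsPacking H c y′ → sumS y′ ≤ sumS y)) ×
    cost c x ≡ sumS y

{-# OPTIONS --safe #-}
-- Weak duality reduces the Mengerian property to producing, for every weight c, a cover and a
-- packing of equal value.
--
-- For the positive direction, four vertices, a star plus an edge and a path with double stars share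
-- a shape: every hyperedge has one vertex on each of four consecutive levels, and all levels but the
-- two outer ones are single vertices. Removing one copy of a leftmost hyperedge s inside the support
-- of c lowers the packing number by one, because an optimal cover of the rest can be pruned to a
-- single vertex on s. The same applies to C8 as soon as a weight vanishes. If all weights on C8 are
-- positive, then removing the window at k either works or some triple T_j = {j, j+3, j+6} with
-- j - k ∈ {0,2,3,5} is an optimal cover; two such triples, for k = 0 and k = j + 4, exchange vertices
-- into two covers that are together strictly cheaper.
--
-- For the converse, non-Mengerian weights come from odd cycle minors: three 4-subsets of a 5-set, the
-- spider with legs 2, 2, 1, and chordless cycles of length 4m ≥ 12; a cycle of length not divisible
-- by 4 fails already for the all-one weight. A shortest cycle of G therefore has length 3 (a star plus
-- an edge) or 8 (all of G, as otherwise a spider appears). Without cycles and spiders, a path from leaf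
-- to leaf carries all remaining vertices as leaves at its second and second to last vertex.
module Submission where

open import Defs
open import Data.Nat using (ℕ; zero; suc; _+_; _*_; _∸_; _⊓_; _≤_; _<_; z≤n; s≤s; _%_; _/_; NonZero)
open import Data.Nat.Properties
open import Data.Nat.DivMod
open import Data.Nat.Induction using (<-wellFounded)
open import Data.Nat.ListAction using (sum)
open import Data.Nat.ListAction.Properties using (sum-++)
open import Data.Nat.Tactic.RingSolver using (solve-∀)
open import Induction.WellFounded using (Acc; acc)
open import Data.Bool using (Bool; true; false; if_then_else_; _∧_; _∨_; not)
import Data.Bool as B
open import Data.Bool.ListAction using (all; any)
open import Data.Fin using (Fin; zero; suc; toℕ; fromℕ<)
import Data.Fin.Properties as F
open import Data.Fin.Subset using (Subset; ∣_∣)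
import Data.Fin.Subset as S
open import Data.Fin.Subset.Properties using (_∈?_; anySubset?; ∣p∣≤n; ∣p∣≡n⇒p≡⊤)
open import Data.Vec using (Vec; []; _∷_; lookup; tabulate)
open import Data.Vec.Properties using (lookup∘tabulate; lookup⇒[]=; []=⇒lookup; lookup-replicate)
open import Data.List using (List; []; _∷_; _++_; _ʳ++_; map; allFin; length; filterᵇ)
import Data.List as L
open import Data.List.Properties using (map-tabulate; map-++; map-∘; length-map; length-++)
open import Data.List.Membership.Propositional using (_∈_; _∉_)
open import Data.List.Membership.Propositional.Properties using (∈-map⁻; ∈-map⁺; ∈-++⁻; ∈-++⁺ˡ; ∈-++⁺ʳ; ∈-∃++)
import Data.List.Membership.DecPropositional as DecMem
open import Data.List.Relation.Unary.Any using (here; there; index)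
open import Data.List.Relation.Unary.Any.Properties using (lookup-index)
open import Data.Product using (Σ; _×_; _,_; proj₁; proj₂)
open import Data.Sum using (_⊎_; inj₁; inj₂; [_,_]′)
open import Data.Empty using (⊥; ⊥-elim)
open import Data.Unit using (⊤; tt)
open import Relation.Nullary using (¬_; Dec; yes; no; does; contradiction)
open import Relation.Nullary.Decidable using (_×-dec_; _→-dec_; ¬?; map′; dec-true; dec-false; toWitness; True; ⌊_⌋)
open import Relation.Binary.PropositionalEquality
open import Relation.Binary.Definitions using (tri<; tri≈; tri>)
open import Function using (_∘_; id)
open import Function.Bundles using (_⇔_; mk⇔)

-- Sums and weak duality

-- Failure of the Mengerian property is certified inside ℕ, without linear programming. If every
-- hyperedge in the support of the weight meets a list `ps` at least twice, half the indicator of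
-- `ps` is a fractional cover, and double counting bounds every packing by `length ps / 2` when `ps`
-- has weight one. If an odd number of hyperedges, as many as `length ps`, uses each vertex at most
-- twice its weight, then twice the cost of any integral cover is at least `length ps`. A cover and
-- a packing of equal value would therefore make an odd number even. Vertices outside `ps` that
-- occur in these hyperedges get weight two: they may be used up to four times and do not count in
-- the fractional cover.
--
-- The positive direction for the 8-cycle cannot follow the levelled argument, because a cycle has
-- no leftmost hyperedge and a window fixed in advance need not occur in any optimal packing. A
-- failed attempt at one window still yields information, namely an optimal cover that meets this
-- window twice, and two failures together are contradictory.

sumL : ∀ {A : Set} → (A → ℕ) → List A → ℕ
sumL f xs = sum (map f xs)

module _ {A : Set} where

  sumL-cong : ∀ {f g : A → ℕ} → (∀ x → f x ≡ g x) → ∀ xs → sumL f xs ≡ sumL g xs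
  sumL-cong e []       = refl
  sumL-cong e (x ∷ xs) = cong₂ _+_ (e x) (sumL-cong e xs)

  sumL-mono : ∀ {f g : A → ℕ} → (∀ x → f x ≤ g x) → ∀ xs → sumL f xs ≤ sumL g xs
  sumL-mono e []       = z≤n
  sumL-mono e (x ∷ xs) = +-mono-≤ (e x) (sumL-mono e xs)

  sumL-0 : ∀ (xs : List A) → sumL (λ _ → 0) xs ≡ 0
  sumL-0 []       = refl
  sumL-0 (_ ∷ xs) = sumL-0 xs

  sumL-+ : ∀ (f g : A → ℕ) xs → sumL (λ x → f x + g x) xs ≡ sumL f xs + sumL g xs
  sumL-+ f g []       = refl
  sumL-+ f g (x ∷ xs) = begin
    f x + g x + sumL (λ x → f x + g x) xs  ≡⟨ cong (f x + g x +_) (sumL-+ f g xs) ⟩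
    f x + g x + (sumL f xs + sumL g xs)    ≡⟨ +-assoc (f x) _ _ ⟩
    f x + (g x + (sumL f xs + sumL g xs))  ≡⟨ cong (f x +_) (+-assoc (g x) _ _) ⟨
    f x + (g x + sumL f xs + sumL g xs)    ≡⟨ cong (λ z → f x + (z + sumL g xs)) (+-comm (g x) _) ⟩
    f x + (sumL f xs + g x + sumL g xs)    ≡⟨ cong (f x +_) (+-assoc (sumL f xs) _ _) ⟩
    f x + (sumL f xs + (g x + sumL g xs))  ≡⟨ +-assoc (f x) _ _ ⟨
    f x + sumL f xs + (g x + sumL g xs)    ∎
    where open ≡-Reasoning

  sumL-* : ∀ k (f : A → ℕ) xs → sumL (λ x → k * f x) xs ≡ k * sumL f xs
  sumL-* k f []       = sym (*-zeroʳ k)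
  sumL-* k f (x ∷ xs) = trans (cong (k * f x +_) (sumL-* k f xs)) (sym (*-distribˡ-+ k (f x) _))

sumL-swap : ∀ {A B : Set} (F : A → B → ℕ) xs ys →
  sumL (λ x → sumL (F x) ys) xs ≡ sumL (λ y → sumL (λ x → F x y) xs) ys
sumL-swap F []       ys = sym (sumL-0 ys)
sumL-swap F (x ∷ xs) ys =
  trans (cong (sumL (F x) ys +_) (sumL-swap F xs ys)) (sym (sumL-+ (F x) _ ys))

δ : ∀ {n} → Fin n → Fin n → ℕ
δ u v = if does (u F.≟ v) then 1 else 0

δ-refl : ∀ {n} (u : Fin n) → δ u u ≡ 1
δ-refl u with u F.≟ u
... | yes _ = refl
... | no u≢ = ⊥-elim (u≢ refl)

δ-≢ : ∀ {n} {u v : Fin n} → u ≢ v → δ u v ≡ 0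
δ-≢ {u = u} {v} u≢v with u F.≟ v
... | yes e = ⊥-elim (u≢v e)
... | no _  = refl

sumV-suc : ∀ {n} (f : Fin (suc n) → ℕ) → sumV f ≡ f zero + sumV (f ∘ suc)
sumV-suc f = cong (λ z → f zero + sum z)
  (trans (map-tabulate suc f) (sym (map-tabulate id (f ∘ suc))))

sumV-δ : ∀ {n} (u : Fin n) (g : Fin n → ℕ) → sumV (λ v → δ u v * g v) ≡ g u
sumV-δ {suc n} zero g = begin
  sumV (λ v → δ zero v * g v)  ≡⟨ sumV-suc (λ v → δ zero v * g v) ⟩
  g zero + 0 + sumL (λ _ → 0) (allFin n)  ≡⟨ cong₂ _+_ (+-identityʳ (g zero)) (sumL-0 (allFin n)) ⟩
  g zero + 0                   ≡⟨ +-identityʳ _ ⟩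
  g zero                       ∎
  where open ≡-Reasoning
sumV-δ (suc u) g = trans (sumV-suc (λ v → δ (suc u) v * g v)) (sumV-δ u (g ∘ suc))

term≤sumV : ∀ {n} (u : Fin n) (g : Fin n → ℕ) → g u ≤ sumV g
term≤sumV {n} u g = subst (_≤ sumV g) (sumV-δ u g) (sumL-mono le (allFin n))
  where
  le : ∀ v → δ u v * g v ≤ g v
  le v with u F.≟ v
  ... | yes _ = ≤-reflexive (*-identityˡ (g v))
  ... | no _  = z≤n

sumV≤1 : ∀ {n} (b : Fin n) (g : Fin n → ℕ) → (∀ v → g v ≤ δ b v) → sumV g ≤ 1
sumV≤1 {n} b g le = ≤-trans (sumL-mono (λ v → ≤-trans (le v) (≤-reflexive (sym (*-identityʳ _)))) (allFin n))
  (≤-reflexive (sumV-δ b (λ _ → 1)))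

sumV-positive : ∀ {n} (g : Fin n → ℕ) → 1 ≤ sumV g → Σ (Fin n) λ v → 1 ≤ g v
sumV-positive {suc n} g p with 1 ≤? g zero
... | yes q = zero , q
... | no ¬q with sumV-positive (g ∘ suc) (subst (1 ≤_) (trans (sumV-suc g) (cong (_+ sumV (g ∘ suc)) (n<1⇒n≡0 (≰⇒> ¬q)))) p)
...   | v , q = suc v , q

sumV-monoStrict : ∀ {n} {f g : Fin n → ℕ} → (∀ v → f v ≤ g v) → ∀ u → f u < g u → sumV f < sumV g
sumV-monoStrict {f = f} {g} le zero lt = subst₂ _<_ (sym (sumV-suc f)) (sym (sumV-suc g))
  (+-mono-<-≤ lt (sumL-mono (le ∘ suc) (allFin _)))
sumV-monoStrict {f = f} {g} le (suc u) lt = subst₂ _<_ (sym (sumV-suc f)) (sym (sumV-suc g))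
  (+-mono-≤-< (le zero) (sumV-monoStrict (le ∘ suc) u lt))

δS : ∀ {n} → Subset n → Subset n → ℕ
δS []      []      = 1
δS (a ∷ s) (b ∷ t) = if does (a B.≟ b) then δS s t else 0

δS-≢0 : ∀ {n} (s t : Subset n) → δS s t ≢ 0 → s ≡ t
δS-≢0 []      []      _ = refl
δS-≢0 (a ∷ s) (b ∷ t) p with a B.≟ b
... | yes refl = cong (a ∷_) (δS-≢0 s t p)
... | no _     = ⊥-elim (p refl)

sumS-suc : ∀ {n} (g : Subset (suc n) → ℕ) → sumS g ≡ sumS (g ∘ (true ∷_)) + sumS (g ∘ (false ∷_))
sumS-suc {n} g = begin
  sum (map g (map (true ∷_) S ++ map (false ∷_) S))
    ≡⟨ cong sum (map-++ g (map (true ∷_) S) _) ⟩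
  sum (map g (map (true ∷_) S) ++ map g (map (false ∷_) S))
    ≡⟨ sum-++ (map g (map (true ∷_) S)) _ ⟩
  sum (map g (map (true ∷_) S)) + sum (map g (map (false ∷_) S))
    ≡⟨ cong₂ (λ x y → sum x + sum y) (map-∘ S) (map-∘ S) ⟨
  sumS (g ∘ (true ∷_)) + sumS (g ∘ (false ∷_)) ∎
  where
  open ≡-Reasoning
  S = allSubsets n

sumS-δ : ∀ {n} (s : Subset n) (g : Subset n → ℕ) → sumS (λ t → δS s t * g t) ≡ g s
sumS-δ [] g = trans (+-identityʳ _) (+-identityʳ _)
sumS-δ {suc n} (true ∷ s) g = trans (sumS-suc (λ t → δS (true ∷ s) t * g t))
  (trans (cong₂ _+_ (sumS-δ s (g ∘ (true ∷_))) (sumL-0 (allSubsets n))) (+-identityʳ _))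
sumS-δ {suc n} (false ∷ s) g = trans (sumS-suc (λ t → δS (false ∷ s) t * g t))
  (cong₂ _+_ (sumL-0 (allSubsets n)) (sumS-δ s (g ∘ (false ∷_))))

term≤sumS : ∀ {n} (s : Subset n) (g : Subset n → ℕ) → g s ≤ sumS g
term≤sumS {n} s g = subst (_≤ sumS g) (sumS-δ s g) (sumL-mono le (allSubsets n))
  where
  δ≤1 : ∀ {m} (s t : Subset m) → δS s t ≤ 1
  δ≤1 []      []      = ≤-refl
  δ≤1 (a ∷ s) (b ∷ t) with a B.≟ b
  ... | yes _ = δ≤1 s t
  ... | no _  = z≤n
  le : ∀ t → δS s t * g t ≤ g t
  le t = ≤-trans (*-monoˡ-≤ (g t) (δ≤1 s t)) (≤-reflexive (*-identityˡ (g t)))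

_∈ₛ_ : ∀ {n} → Fin n → Subset n → Set
v ∈ₛ s = lookup s v ≡ true

sumOn : ∀ {n} → Subset n → (Fin n → ℕ) → ℕ
sumOn s x = sumV (λ v → if lookup s v then x v else 0)

load : ∀ {n} → (Subset n → ℕ) → Fin n → ℕ
load y v = sumS (λ s → if lookup s v then y s else 0)

sumOn-hit : ∀ {n} (s : Subset n) x v → v ∈ₛ s → 1 ≤ x v → 1 ≤ sumOn s x
sumOn-hit s x v v∈s p = ≤-trans (subst (1 ≤_) (sym (cong (if_then x v else 0) v∈s)) p)
  (term≤sumV v (λ v → if lookup s v then x v else 0))

sumOn-positive : ∀ {n} (s : Subset n) x → 1 ≤ sumOn s x → Σ (Fin n) λ v → v ∈ₛ s × 1 ≤ x v
sumOn-positive s x p with sumV-positive _ p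
... | v , q with lookup s v in e
...   | true = v , e , q

if-swap : ∀ b (k x : ℕ) → k * (if b then x else 0) ≡ x * (if b then k else 0)
if-swap true  k x = *-comm k x
if-swap false k x = trans (*-zeroʳ k) (sym (*-zeroʳ x))

-- The double counting Σ_s y(s) z(s) = Σ_v z(v) load(v); with z a cover and d = 1 this is weak duality.
packing-bound : ∀ {n} {H : Hypergraph n} {c y} (z : Fin n → ℕ) d → IsPacking H c y →
  (∀ s → H s → (∀ v → v ∈ₛ s → 1 ≤ c v) → d ≤ sumOn s z) → d * sumS y ≤ cost c z
packing-bound {n} {H} {c} {y} z d (sup , cap) h = begin
  d * sumS y                    ≡⟨ sumL-* d y (allSubsets n) ⟨
  sumS (λ s → d * y s)          ≤⟨ sumL-mono each (allSubsets n) ⟩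
  sumS (λ s → y s * sumOn s z)  ≡⟨ sumL-cong (λ s → sym (sumL-* (y s) _ (allFin n))) (allSubsets n) ⟩
  sumS (λ s → sumV (λ v → y s * (if lookup s v then z v else 0)))
    ≡⟨ sumL-swap _ (allSubsets n) (allFin n) ⟩
  sumV (λ v → sumS (λ s → y s * (if lookup s v then z v else 0)))
    ≡⟨ sumL-cong (λ v → trans (sumL-cong (λ s → if-swap (lookup s v) (y s) (z v)) (allSubsets n))
         (sumL-* (z v) _ (allSubsets n))) (allFin n) ⟩
  sumV (λ v → z v * load y v)   ≤⟨ sumL-mono (λ v → ≤-trans (*-monoʳ-≤ (z v) (cap v)) (≤-reflexive (*-comm (z v) (c v)))) (allFin n) ⟩
  cost c z                      ∎
  where
  open ≤-Reasoning
  each : ∀ s → d * y s ≤ y s * sumOn s z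
  each s with y s in e
  ... | zero  = ≤-reflexive (*-zeroʳ d)
  ... | suc k = ≤-trans (*-monoˡ-≤ (suc k) (h s (sup s (λ q → 1+n≢0 (trans (sym e) q))) supp))
                        (≤-reflexive (*-comm (sumOn s z) (suc k)))
    where
    -- A hyperedge used by the packing puts load on each of its vertices, so it lies in the support
    -- of `c`; the bound `d` has to be checked only on such hyperedges.
    supp : ∀ v → v ∈ₛ s → 1 ≤ c v
    supp v v∈s = ≤-trans (s≤s z≤n) (≤-trans (≤-reflexive (sym (trans (cong (if_then y s else 0) v∈s) e)))
      (≤-trans (term≤sumS s (λ s → if lookup s v then y s else 0)) (cap v)))

-- Matching covers and packings, and the removal of one hyperedge

Solvable : ∀ {n} → Hypergraph n → (Fin n → ℕ) → Set
Solvable {n} H c = Σ (Fin n → ℕ) λ x → Σ (Subset n → ℕ) λ y →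
  IsCover H x × IsPacking H c y × cost c x ≤ sumS y

weak-duality : ∀ {n} {H : Hypergraph n} {c x y} → IsCover H x → IsPacking H c y → sumS y ≤ cost c x
weak-duality {x = x} {y} cov pack =
  subst (_≤ _) (*-identityˡ (sumS y)) (packing-bound x 1 pack (λ s Hs _ → cov s Hs))

solvable⇒Mengerian : ∀ {n} {H : Hypergraph n} → (∀ c → Solvable H c) → Mengerian H
solvable⇒Mengerian sol c with sol c
... | x , y , cov , pack , le =
  x , y , (cov , λ x′ cov′ → ≤-trans le (weak-duality cov′ pack)) ,
  (pack , λ y′ pack′ → ≤-trans (weak-duality cov pack′) le) ,
  ≤-antisym le (weak-duality cov pack)

-- The indicator of the zero set of `c`, whose vertices enter a cover at no cost.
zeros : ∀ {n} → (Fin n → ℕ) → Fin n → ℕ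
zeros c v = 1 ∸ c v

*-zeros : ∀ k → k * (1 ∸ k) ≡ 0
*-zeros zero    = refl
*-zeros (suc k) = trans (cong (suc k *_) (0∸n≡0 k)) (*-zeroʳ (suc k))

cost-+ : ∀ {n} (c x x′ : Fin n → ℕ) → cost c (λ v → x v + x′ v) ≡ cost c x + cost c x′
cost-+ {n} c x x′ = trans (sumL-cong (λ v → *-distribˡ-+ (c v) (x v) (x′ v)) (allFin n))
  (sumL-+ _ _ (allFin n))

cost-zeros : ∀ {n} (c : Fin n → ℕ) → cost c (zeros c) ≡ 0
cost-zeros {n} c = trans (sumL-cong (λ v → *-zeros (c v)) (allFin n)) (sumL-0 (allFin n))

-- A hyperedge leaving the support of c is covered for free, so only hyperedges inside matter.
cover-support : ∀ {n} {H : Hypergraph n} (c x : Fin n → ℕ) →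
  (∀ s → H s → (∀ v → v ∈ₛ s → 1 ≤ c v) → Σ (Fin n) λ v → v ∈ₛ s × 1 ≤ x v) →
  IsCover H (λ v → x v + zeros c v)
cover-support {n} c x h s Hs with F.any? (λ v → (lookup s v B.≟ true) ×-dec (c v ≟ 0))
... | yes (v , v∈s , cv) = sumOn-hit s _ v v∈s
  (subst (λ k → 1 ≤ x v + (1 ∸ k)) (sym cv) (m≤n+m 1 (x v)))
... | no none with h s Hs (λ v v∈s → n≢0⇒n>0 (λ e → none (v , v∈s , e)))
...   | v , v∈s , p = sumOn-hit s _ v v∈s (≤-trans p (m≤m+n (x v) _))

indicator : ∀ {n} → Subset n → Fin n → ℕ
indicator s v = if lookup s v then 1 else 0

-- Since `s` lies in the support of `c`, the truncated subtraction is exact, and returning one copy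
-- of `s` uses precisely the capacity taken away.
add-edge : ∀ {n} {H : Hypergraph n} {c} s → H s → (∀ v → v ∈ₛ s → 1 ≤ c v) →
  ∀ {y} → IsPacking H (λ v → c v ∸ indicator s v) y →
  Σ (Subset n → ℕ) λ y′ → IsPacking H c y′ × sumS y′ ≡ suc (sumS y)
add-edge {n} {H} {c} s Hs supp {y} (sup , cap) = y′ , (sup′ , cap′) , tot
  where
  y′ : Subset n → ℕ
  y′ t = δS s t + y t
  sup′ : ∀ t → y′ t ≢ 0 → H t
  sup′ t p with δS s t in e
  ... | zero  = sup t p
  ... | suc _ = subst H (δS-≢0 s t (λ q → 1+n≢0 (trans (sym e) q))) Hs
  if-+ : ∀ b (k l : ℕ) → (if b then k + l else 0) ≡ k * (if b then 1 else 0) + (if b then l else 0)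
  if-+ true  k l = cong (_+ l) (sym (*-identityʳ k))
  if-+ false k l = sym (trans (+-identityʳ _) (*-zeroʳ k))
  load′ : ∀ v → load y′ v ≡ indicator s v + load y v
  load′ v = trans (sumL-cong (λ t → if-+ (lookup t v) (δS s t) (y t)) (allSubsets n))
    (trans (sumL-+ _ _ (allSubsets n)) (cong (_+ load y v) (sumS-δ s (λ t → if lookup t v then 1 else 0))))
  cap′ : ∀ v → load y′ v ≤ c v
  cap′ v = subst (_≤ c v) (sym (load′ v))
    (≤-trans (+-monoʳ-≤ (indicator s v) (cap v)) (≤-reflexive (m+[n∸m]≡n ind≤)))
    where
    ind≤ : indicator s v ≤ c v
    ind≤ with lookup s v in e
    ... | true  = supp v e
    ... | false = z≤n
  tot : sumS y′ ≡ suc (sumS y)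
  tot = trans (sumL-+ (δS s) y (allSubsets n)) (cong (_+ sumS y)
    (trans (sumL-cong (λ t → sym (*-identityʳ (δS s t))) (allSubsets n)) (sumS-δ s (λ _ → 1))))

-- The free cover and the empty packing both have value zero.
no-edge : ∀ {n} {H : Hypergraph n} c → (∀ s → H s → ¬ (∀ v → v ∈ₛ s → 1 ≤ c v)) → Solvable H c
no-edge {n} c none = zeros c , (λ _ → 0) , cover-support c (λ _ → 0) (λ s Hs p → ⊥-elim (none s Hs p)) ,
  ((λ s p → ⊥-elim (p refl)) , λ v → ≤-trans (≤-reflexive (trans (sumL-cong (λ s → lem (lookup s v)) (allSubsets n)) (sumL-0 (allSubsets n)))) z≤n) ,
  ≤-trans (≤-reflexive (cost-zeros c)) z≤n
  where
  lem : ∀ b → (if b then 0 else 0) ≡ 0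
  lem true  = refl
  lem false = refl

-- Only an inequality: where `c` vanishes on `s` the truncated subtraction removes nothing, while
-- `sumOn s x` still counts the vertex.
cost-split : ∀ {n} (c : Fin n → ℕ) s x → cost c x ≤ cost (λ v → c v ∸ indicator s v) x + sumOn s x
cost-split {n} c s x = ≤-trans (sumL-mono le (allFin n)) (≤-reflexive (sumL-+ _ _ (allFin n)))
  where
  le : ∀ v → c v * x v ≤ (c v ∸ indicator s v) * x v + (if lookup s v then x v else 0)
  le v with lookup s v
  ... | false = m≤m+n _ 0
  ... | true with c v
  ...   | zero  = z≤n
  ...   | suc k = ≤-reflexive (+-comm (x v) (k * x v))

cost-remove-< : ∀ {n} (c : Fin n → ℕ) s v → v ∈ₛ s → 1 ≤ c v →
  sumV (λ v → c v ∸ indicator s v) < sumV c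
cost-remove-< c s v v∈s p = sumV-monoStrict (λ u → m∸n≤m (c u) (indicator s u)) v lt
  where
  lt : c v ∸ indicator s v < c v
  lt rewrite v∈s = lem p
    where
    lem : ∀ {k} → 1 ≤ k → k ∸ 1 < k
    lem (s≤s _) = ≤-refl

-- After removing one copy of s, prune the cover on s to the single vertex b.
greedy-step : ∀ {n} {H : Hypergraph n} c s → H s → (∀ v → v ∈ₛ s → 1 ≤ c v) →
  (∀ x → IsCover H x → Σ (Fin n) λ b → ∀ t → H t → (∀ v → v ∈ₛ t → 1 ≤ c v) →
    Σ (Fin n) λ v → v ∈ₛ t × 1 ≤ x v × (v ∈ₛ s → v ≡ b)) →
  Solvable H (λ v → c v ∸ indicator s v) → Solvable H c
greedy-step {n} {H} c s Hs supp choose (x , y , cov , pack , le) with choose x cov | add-edge {c = c} s Hs supp pack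
... | b , hit | y′ , pack′ , tot = _ , y′ , cover-support c x″ hit″ , pack′ , le′
  where
  -- Capping at one and keeping only `b` on `s` makes the weight on `s` at most one, which is
  -- exactly what the packing gains from `s`.
  x″ : Fin n → ℕ
  x″ v = if lookup s v then δ b v * (x v ⊓ 1) else x v ⊓ 1
  1≤⊓ : ∀ {k} → 1 ≤ k → 1 ≤ k ⊓ 1
  1≤⊓ p = ⊓-glb p ≤-refl
  hit″ : ∀ t → H t → (∀ v → v ∈ₛ t → 1 ≤ c v) → Σ (Fin n) λ v → v ∈ₛ t × 1 ≤ x″ v
  hit″ t Ht p with hit t Ht p
  ... | v , v∈t , q , only = v , v∈t , pos
    where
    pos : 1 ≤ x″ v
    pos with lookup s v in e
    ... | false = 1≤⊓ q
    ... | true rewrite only refl | δ-refl b = ≤-trans (1≤⊓ q) (m≤m+n _ 0)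
  on≤1 : sumOn s x″ ≤ 1
  on≤1 = sumV≤1 b _ le1
    where
    le1 : ∀ v → (if lookup s v then x″ v else 0) ≤ δ b v
    le1 v with lookup s v
    ... | false = z≤n
    ... | true  = ≤-trans (*-monoʳ-≤ (δ b v) (m⊓n≤n (x v) 1)) (≤-reflexive (*-identityʳ _))
  x″≤x : ∀ v → x″ v ≤ x v
  x″≤x v with lookup s v | b F.≟ v
  ... | false | _     = m⊓n≤m (x v) 1
  ... | true  | yes _ = ≤-trans (≤-reflexive (*-identityˡ _)) (m⊓n≤m (x v) 1)
  ... | true  | no _  = z≤n
  le′ : cost c (λ v → x″ v + zeros c v) ≤ sumS y′
  le′ = begin
    cost c (λ v → x″ v + zeros c v)                    ≡⟨ cost-+ c x″ (zeros c) ⟩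
    cost c x″ + cost c (zeros c)                       ≡⟨ cong (cost c x″ +_) (cost-zeros c) ⟩
    cost c x″ + 0                                      ≡⟨ +-identityʳ _ ⟩
    cost c x″                                          ≤⟨ cost-split c s x″ ⟩
    cost (λ v → c v ∸ indicator s v) x″ + sumOn s x″
      ≤⟨ +-mono-≤ (sumL-mono (λ v → *-monoʳ-≤ (c v ∸ indicator s v) (x″≤x v)) (allFin n)) on≤1 ⟩
    cost (λ v → c v ∸ indicator s v) x + 1             ≤⟨ +-monoˡ-≤ 1 le ⟩
    sumS y + 1                                         ≡⟨ +-comm (sumS y) 1 ⟩
    suc (sumS y)                                       ≡⟨ tot ⟨
    sumS y′                                            ∎
    where open ≤-Reasoning

-- Levelled hypergraphs

least : (Q : ℕ → Set) → (∀ i → Dec (Q i)) → ∀ N →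
  (Σ ℕ λ i → Q i × (∀ j → j < i → ¬ Q j)) ⊎ (∀ j → j < N → ¬ Q j)
least Q Q? zero = inj₂ (λ _ ())
least Q Q? (suc N) with least Q Q? N
... | inj₁ found = inj₁ found
... | inj₂ none with Q? N
...   | yes q = inj₁ (N , q , none)
...   | no ¬q = inj₂ below
  where
  below : ∀ j → j < suc N → ¬ Q j
  below j j<1+N q with m≤n⇒m<n∨m≡n (≤-pred j<1+N)
  ... | inj₁ j<N = none j j<N q
  ... | inj₂ refl = ¬q q

-- The field `fits` says that the top level `3 + start` is at most `r + 1`, the upper outer level.
record Window {n} (level : Fin n → ℕ) (r : ℕ) (s : Subset n) : Set where
  constructor window
  field
    start : ℕ
    fits  : 2 + start ≤ r
    v₀ v₁ v₂ v₃ : Fin n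
    ∈₀ : v₀ ∈ₛ s
    ∈₁ : v₁ ∈ₛ s
    ∈₂ : v₂ ∈ₛ s
    ∈₃ : v₃ ∈ₛ s
    only : ∀ v → v ∈ₛ s → v ≡ v₀ ⊎ v ≡ v₁ ⊎ v ≡ v₂ ⊎ v ≡ v₃
    level₀ : level v₀ ≡ start
    level₁ : level v₁ ≡ 1 + start
    level₂ : level v₂ ≡ 2 + start
    level₃ : level v₃ ≡ 3 + start

-- The outer levels 0 and r + 1 may have several vertices; a hyperedge can use both of them
-- only for r = 2 (the double star), which is where exchange is needed.
record Levelled {n} (H : Hypergraph n) : Set where
  field
    H?     : ∀ s → Dec (H s)
    level  : Fin n → ℕ
    r      : ℕ
    windows : ∀ s → H s → Window level r s
    single : ∀ u v → 1 ≤ level u → level u ≤ r → level u ≡ level v → u ≡ v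
    exchange : r ≡ 2 → ∀ s s′ u u′ → H s → H s′ → u ∈ₛ s → level u ≡ 0 → u′ ∈ₛ s′ → level u′ ≡ 3 →
      Σ (Subset n) λ t → H t × (∀ v → v ∈ₛ t → v ≡ u ⊎ v ≡ u′ ⊎ (1 ≤ level v × level v ≤ 2))

module _ {n} {level : Fin n → ℕ} {r} {s : Subset n} (W : Window level r s) where
  open Window W

  level-bounds : ∀ {v} → v ∈ₛ s → start ≤ level v × level v ≤ 3 + start
  level-bounds {v} v∈s with only v v∈s
  ... | inj₁ refl               = ≤-reflexive (sym level₀) , ≤-trans (≤-reflexive level₀) (m≤n+m start 3)
  ... | inj₂ (inj₁ refl)        = ≤-trans (m≤n+m start 1) (≤-reflexive (sym level₁)) ,
                                  ≤-trans (≤-reflexive level₁) (s≤s (m≤n+m start 2))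
  ... | inj₂ (inj₂ (inj₁ refl)) = ≤-trans (m≤n+m start 2) (≤-reflexive (sym level₂)) ,
                                  ≤-trans (≤-reflexive level₂) (s≤s (s≤s (m≤n+m start 1)))
  ... | inj₂ (inj₂ (inj₂ refl)) = ≤-trans (m≤n+m start 3) (≤-reflexive (sym level₃)) , ≤-reflexive level₃

  on-level : ∀ {l} → start ≤ l → l ≤ 3 + start → Σ (Fin n) λ v → v ∈ₛ s × level v ≡ l
  on-level {l} lo hi with m≤n⇒m<n∨m≡n lo
  ... | inj₂ e = v₀ , ∈₀ , trans level₀ e
  ... | inj₁ lo₁ with m≤n⇒m<n∨m≡n lo₁
  ...   | inj₂ e = v₁ , ∈₁ , trans level₁ e
  ...   | inj₁ lo₂ with m≤n⇒m<n∨m≡n lo₂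
  ...     | inj₂ e = v₂ , ∈₂ , trans level₂ e
  ...     | inj₁ lo₃ = v₃ , ∈₃ , trans level₃ (≤-antisym lo₃ hi)

  top-unique : ∀ {v} → v ∈ₛ s → level v ≡ 3 + start → v ≡ v₃
  top-unique {v} v∈s e with only v v∈s
  ... | inj₁ refl               = ⊥-elim (m≢1+n+m start {2} (trans (sym level₀) e))
  ... | inj₂ (inj₁ refl)        = ⊥-elim (m≢1+n+m (1 + start) {1} (trans (sym level₁) e))
  ... | inj₂ (inj₂ (inj₁ refl)) = ⊥-elim (m≢1+n+m (2 + start) {0} (trans (sym level₂) e))
  ... | inj₂ (inj₂ (inj₂ refl)) = refl

  bottom-unique : ∀ {v} → v ∈ₛ s → level v ≡ start → v ≡ v₀
  bottom-unique {v} v∈s e with only v v∈s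
  ... | inj₁ refl               = refl
  ... | inj₂ (inj₁ refl)        = ⊥-elim (m≢1+n+m start {0} (trans (sym e) level₁))
  ... | inj₂ (inj₂ (inj₁ refl)) = ⊥-elim (m≢1+n+m start {1} (trans (sym e) level₂))
  ... | inj₂ (inj₂ (inj₂ refl)) = ⊥-elim (m≢1+n+m start {2} (trans (sym e) level₃))

Within : ∀ {n} → (Fin n → ℕ) → Subset n → Set
Within c s = ∀ v → v ∈ₛ s → 1 ≤ c v

within? : ∀ {n} (c : Fin n → ℕ) s → Dec (Within c s)
within? c s = F.all? (λ v → (lookup s v B.≟ true) →-dec (1 ≤? c v))

module _ {n} {H : Hypergraph n} (L : Levelled H) where
  open Levelled L

  module _ (c : Fin n → ℕ) {s : Subset n} (Hs : H s) (s⊆c : Within c s) (W : Window level r s)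
    (leftmost : ∀ t → H t → Within c t → (T : Window level r t) → Window.start W ≤ Window.start T)
    (x : Fin n → ℕ) (cov : IsCover H x) where
    open Window W

    -- The pruning condition of `greedy-step`: every hyperedge in the support stays covered when `b`
    -- is the only vertex of `s` kept in `x`.
    Keep : Fin n → Set
    Keep b = ∀ t → H t → Within c t → Σ (Fin n) λ v → v ∈ₛ t × 1 ≤ x v × (v ∈ₛ s → v ≡ b)

    -- A hyperedge whose levels include an inner level contains the only vertex there. Hence it is
    -- enough that every hyperedge hit on `s` spans the level of `b`.
    keep-inner : ∀ b → 1 ≤ x b → 1 ≤ level b → level b ≤ r →
      (∀ t → H t → Within c t → (T : Window level r t) → ∀ v → v ∈ₛ s → v ∈ₛ t → 1 ≤ x v →
        Window.start T ≤ level b × level b ≤ 3 + Window.start T) → Keep b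
    keep-inner b xb lo hi near t Ht t⊆c with sumOn-positive t x (cov t Ht)
    ... | v , v∈t , xv with lookup s v in e
    ...   | false = v , v∈t , xv , λ q → contradiction (trans (sym q) e) λ ()
    ...   | true with near t Ht t⊆c (windows t Ht) v e v∈t xv
    ...     | p , q with on-level (windows t Ht) p q
    ...       | w , w∈t , lw with single b w lo hi (sym lw)
    ...         | refl = b , w∈t , xb , λ _ → refl

    lift : ∀ {k} {b} → level b ≡ suc k + start → 1 ≤ level b
    lift e = ≤-trans (s≤s z≤n) (≤-reflexive (sym e))

    -- With the levels above b avoided by x, any hyperedge meeting the part of s below b contains b.
    below : ∀ k b → k ≤ 3 → level b ≡ k + start → (∀ v → v ∈ₛ s → 1 ≤ x v → level v ≤ level b) →
      ∀ t → H t → Within c t → (T : Window level r t) → ∀ v → v ∈ₛ s → v ∈ₛ t → 1 ≤ x v →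
        Window.start T ≤ level b × level b ≤ 3 + Window.start T
    below k b k≤3 e top t Ht t⊆c T v v∈s v∈t xv =
      ≤-trans (proj₁ (level-bounds T v∈t)) (top v v∈s xv) ,
      ≤-trans (≤-reflexive e) (+-mono-≤ k≤3 (leftmost t Ht t⊆c T))

    -- The window of `s` ends on level `r + 1`, so no window starts later; being leftmost, none
    -- starts earlier either.
    last-window : ¬ 3 + start ≤ r → ∀ t → H t → Within c t → (T : Window level r t) → Window.start T ≡ start
    last-window full t Ht t⊆c T = ≤-antisym
      (+-cancelˡ-≤ 2 _ _ (≤-trans (Window.fits T) (≤-pred (≰⇒> full)))) (leftmost t Ht t⊆c T)

    inside : ¬ 3 + start ≤ r → ∀ k b → k ≤ 3 → level b ≡ k + start →
      ∀ t → H t → Within c t → (T : Window level r t) → ∀ v → v ∈ₛ s → v ∈ₛ t → 1 ≤ x v →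
        Window.start T ≤ level b × level b ≤ 3 + Window.start T
    inside full k b k≤3 e t Ht t⊆c T v _ _ _ with last-window full t Ht t⊆c T
    ... | e′ = ≤-trans (≤-reflexive e′) (≤-trans (m≤n+m start k) (≤-reflexive (sym e))) ,
               ≤-trans (≤-reflexive e) (+-mono-≤ k≤3 (≤-reflexive (sym e′)))

    ≤r₂ : level v₂ ≤ r
    ≤r₂ = ≤-trans (≤-reflexive level₂) fits
    ≤r₁ : level v₁ ≤ r
    ≤r₁ = ≤-trans (≤-reflexive level₁) (≤-trans (n≤1+n _) fits)

    -- The double star: x contains all available leaves on one of the two sides.
    keep-double-star : ¬ 3 + start ≤ r → start ≡ 0 → ¬ 1 ≤ x v₁ → ¬ 1 ≤ x v₂ → Σ (Fin n) Keep
    keep-double-star full e ¬x₁ ¬x₂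
      with F.any? (λ u → (level u ≟ 3) ×-dec (¬? (1 ≤? x u) ×-dec
             anySubset? (λ t → H? t ×-dec (within? c t ×-dec (lookup t u B.≟ true)))))
    ... | no all = v₃ , λ t Ht t⊆c → let T = windows t Ht in
        Window.v₃ T , Window.∈₃ T , hit t Ht t⊆c T , λ q →
          top-unique W q (trans (Window.level₃ T) (cong (3 +_) (last-window full t Ht t⊆c T)))
      where
      hit : ∀ t → H t → Within c t → (T : Window level r t) → 1 ≤ x (Window.v₃ T)
      hit t Ht t⊆c T with 1 ≤? x (Window.v₃ T)
      ... | yes p = p
      ... | no ¬p = ⊥-elim (all (Window.v₃ T , trans (Window.level₃ T) (cong (3 +_) (trans (last-window full t Ht t⊆c T) e)) ,
                      ¬p , t , Ht , t⊆c , Window.∈₃ T))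
    -- Here `u` is an available top leaf missed by `x`. For every `t`, the exchanged hyperedge joins
    -- the bottom leaf of `t` to `u`; as `x` misses `u` and both middle vertices, it must contain
    -- that bottom leaf.
    ... | yes (u , lu , ¬xu , s′ , Hs′ , _ , u∈s′) = v₀ , λ t Ht t⊆c → let T = windows t Ht in
        Window.v₀ T , Window.∈₀ T , hit t Ht t⊆c T , λ q →
          bottom-unique W q (trans (Window.level₀ T) (last-window full t Ht t⊆c T))
      where
      r≡2 : r ≡ 2
      r≡2 = ≤-antisym (≤-trans (≤-pred (≰⇒> full)) (≤-reflexive (cong (2 +_) e)))
                      (≤-trans (≤-reflexive (sym (cong (2 +_) e))) fits)
      hit : ∀ t → H t → Within c t → (T : Window level r t) → 1 ≤ x (Window.v₀ T)
      hit t Ht t⊆c T with exchange r≡2 t s′ (Window.v₀ T) u Ht Hs′ (Window.∈₀ T)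
                            (trans (Window.level₀ T) (trans (last-window full t Ht t⊆c T) e)) u∈s′ lu
      ... | t′ , Ht′ , t′-only with sumOn-positive t′ x (cov t′ Ht′)
      ...   | v , v∈t′ , xv with t′-only v v∈t′
      ...     | inj₁ refl = xv
      ...     | inj₂ (inj₁ refl) = ⊥-elim (¬xu xv)
      ...     | inj₂ (inj₂ (lo , hi)) with m≤n⇒m<n∨m≡n lo
      ...       | inj₂ 1≡ = ⊥-elim (¬x₁ (subst (λ w → 1 ≤ x w)
                    (single v v₁ lo (≤-trans hi (≤-reflexive (sym r≡2))) (trans (sym 1≡) (sym (trans level₁ (cong suc e))))) xv))
      ...       | inj₁ 2≤ = ⊥-elim (¬x₂ (subst (λ w → 1 ≤ x w)
                    (single v v₂ lo (≤-trans hi (≤-reflexive (sym r≡2))) (trans (≤-antisym hi 2≤) (sym (trans level₂ (cong (2 +_) e))))) xv))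

    -- The highest vertex of `s` in `x` works if its level is inner, and a sole vertex of `s` in `x`
    -- always works. The delicate case is `v₃` on the outer level: then all available windows have
    -- the same start, so any inner vertex of `s` in `x` works, and what remains is that `x` meets
    -- `s` exactly in two ends on outer levels.
    choose : Σ (Fin n) Keep
    choose with 1 ≤? x v₃ | 1 ≤? x v₂ | 1 ≤? x v₁ | 1 ≤? x v₀
    choose | yes x₃ | x₂? | x₁? | x₀? with 3 + start ≤? r
    choose | yes x₃ | x₂? | x₁? | x₀? | yes inner = v₃ , keep-inner v₃ x₃ (lift level₃)
      (≤-trans (≤-reflexive level₃) inner)
      (below 3 v₃ ≤-refl level₃ (λ v v∈s _ → ≤-trans (proj₂ (level-bounds W v∈s)) (≤-reflexive (sym level₃))))
    choose | yes x₃ | yes x₂ | x₁? | x₀? | no full =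
      v₂ , keep-inner v₂ x₂ (lift level₂) ≤r₂ (inside full 2 v₂ (s≤s (s≤s z≤n)) level₂)
    choose | yes x₃ | no ¬x₂ | yes x₁ | x₀? | no full =
      v₁ , keep-inner v₁ x₁ (lift level₁) ≤r₁ (inside full 1 v₁ (s≤s z≤n) level₁)
    choose | yes x₃ | no ¬x₂ | no ¬x₁ | no ¬x₀ | no full = v₃ , kept
      where
      kept : Keep v₃
      kept t Ht t⊆c with sumOn-positive t x (cov t Ht)
      ... | v , v∈t , xv = v , v∈t , xv , λ q → at (only v q)
        where
        at : v ≡ v₀ ⊎ v ≡ v₁ ⊎ v ≡ v₂ ⊎ v ≡ v₃ → v ≡ v₃
        at (inj₁ refl)               = ⊥-elim (¬x₀ xv)
        at (inj₂ (inj₁ refl))        = ⊥-elim (¬x₁ xv)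
        at (inj₂ (inj₂ (inj₁ refl))) = ⊥-elim (¬x₂ xv)
        at (inj₂ (inj₂ (inj₂ e)))    = e
    choose | yes x₃ | no ¬x₂ | no ¬x₁ | yes x₀ | no full with start ≟ 0
    ... | yes e = keep-double-star full e ¬x₁ ¬x₂
    -- Above level zero the bottom vertex of `s` is on an inner level, hence alone there.
    ... | no e = v₀ , keep-inner v₀ x₀ (≤-trans (n≢0⇒n>0 e) (≤-reflexive (sym level₀)))
                  (≤-trans (≤-reflexive level₀) (≤-trans (m≤n+m start 2) fits)) (inside full 0 v₀ z≤n level₀)
    choose | no ¬x₃ | yes x₂ | x₁? | x₀? = v₂ , keep-inner v₂ x₂ (lift level₂) ≤r₂ (below 2 v₂ (s≤s (s≤s z≤n)) level₂ top)
      where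
      top : ∀ v → v ∈ₛ s → 1 ≤ x v → level v ≤ level v₂
      top v v∈s xv with only v v∈s
      ... | inj₁ refl               = ≤-trans (≤-reflexive level₀) (≤-trans (m≤n+m start 2) (≤-reflexive (sym level₂)))
      ... | inj₂ (inj₁ refl)        = ≤-trans (≤-reflexive level₁) (≤-trans (n≤1+n _) (≤-reflexive (sym level₂)))
      ... | inj₂ (inj₂ (inj₁ refl)) = ≤-refl
      ... | inj₂ (inj₂ (inj₂ refl)) = ⊥-elim (¬x₃ xv)
    choose | no ¬x₃ | no ¬x₂ | yes x₁ | x₀? = v₁ , keep-inner v₁ x₁ (lift level₁) ≤r₁ (below 1 v₁ (s≤s z≤n) level₁ top)
      where
      top : ∀ v → v ∈ₛ s → 1 ≤ x v → level v ≤ level v₁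
      top v v∈s xv with only v v∈s
      ... | inj₁ refl               = ≤-trans (≤-reflexive level₀) (≤-trans (n≤1+n start) (≤-reflexive (sym level₁)))
      ... | inj₂ (inj₁ refl)        = ≤-refl
      ... | inj₂ (inj₂ (inj₁ refl)) = ⊥-elim (¬x₂ xv)
      ... | inj₂ (inj₂ (inj₂ refl)) = ⊥-elim (¬x₃ xv)
    choose | no ¬x₃ | no ¬x₂ | no ¬x₁ | x₀? = v₀ , kept
      where
      kept : Keep v₀
      kept t Ht t⊆c with sumOn-positive t x (cov t Ht)
      ... | v , v∈t , xv = v , v∈t , xv , λ q → at (only v q)
        where
        at : v ≡ v₀ ⊎ v ≡ v₁ ⊎ v ≡ v₂ ⊎ v ≡ v₃ → v ≡ v₀
        at (inj₁ e)                  = e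
        at (inj₂ (inj₁ refl))        = ⊥-elim (¬x₁ xv)
        at (inj₂ (inj₂ (inj₁ refl))) = ⊥-elim (¬x₂ xv)
        at (inj₂ (inj₂ (inj₂ refl))) = ⊥-elim (¬x₃ xv)

  levelled-solvable : ∀ c → Solvable H c
  levelled-solvable c = go c (<-wellFounded (sumV c))
    where
    go : ∀ c → Acc _<_ (sumV c) → Solvable H c
    -- The search runs over levels of arbitrary vertices of supported hyperedges. The smallest such
    -- level is at least the start of the window of `s` and at most every other start, so this
    -- window is leftmost.
    go c (acc rec) with least (λ i → Σ (Subset n) λ s → H s × Within c s × Σ (Fin n) λ v → v ∈ₛ s × level v ≡ i)
      (λ i → anySubset? λ s → H? s ×-dec (within? c s ×-dec F.any? λ v → (lookup s v B.≟ true) ×-dec (level v ≟ i))) (suc r)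
    ... | inj₂ none = no-edge c λ s Hs s⊆c → let W = windows s Hs in
      none (Window.start W) (s≤s (≤-trans (m≤n+m _ 2) (Window.fits W)))
        (s , Hs , s⊆c , Window.v₀ W , Window.∈₀ W , Window.level₀ W)
    ... | inj₁ (i , (s , Hs , s⊆c , v , v∈s , lv) , smaller) =
      greedy-step c s Hs s⊆c (λ x cov → choose c Hs s⊆c W leftmost x cov)
        (go _ (rec (cost-remove-< c s v v∈s (s⊆c v v∈s))))
      where
      W = windows s Hs
      leftmost : ∀ t → H t → Within c t → (T : Window level r t) → Window.start W ≤ Window.start T
      leftmost t Ht t⊆c T = ≤-trans (proj₁ (level-bounds W v∈s)) (≤-trans (≤-reflexive lv)
        (≮⇒≥ λ lt → smaller (Window.start T) lt (t , Ht , t⊆c , Window.v₀ T , Window.∈₀ T , Window.level₀ T)))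

-- Paths on four vertices

_∈ₗ?_ : ∀ {n} (v : Fin n) xs → Dec (v ∈ xs)
_∈ₗ?_ = DecMem._∈?_ F._≟_

count : ∀ {n} → List (Fin n) → Fin n → ℕ
count xs v = sumL (λ u → δ u v) xs

count-∉ : ∀ {n} (xs : List (Fin n)) v → v ∉ xs → count xs v ≡ 0
count-∉ []       v v∉ = refl
count-∉ (x ∷ xs) v v∉ = cong₂ _+_ (δ-≢ (λ e → v∉ (here (sym e)))) (count-∉ xs v (v∉ ∘ there))

count-∈ : ∀ {n} (xs : List (Fin n)) v → v ∈ xs → 1 ≤ count xs v
count-∈ (x ∷ xs) v (here refl) = ≤-trans (≤-reflexive (sym (δ-refl v))) (m≤m+n _ _)
count-∈ (x ∷ xs) v (there p)   = ≤-trans (count-∈ xs v p) (m≤n+m _ (δ x v))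

count-positive : ∀ {n} (xs : List (Fin n)) v → 1 ≤ count xs v → v ∈ xs
count-positive xs v p with v ∈ₗ? xs
... | yes q = q
... | no ¬q = contradiction (≤-trans p (≤-reflexive (count-∉ xs v ¬q))) λ ()

count≤1 : ∀ {n} (xs : List (Fin n)) v → Distinct xs → count xs v ≤ 1
count≤1 []       v _ = z≤n
count≤1 (x ∷ xs) v (x∉ , d) with x F.≟ v
... | no _ = count≤1 xs v d
... | yes refl = s≤s (≤-reflexive (count-∉ xs v (λ p → x∉ v p refl)))

sumV-count : ∀ {n} (xs : List (Fin n)) (h : Fin n → ℕ) → sumV (λ v → count xs v * h v) ≡ sumL h xs
sumV-count {n} []       h = sumL-0 (allFin n)
sumV-count {n} (x ∷ xs) h = trans (sumL-cong (λ v → *-distribʳ-+ (h v) (δ x v) (count xs v)) (allFin n))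
  (trans (sumL-+ _ _ (allFin n)) (cong₂ _+_ (sumV-δ x h) (sumV-count xs h)))

sumL-1 : ∀ {A : Set} (xs : List A) → sumL (λ _ → 1) xs ≡ length xs
sumL-1 []       = refl
sumL-1 (_ ∷ xs) = cong suc (sumL-1 xs)

term≤sumL : ∀ {A : Set} (f : A → ℕ) {v xs} → v ∈ xs → f v ≤ sumL f xs
term≤sumL f (here refl) = m≤m+n _ _
term≤sumL f {xs = y ∷ _} (there q) = ≤-trans (term≤sumL f q) (m≤n+m _ (f y))

setOf : ∀ {n} → List (Fin n) → Subset n
setOf xs = tabulate (λ v → does (v ∈ₗ? xs))

∈ₛ-setOf : ∀ {n} {xs : List (Fin n)} {v} → v ∈ xs → v ∈ₛ setOf xs
∈ₛ-setOf {xs = xs} {v} p = trans (lookup∘tabulate _ v) (dec-true (v ∈ₗ? xs) p)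

setOf-∈ₛ : ∀ {n} {xs : List (Fin n)} {v} → v ∈ₛ setOf xs → v ∈ xs
setOf-∈ₛ {xs = xs} {v} p with v ∈ₗ? xs
... | yes q = q
... | no ¬q = contradiction (trans (sym p) (trans (lookup∘tabulate _ v) (dec-false (v ∈ₗ? xs) ¬q))) λ ()

card : ∀ {n} (s : Subset n) → ∣ s ∣ ≡ sumV (indicator s)
card []          = refl
card (true ∷ s)  = trans (cong suc (card s)) (sym (sumV-suc (indicator (true ∷ s))))
card (false ∷ s) = trans (card s) (sym (sumV-suc (indicator (false ∷ s))))

count≤indicator : ∀ {n} (xs : List (Fin n)) s → Distinct xs → (∀ v → v ∈ xs → v ∈ₛ s) → ∀ v → count xs v ≤ indicator s v
count≤indicator xs s d sub v with v ∈ₗ? xs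
... | yes p rewrite sub v p = count≤1 xs v d
... | no ¬p = ≤-trans (≤-reflexive (count-∉ xs v ¬p)) z≤n

card-setOf : ∀ {n} (xs : List (Fin n)) → Distinct xs → ∣ setOf xs ∣ ≡ length xs
card-setOf {n} xs d = trans (card (setOf xs)) (trans (sumL-cong eq (allFin n)) (trans (sumV-count xs (λ _ → 1)) (sumL-1 xs)))
  where
  eq : ∀ v → indicator (setOf xs) v ≡ count xs v * 1
  eq v = trans (≤-antisym ind≤ (count≤indicator xs (setOf xs) d (λ _ → ∈ₛ-setOf) v)) (sym (*-identityʳ _))
    where
    ind≤ : indicator (setOf xs) v ≤ count xs v
    ind≤ with lookup (setOf xs) v in e
    ... | false = z≤n
    ... | true  = count-∈ xs v (setOf-∈ₛ {xs = xs} e)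

length≤card : ∀ {n} (xs : List (Fin n)) s → Distinct xs → (∀ v → v ∈ xs → v ∈ₛ s) → length xs ≤ ∣ s ∣
length≤card {n} xs s d sub = subst₂ _≤_ (trans (sumV-count xs (λ _ → 1)) (sumL-1 xs)) (sym (card s))
  (sumL-mono (λ v → ≤-trans (≤-reflexive (*-identityʳ _)) (count≤indicator xs s d sub v)) (allFin n))

sumOn-≥ : ∀ {n} (xs : List (Fin n)) s z → Distinct xs → (∀ v → v ∈ xs → v ∈ₛ s) → sumL z xs ≤ sumOn s z
sumOn-≥ {n} xs s z d sub = subst (_≤ sumOn s z) (sumV-count xs z) (sumL-mono le (allFin n))
  where
  le : ∀ v → count xs v * z v ≤ (if lookup s v then z v else 0)
  le v with lookup s v | count≤indicator xs s d sub v
  ... | true  | p = ≤-trans (*-monoˡ-≤ (z v) p) (≤-reflexive (*-identityˡ (z v)))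
  ... | false | p rewrite n≤0⇒n≡0 p = z≤n

record Path4 {n} (G : Graph n) (a b c d : Fin n) : Set where
  constructor path4
  field
    distinct : Distinct (a ∷ b ∷ c ∷ d ∷ [])
    ab : Adj G a b
    bc : Adj G b c
    cd : Adj G c d

quad : ∀ {n} → Fin n → Fin n → Fin n → Fin n → List (Fin n)
quad a b c d = a ∷ b ∷ c ∷ d ∷ []

distinct4 : ∀ {n} {a b c d : Fin n} → a ≢ b → a ≢ c → a ≢ d → b ≢ c → b ≢ d → c ≢ d → Distinct (quad a b c d)
distinct4 ab ac ad bc bd cd =
  (λ { _ (here refl) → ab ; _ (there (here refl)) → ac ; _ (there (there (here refl))) → ad }) ,
  (λ { _ (here refl) → bc ; _ (there (here refl)) → bd }) , (λ { _ (here refl) → cd }) , (λ _ ()) , tt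

module _ {n} {a b c d : Fin n} where

  ∈quad : ∀ {v} → v ∈ quad a b c d → v ≡ a ⊎ v ≡ b ⊎ v ≡ c ⊎ v ≡ d
  ∈quad (here e)                         = inj₁ e
  ∈quad (there (here e))                 = inj₂ (inj₁ e)
  ∈quad (there (there (here e)))         = inj₂ (inj₂ (inj₁ e))
  ∈quad (there (there (there (here e)))) = inj₂ (inj₂ (inj₂ e))

  distinct-≢ : Distinct (quad a b c d) → a ≢ b × a ≢ c × a ≢ d × b ≢ c × b ≢ d × c ≢ d
  distinct-≢ (p , q , r , _) = p b (here refl) , p c (there (here refl)) , p d (there (there (here refl))) ,
    q c (here refl) , q d (there (here refl)) , r d (here refl)

path⇒H3 : ∀ {n} {G : Graph n} {a b c d} → Path4 G a b c d → H3 G (setOf (quad a b c d))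
path⇒H3 {a = a} {b} {c} {d} (path4 dis ab bc cd) = card-setOf (quad a b c d) dis , a , b , c , d , dis ,
  mem (here refl) , mem (there (here refl)) , mem (there (there (here refl))) , mem (there (there (there (here refl)))) , ab , bc , cd
  where
  mem : ∀ {v} → v ∈ quad a b c d → v S.∈ setOf (quad a b c d)
  mem {v} p = lookup⇒[]= v _ (∈ₛ-setOf p)

record PathIn {n} (G : Graph n) (s : Subset n) : Set where
  constructor pathIn
  field
    {a b c d} : Fin n
    path      : Path4 G a b c d
    ∈s        : ∀ v → v ∈ quad a b c d → v ∈ₛ s
    only      : ∀ v → v ∈ₛ s → v ∈ quad a b c d

H3⇒path : ∀ {n} {G : Graph n} s → H3 G s → PathIn G s
H3⇒path {n} s (c4 , a , b , c , d , dis , a∈ , b∈ , c∈ , d∈ , ab , bc , cd) = pathIn (path4 dis ab bc cd) sub only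
  where
  sub : ∀ v → v ∈ quad a b c d → v ∈ₛ s
  sub v p with ∈quad p
  ... | inj₁ refl = []=⇒lookup a∈
  ... | inj₂ (inj₁ refl) = []=⇒lookup b∈
  ... | inj₂ (inj₂ (inj₁ refl)) = []=⇒lookup c∈
  ... | inj₂ (inj₂ (inj₂ refl)) = []=⇒lookup d∈
  only : ∀ v → v ∈ₛ s → v ∈ quad a b c d
  only v v∈s with v ∈ₗ? quad a b c d
  ... | yes p = p
  ... | no v∉ = contradiction (≤-trans (length≤card (v ∷ quad a b c d) s ((λ { y p refl → v∉ p }) , dis) sub′) (≤-reflexive c4)) 1+n≰n
    where
    sub′ : ∀ u → u ∈ v ∷ quad a b c d → u ∈ₛ s
    sub′ u (here refl) = v∈s
    sub′ u (there p)   = sub u p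

distinct? : ∀ {n} (xs : List (Fin n)) → Dec (Distinct xs)
distinct? []       = yes tt
distinct? (x ∷ xs) = map′ (λ x∉ y p e → x∉ (subst (_∈ xs) (sym e) p)) (λ h p → h x p refl) (¬? (x ∈ₗ? xs)) ×-dec distinct? xs

H3? : ∀ {n} (G : Graph n) s → Dec (H3 G s)
H3? G s = (∣ s ∣ ≟ 4) ×-dec F.any? λ a → F.any? λ b → F.any? λ c → F.any? λ d →
  distinct? (quad a b c d) ×-dec (a ∈? s) ×-dec (b ∈? s) ×-dec (c ∈? s) ×-dec (d ∈? s) ×-dec
  (G a b B.≟ true) ×-dec (G b c B.≟ true) ×-dec (G c d B.≟ true)

path4? : ∀ {n} (G : Graph n) a b c d → Dec (Path4 G a b c d)
path4? G a b c d = map′ (λ (p , q , r , s) → path4 p q r s) (λ (path4 p q r s) → p , q , r , s)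
  (distinct? (quad a b c d) ×-dec (G a b B.≟ true) ×-dec (G b c B.≟ true) ×-dec (G c d B.≟ true))

PathCover : ∀ {n} → Graph n → (Fin n → ℕ) → Set
PathCover G x = ∀ {a b c d} → Path4 G a b c d → 1 ≤ sumL x (quad a b c d)

cover⇒pathCover : ∀ {n} {G : Graph n} {x} → IsCover (H3 G) x → PathCover G x
cover⇒pathCover {x = x} cov {a} {b} {c} {d} P with sumOn-positive (setOf (quad a b c d)) x (cov _ (path⇒H3 P))
... | v , v∈ , p = ≤-trans p (term≤sumL x (setOf-∈ₛ {xs = quad a b c d} v∈))

-- Evaluating the Mengerian property at the weight counting occurrences in ws.
certificate : ∀ {n} {G : Graph n} → Mengerian (H3 G) → (ws : List (Fin n)) (z : Fin n → ℕ) (k : ℕ) →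
  (∀ {a b c d} → Path4 G a b c d → (∀ v → v ∈ quad a b c d → v ∈ ws) → k ≤ sumL z (quad a b c d)) →
  Σ (Fin n → ℕ) λ x → PathCover G x × k * sumL x ws ≤ sumL z ws
certificate {n} {G} men ws z k h with men (count ws)
... | x , y , (cov , _) , (pack , _) , eq = x , cover⇒pathCover cov ,
  -- On the support, `z` divided by `k` is a fractional cover, so it bounds the packing `y`, whose
  -- size equals the cost of `x`.
  subst₂ (λ p q → k * p ≤ q) (trans (sym eq) (sumV-count ws x)) (sumV-count ws z) (packing-bound z k pack each)
  where
  each : ∀ s → H3 G s → (∀ v → v ∈ₛ s → 1 ≤ count ws v) → k ≤ sumOn s z
  each s Hs sup with H3⇒path s Hs
  ... | pathIn {a} {b} {c} {d} P sub _ =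
    ≤-trans (h P (λ v p → count-positive ws v (sup v (sub v p)))) (sumOn-≥ (quad a b c d) s z (Path4.distinct P) sub)

-- Odd minors

pattern #0 = here refl
pattern #1 = there (here refl)
pattern #2 = there (there (here refl))
pattern #3 = there (there (there (here refl)))

δ-sym : ∀ {n} (u v : Fin n) → δ u v ≡ δ v u
δ-sym u v with u F.≟ v
... | yes refl = sym (δ-refl u)
... | no u≢v   = sym (δ-≢ (u≢v ∘ sym))

sumL-count-swap : ∀ {n} (xs ys : List (Fin n)) → sumL (count xs) ys ≡ sumL (count ys) xs
sumL-count-swap xs ys = trans (sumL-swap (λ y x → δ x y) ys xs)
  (sumL-cong (λ x → sumL-cong (λ y → δ-sym x y) ys) xs)

sumL-++ : ∀ {A : Set} (f : A → ℕ) xs ys → sumL f (xs ++ ys) ≡ sumL f xs + sumL f ys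
sumL-++ f xs ys = trans (cong sum (map-++ f xs ys)) (sum-++ (map f xs) (map f ys))

sumL-mono-∈ : ∀ {A : Set} {f g : A → ℕ} xs → (∀ x → x ∈ xs → f x ≤ g x) → sumL f xs ≤ sumL g xs
sumL-mono-∈ []       h = z≤n
sumL-mono-∈ (x ∷ xs) h = +-mono-≤ (h x (here refl)) (sumL-mono-∈ xs (λ y p → h y (there p)))

sumL-hit : ∀ {A : Set} (f : A → ℕ) {xs} → 1 ≤ sumL f xs → Σ A λ v → v ∈ xs × 1 ≤ f v
sumL-hit f {x ∷ xs} p with 1 ≤? f x
... | yes q = x , here refl , q
... | no ¬q with sumL-hit f {xs} (subst (λ k → 1 ≤ k + sumL f xs) (n<1⇒n≡0 (≰⇒> ¬q)) p)
...   | v , v∈ , q = v , there v∈ , q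

-- The vertices of ps carry an odd cycle as a minor: weight 1 on ps, weight 2 on fs.
odd-minor : ∀ {n} {G : Graph n} → Mengerian (H3 G) → (t : ℕ) (ps fs : List (Fin n)) → length ps ≡ suc (2 * t) →
  Distinct ps → (∀ v → v ∈ fs → v ∉ ps) →
  (∀ {a b c d} → Path4 G a b c d → (∀ v → v ∈ quad a b c d → v ∈ ps ++ fs) → 2 ≤ sumL (count ps) (quad a b c d)) →
  (∀ x → PathCover G x → suc (2 * t) ≤ 2 * (sumL x ps + (sumL x fs + sumL x fs))) → ⊥
odd-minor {n} {G} men t ps fs len dis apart meets lower with certificate men (ps ++ fs ++ fs) (count ps) 2 meets′
  where
  meets′ : ∀ {a b c d} → Path4 G a b c d → (∀ v → v ∈ quad a b c d → v ∈ ps ++ fs ++ fs) → 2 ≤ sumL (count ps) (quad a b c d)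
  meets′ P sub = meets P (λ v p → merge (∈-++⁻ ps (sub v p)))
    where
    merge : ∀ {v} → v ∈ ps ⊎ v ∈ fs ++ fs → v ∈ ps ++ fs
    merge (inj₁ p) = ∈-++⁺ˡ p
    merge (inj₂ p) with ∈-++⁻ fs p
    ... | inj₁ q = ∈-++⁺ʳ ps q
    ... | inj₂ q = ∈-++⁺ʳ ps q
-- Twice the cost of `x` is at most `length ps`, because `count ps` vanishes on `fs`, and at least
-- `length ps` by `lower`.
... | x , cov , le = even≢odd (sumL x ps + (sumL x fs + sumL x fs)) t (≤-antisym
  (≤-trans (subst (λ k → 2 * k ≤ sumL (count ps) (ps ++ fs ++ fs)) (split x) le) upper) (lower x cov))
  where
  split : ∀ (f : Fin n → ℕ) → sumL f (ps ++ fs ++ fs) ≡ sumL f ps + (sumL f fs + sumL f fs)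
  split f = trans (sumL-++ f ps (fs ++ fs)) (cong (sumL f ps +_) (sumL-++ f fs fs))
  on-fs : sumL (count ps) fs ≤ 0
  on-fs = ≤-trans (sumL-mono-∈ fs (λ v p → ≤-reflexive (count-∉ ps v (apart v p)))) (≤-reflexive (sumL-0 fs))
  upper : sumL (count ps) (ps ++ fs ++ fs) ≤ suc (2 * t)
  upper = ≤-trans (≤-reflexive (split (count ps))) (≤-trans (+-mono-≤
    (≤-trans (sumL-mono (λ v → count≤1 ps v dis) ps) (≤-reflexive (trans (sumL-1 ps) len))) (+-mono-≤ on-fs on-fs))
    (≤-reflexive (+-identityʳ _)))

-- A hyperedge given by its vertices; their order along a path is left open.
record Edge4 {n} (G : Graph n) (a b c d : Fin n) : Set where
  constructor edge4
  field
    {e f g h} : Fin n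
    path : Path4 G e f g h
    sub  : ∀ v → v ∈ quad e f g h → v ∈ quad a b c d

edge : ∀ {n} {G : Graph n} {a b c d e f g h} → Path4 G e f g h →
  e ∈ quad a b c d → f ∈ quad a b c d → g ∈ quad a b c d → h ∈ quad a b c d → Edge4 G a b c d
edge P p q r s = edge4 P λ { _ #0 → p ; _ #1 → q ; _ #2 → r ; _ #3 → s }

edge-covered : ∀ {n} {G : Graph n} {a b c d} x → PathCover G x → Edge4 G a b c d → 1 ≤ sumL x (quad a b c d)
edge-covered x cov (edge4 {e} {f} {g} {h} P sub) with sumL-hit x {quad e f g h} (cov P)
... | v , v∈ , p = ≤-trans p (term≤sumL x (sub v v∈))

-- The count over `fs` is stated with `count xs` so that, for a path `xs`, distinctness bounds each
-- of its terms by one. This turns the length of a path into a lower bound on its hits in `ps`.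
path-counts : ∀ {n} (ps fs xs : List (Fin n)) → (∀ v → v ∈ xs → v ∈ ps ++ fs) →
  length xs ≤ sumL (count ps) xs + sumL (count xs) fs
path-counts ps fs xs sub = ≤-trans (≤-reflexive (sym (sumL-1 xs)))
  (≤-trans (sumL-mono-∈ xs each) (≤-reflexive (trans (sumL-+ (count ps) (count fs) xs) (cong (sumL (count ps) xs +_) (sumL-count-swap fs xs)))))
  where
  each : ∀ v → v ∈ xs → 1 ≤ count ps v + count fs v
  each v p with ∈-++⁻ ps (sub v p)
  ... | inj₁ q = ≤-trans (count-∈ ps v q) (m≤m+n _ _)
  ... | inj₂ q = ≤-trans (count-∈ fs v q) (m≤n+m _ (count ps v))

-- Without `a` and `b` the three sets become the edges of a triangle on `p`, `q`, `r`. A path inside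
-- the five vertices has at most two vertices outside the triangle, so it meets the triangle twice.
three-of-five : ∀ {n} {G : Graph n} → Mengerian (H3 G) → ∀ {p q r a b} → Distinct (p ∷ q ∷ r ∷ a ∷ b ∷ []) →
  Edge4 G q r a b → Edge4 G p r a b → Edge4 G p q a b → ⊥
three-of-five {n} {G} men {p} {q} {r} {a} {b} (p∉ , q∉ , r∉ , _) ep eq er =
  odd-minor men 1 (p ∷ q ∷ r ∷ []) (a ∷ b ∷ []) refl
    ((λ { _ #0 → p∉ q #0 ; _ #1 → p∉ r #1 }) , (λ { _ #0 → q∉ r #0 }) , (λ _ ()) , tt) apart meets lower
  where
  apart : ∀ v → v ∈ a ∷ b ∷ [] → v ∉ p ∷ q ∷ r ∷ []
  apart _ #0 #0 = p∉ a #2 refl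
  apart _ #0 #1 = q∉ a #1 refl
  apart _ #0 #2 = r∉ a #0 refl
  apart _ #1 #0 = p∉ b #3 refl
  apart _ #1 #1 = q∉ b #2 refl
  apart _ #1 #2 = r∉ b #1 refl
  meets : ∀ {e f g h} → Path4 G e f g h → (∀ v → v ∈ quad e f g h → v ∈ p ∷ q ∷ r ∷ a ∷ b ∷ []) →
    2 ≤ sumL (count (p ∷ q ∷ r ∷ [])) (quad e f g h)
  meets {e} {f} {g} {h} P sub = +-cancelʳ-≤ 2 2 _ (≤-trans (path-counts (p ∷ q ∷ r ∷ []) (a ∷ b ∷ []) xs sub)
    (+-monoʳ-≤ (sumL (count (p ∷ q ∷ r ∷ [])) xs) (+-mono-≤ (count≤1 xs a (Path4.distinct P)) (+-mono-≤ (count≤1 xs b (Path4.distinct P)) z≤n))))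
    where xs = quad e f g h
  lower : ∀ x → PathCover G x → 3 ≤ 2 * (sumL x (p ∷ q ∷ r ∷ []) + (sumL x (a ∷ b ∷ []) + sumL x (a ∷ b ∷ [])))
  lower x cov = ≤-trans (+-mono-≤ (edge-covered x cov ep) (+-mono-≤ (edge-covered x cov eq) (edge-covered x cov er)))
    (≤-trans (m≤m+n _ (x a + x b)) (≤-reflexive (ring (x p) (x q) (x r) (x a) (x b))))
    where
    ring : ∀ p q r a b → q + (r + (a + (b + 0))) + (p + (r + (a + (b + 0))) + (p + (q + (a + (b + 0))))) + (a + b) ≡
      2 * (p + (q + (r + 0)) + (a + (b + 0) + (a + (b + 0))))
    ring = solve-∀

path-neighbour : ∀ {n} {G : Graph n} → IsSimple G → ∀ {a b c d} → Path4 G a b c d → ∀ v → v ∈ quad a b c d →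
  Σ (Fin n) λ w → w ∈ quad a b c d × Adj G v w
path-neighbour (sm , _) {a} {b} {c} {d} (path4 _ ab bc cd) v p with ∈quad p
... | inj₁ refl               = b , #1 , ab
... | inj₂ (inj₁ refl)        = c , #2 , bc
... | inj₂ (inj₂ (inj₁ refl)) = d , #3 , cd
... | inj₂ (inj₂ (inj₂ refl)) = c , #2 , trans (sm d c) cd

-- The paths `l u w m`, `l u w u′` and `m w u′ l′` restrict to a triangle on `u`, `m`, `u′`. Among
-- the six vertices a path through `l` also uses `u`, and one through `l′` also uses `u′`; so a path
-- with at most one vertex in the triangle would have at most three vertices in all.
no-spider : ∀ {n} {G : Graph n} → IsSimple G → Mengerian (H3 G) → ∀ {l u w u′ l′ m} →
  Distinct (l ∷ u ∷ w ∷ u′ ∷ l′ ∷ m ∷ []) →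
  Adj G l u → Adj G u w → Adj G w u′ → Adj G u′ l′ → Adj G w m →
  (∀ v → v ∈ (l ∷ u ∷ w ∷ u′ ∷ l′ ∷ m ∷ []) → Adj G l v → v ≡ u) →
  (∀ v → v ∈ (l ∷ u ∷ w ∷ u′ ∷ l′ ∷ m ∷ []) → Adj G l′ v → v ≡ u′) → ⊥
no-spider {n} {G} simple@(sm , _) men {l} {u} {w} {u′} {l′} {m} (l∉ , u∉ , w∉ , u′∉ , l′∉ , _) lu uw wu′ u′l′ wm l-leaf l′-leaf =
  odd-minor men 1 ps fs refl ((λ { _ #0 → u∉ m #3 ; _ #1 → u∉ u′ #1 }) , (λ { _ #0 → ≢-sym (u′∉ m #1) }) , (λ _ ()) , tt) apart meets lower
  where
  ps = u ∷ m ∷ u′ ∷ []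
  fs = l ∷ w ∷ l′ ∷ []
  apart : ∀ v → v ∈ fs → v ∉ ps
  apart _ #0 #0 = l∉ u #0 refl
  apart _ #0 #1 = l∉ m (there #3) refl
  apart _ #0 #2 = l∉ u′ #2 refl
  apart _ #1 #0 = u∉ w #0 refl
  apart _ #1 #1 = w∉ m #2 refl
  apart _ #1 #2 = w∉ u′ #0 refl
  apart _ #2 #0 = u∉ l′ #2 refl
  apart _ #2 #1 = l′∉ m #0 refl
  apart _ #2 #2 = u′∉ l′ #0 refl
  six : ∀ v → v ∈ ps ++ fs → v ∈ (l ∷ u ∷ w ∷ u′ ∷ l′ ∷ m ∷ [])
  six _ #0 = #1
  six _ #1 = there (there #3)
  six _ #2 = #3
  six _ #3 = #0
  six _ (there #3) = #2
  six _ (there (there #3)) = there #3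
  meets : ∀ {e f g h} → Path4 G e f g h → (∀ v → v ∈ quad e f g h → v ∈ ps ++ fs) → 2 ≤ sumL (count ps) (quad e f g h)
  meets {e} {f} {g} {h} P sub = ≮⇒≥ (λ lt → 1+n≰n (begin
      4                                                            ≤⟨ path-counts ps fs xs sub ⟩
      sumL (count ps) xs + (cnt l + (cnt w + (cnt l′ + 0)))
        ≤⟨ +-mono-≤ (≤-pred lt) (+-mono-≤ l≤ (+-mono-≤ (count≤1 xs w dis) (+-monoˡ-≤ 0 l′≤))) ⟩
      1 + (cnt u + (1 + (cnt u′ + 0)))                             ≡⟨ ring (cnt u) (cnt u′) ⟩
      2 + (cnt u + (0 + (cnt u′ + 0)))
        ≤⟨ +-monoʳ-≤ 2 (+-monoʳ-≤ (cnt u) (+-monoˡ-≤ (cnt u′ + 0) (z≤n {cnt m}))) ⟩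
      2 + sumL cnt ps                                              ≡⟨ cong (2 +_) (sumL-count-swap xs ps) ⟩
      2 + sumL (count ps) xs                                       ≤⟨ +-monoʳ-≤ 2 (≤-pred lt) ⟩
      3                                                            ∎))
    where
    open ≤-Reasoning
    xs = quad e f g h
    cnt = count xs
    dis = Path4.distinct P
    ring : ∀ a b → 1 + (a + (1 + (b + 0))) ≡ 2 + (a + (0 + (b + 0)))
    ring = solve-∀
    attached : ∀ l u → (∀ v → v ∈ xs → Adj G l v → v ≡ u) → cnt l ≤ cnt u
    attached l u leaf with l ∈ₗ? xs
    ... | no l∉xs = ≤-trans (≤-reflexive (count-∉ xs l l∉xs)) z≤n
    ... | yes l∈xs with path-neighbour simple P l l∈xs
    ...   | v , v∈xs , lv = ≤-trans (count≤1 xs l dis) (count-∈ xs u (subst (_∈ xs) (leaf v v∈xs lv) v∈xs))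
    l≤ : cnt l ≤ cnt u
    l≤ = attached l u λ v p → l-leaf v (six v (sub v p))
    l′≤ : cnt l′ ≤ cnt u′
    l′≤ = attached l′ u′ λ v p → l′-leaf v (six v (sub v p))
  lower : ∀ x → PathCover G x → 3 ≤ 2 * (sumL x ps + (sumL x fs + sumL x fs))
  lower x cov = ≤-trans (+-mono-≤ (cov P₁) (+-mono-≤ (cov P₂) (cov P₃)))
    (≤-trans (m≤m+n _ (x l + x l + x w + (x l′ + x l′ + x l′))) (≤-reflexive (ring (x l) (x u) (x w) (x u′) (x l′) (x m))))
    where
    P₁ : Path4 G l u w m
    P₁ = path4 (distinct4 (l∉ u #0) (l∉ w #1) (l∉ m (there #3)) (u∉ w #0) (u∉ m #3) (w∉ m #2)) lu uw wm
    P₂ : Path4 G l u w u′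
    P₂ = path4 (distinct4 (l∉ u #0) (l∉ w #1) (l∉ u′ #2) (u∉ w #0) (u∉ u′ #1) (w∉ u′ #0)) lu uw wu′
    P₃ : Path4 G m w u′ l′
    P₃ = path4 (distinct4 (≢-sym (w∉ m #2)) (≢-sym (u′∉ m #1)) (≢-sym (l′∉ m #0)) (w∉ u′ #0) (w∉ l′ #1) (u′∉ l′ #0))
      (trans (sm m w) wm) wu′ u′l′
    ring : ∀ l u w u′ l′ m → l + (u + (w + (m + 0))) + (l + (u + (w + (u′ + 0))) + (m + (w + (u′ + (l′ + 0))))) + (l + l + w + (l′ + l′ + l′)) ≡
      2 * (u + (m + (u′ + 0)) + (l + (w + (l′ + 0)) + (l + (w + (l′ + 0)))))
    ring = solve-∀

-- Cycles

CycleOfLength : ∀ {n} → Graph n → ℕ → Set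
CycleOfLength {n} G k = Σ (Fin n) λ v → Σ (List (Fin n)) λ ws →
  suc (length ws) ≡ k × Distinct (v ∷ ws) × Chain G ((v ∷ ws) ++ (v ∷ []))

anyList? : ∀ {n} m {P : List (Fin n) → Set} → (∀ xs → Dec (P xs)) →
  Dec (Σ (List (Fin n)) λ xs → length xs ≡ m × P xs)
anyList? zero P? = map′ (λ p → [] , refl , p) (λ { ([] , _ , p) → p }) (P? [])
anyList? (suc m) P? = map′ (λ (v , xs , e , p) → v ∷ xs , cong suc e , p)
  (λ { (v ∷ xs , e , p) → v , xs , suc-injective e , p })
  (F.any? λ v → anyList? m λ xs → P? (v ∷ xs))

chain? : ∀ {n} (G : Graph n) xs → Dec (Chain G xs)
chain? G []           = yes tt
chain? G (x ∷ [])     = yes tt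
chain? G (x ∷ y ∷ xs) = (G x y B.≟ true) ×-dec chain? G (y ∷ xs)

cycleOfLength? : ∀ {n} (G : Graph n) k → Dec (CycleOfLength G k)
cycleOfLength? G zero    = no λ { (_ , _ , () , _) }
cycleOfLength? G (suc m) = F.any? λ v → map′ (λ (ws , e , p) → ws , cong suc e , p)
  (λ (ws , e , p) → ws , suc-injective e , p)
  (anyList? m λ ws → distinct? (v ∷ ws) ×-dec chain? G ((v ∷ ws) ++ (v ∷ [])))

Shortest : ∀ {n} → Graph n → ℕ → Set
Shortest G k = (3 ≤ k × CycleOfLength G k) × (∀ j → j < k → ¬ (3 ≤ j × CycleOfLength G j))

distinct-length : ∀ {n} (xs : List (Fin n)) → Distinct xs → length xs ≤ n
distinct-length xs d = subst (_≤ _) (card-setOf xs d) (∣p∣≤n (setOf xs))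

shortest-cycle : ∀ {n} (G : Graph n) → (Σ ℕ (Shortest G)) ⊎ (¬ HasCycle G)
shortest-cycle {n} G with least (λ k → 3 ≤ k × CycleOfLength G k) (λ k → (3 ≤? k) ×-dec cycleOfLength? G k) (suc n)
... | inj₁ found = inj₁ found
... | inj₂ none  = inj₂ λ (v , ws , 2≤ , dis , ch) →
  none (suc (length ws)) (s≤s (distinct-length (v ∷ ws) dis)) (s≤s 2≤ , v , ws , refl , dis , ch)

module _ {n} (g : ℕ → Fin n) where

  segment : ℕ → ℕ → List (Fin n)
  segment zero    i = []
  segment (suc L) i = g i ∷ segment L (suc i)

  length-segment : ∀ L i → length (segment L i) ≡ L
  length-segment zero    i = refl
  length-segment (suc L) i = cong suc (length-segment L (suc i))

  segment-∈ : ∀ {v} L i → v ∈ segment L i → Σ ℕ λ d → d < L × v ≡ g (d + i)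
  segment-∈ (suc L) i (here e) = 0 , s≤s z≤n , e
  segment-∈ (suc L) i (there p) with segment-∈ L (suc i) p
  ... | d , d<L , e = suc d , s≤s d<L , trans e (cong g (+-suc d i))

  ∈-segment : ∀ L i d → d < L → g (d + i) ∈ segment L i
  ∈-segment (suc L) i zero    _         = here refl
  ∈-segment (suc L) i (suc d) (s≤s d<L) = there (subst (λ j → g j ∈ segment L (suc i)) (+-suc d i) (∈-segment L (suc i) d d<L))

  segment-distinct : ∀ L i → (∀ j d → i ≤ j → 0 < d → d + j < L + i → g j ≢ g (d + j)) → Distinct (segment L i)
  segment-distinct zero    i inj = tt
  segment-distinct (suc L) i inj = first ,
    segment-distinct L (suc i) (λ j d lo pos hi → inj j d (≤-trans (n≤1+n i) lo) pos (≤-trans hi (≤-reflexive (+-suc L i))))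
    where
    first : ∀ y → y ∈ segment L (suc i) → g i ≢ y
    first y p e with segment-∈ L (suc i) p
    ... | d , d<L , e′ = inj i (suc d) ≤-refl (s≤s z≤n) (s≤s (+-monoˡ-< i d<L)) (trans e (trans e′ (cong g (+-suc d i))))

  segment-chain : ∀ {G : Graph n} {v} L i → (∀ j → i ≤ j → j < L + i → Adj G (g j) (g (suc j))) → Adj G (g (L + i)) v →
    Chain G (segment (suc L) i ++ (v ∷ []))
  segment-chain zero    i adj last = last , tt
  segment-chain {G} {v} (suc L) i adj last = adj i ≤-refl (s≤s (m≤n+m i L)) ,
    segment-chain L (suc i) (λ j lo hi → adj j (≤-trans (n≤1+n i) lo) (≤-trans hi (≤-reflexive (+-suc L i))))
      (subst (λ j → Adj G (g j) v) (sym (+-suc L i)) last)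

  segment-cycle : ∀ {G : Graph n} L i → (∀ j d → i ≤ j → 0 < d → d + j < suc L + i → g j ≢ g (d + j)) →
    (∀ j → i ≤ j → j < L + i → Adj G (g j) (g (suc j))) → Adj G (g (L + i)) (g i) → CycleOfLength G (suc L)
  segment-cycle L i inj adj close = g i , segment L (suc i) , cong suc (length-segment L (suc i)) ,
    segment-distinct (suc L) i inj , segment-chain L i adj close

-- A cycle as a periodic sequence on all of ℕ, so that windows and arcs need no separate treatment
-- when they wrap around.
record Cycle {n} (G : Graph n) (k : ℕ) (g : ℕ → Fin n) : Set where
  field
    per : ∀ i → g (k + i) ≡ g i
    adj : ∀ i → Adj G (g i) (g (suc i))
    inj : ∀ i d → 0 < d → d < k → g i ≢ g (d + i)

module _ {n} (o : Fin n) where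

  nth : List (Fin n) → ℕ → Fin n
  nth []       _       = o
  nth (x ∷ xs) zero    = x
  nth (x ∷ xs) (suc i) = nth xs i

  nth-∈ : ∀ xs i → i < length xs → nth xs i ∈ xs
  nth-∈ (x ∷ xs) zero    _         = here refl
  nth-∈ (x ∷ xs) (suc i) (s≤s i<) = there (nth-∈ xs i i<)

  ∈-nth : ∀ {v} xs → v ∈ xs → Σ ℕ λ i → i < length xs × v ≡ nth xs i
  ∈-nth (x ∷ xs) (here e) = 0 , s≤s z≤n , e
  ∈-nth (x ∷ xs) (there p) with ∈-nth xs p
  ... | i , i< , e = suc i , s≤s i< , e

  nth-distinct : ∀ xs i d → Distinct xs → 0 < d → d + i < length xs → nth xs i ≢ nth xs (d + i)
  nth-distinct (x ∷ xs) zero (suc d) (x∉ , _) _ (s≤s lt) =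
    x∉ _ (nth-∈ xs (d + 0) lt)
  nth-distinct (x ∷ xs) (suc i) d (_ , dis) pos lt e rewrite +-suc d i =
    nth-distinct xs i d dis pos (≤-pred lt) e

  nth-injective : ∀ xs i j → Distinct xs → i < length xs → j < length xs → nth xs i ≡ nth xs j → i ≡ j
  nth-injective xs i j dis i< j< e with <-cmp i j
  ... | tri≈ _ i≡j _ = i≡j
  ... | tri< i<j _ _ = ⊥-elim (nth-distinct xs i (j ∸ i) dis (m<n⇒0<n∸m i<j)
          (subst (_< length xs) (sym (m∸n+n≡m (<⇒≤ i<j))) j<) (trans e (cong (nth xs) (sym (m∸n+n≡m (<⇒≤ i<j))))))
  ... | tri> _ _ j<i = ⊥-elim (nth-distinct xs j (i ∸ j) dis (m<n⇒0<n∸m j<i)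
          (subst (_< length xs) (sym (m∸n+n≡m (<⇒≤ j<i))) i<) (trans (sym e) (cong (nth xs) (sym (m∸n+n≡m (<⇒≤ j<i))))))

  nth-chain : ∀ {G : Graph n} xs i → Chain G xs → suc i < length xs → Adj G (nth xs i) (nth xs (suc i))
  nth-chain (x ∷ [])     i       _        (s≤s ())
  nth-chain (x ∷ y ∷ xs) zero    (p , _)  _         = p
  nth-chain (x ∷ y ∷ xs) (suc i) (_ , ch) (s≤s lt) = nth-chain (y ∷ xs) i ch lt

  nth-++ˡ : ∀ xs ys i → i < length xs → nth (xs ++ ys) i ≡ nth xs i
  nth-++ˡ (x ∷ xs) ys zero    _        = refl
  nth-++ˡ (x ∷ xs) ys (suc i) (s≤s i<) = nth-++ˡ xs ys i i<

  nth-last : ∀ xs v → nth (xs ++ (v ∷ [])) (length xs) ≡ v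
  nth-last []       v = refl
  nth-last (x ∷ xs) v = nth-last xs v

suc-% : ∀ i k .{{_ : NonZero k}} → suc i % k ≡ suc (i % k) % k
suc-% i k = trans (cong (λ j → suc j % k) (m≡m%n+[m/n]*n i k)) ([m+kn]%n≡m%n (suc (i % k)) (i / k) k)

%-shift-≢ : ∀ i d k .{{_ : NonZero k}} → 0 < d → d < k → i % k ≢ (d + i) % k
%-shift-≢ i d k pos d<k e = bad (trans e shift)
  where
  j = i % k
  shift : (d + i) % k ≡ (d + j) % k
  shift = trans (cong (λ l → (d + l) % k) (m≡m%n+[m/n]*n i k))
    (trans (cong (_% k) (sym (+-assoc d j _))) ([m+kn]%n≡m%n (d + j) (i / k) k))
  bad : j ≢ (d + j) % k
  bad eq with d + j <? k
  ... | yes lt = <⇒≢ (+-monoˡ-≤ j pos) (trans eq (m<n⇒m%n≡m lt))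
  ... | no ge = <⇒≢ lt′ (sym (trans eq (trans (cong (_% k) (sym eq″)) (trans ([m+n]%n≡m%n r k) (m<n⇒m%n≡m (≤-trans lt′ (<⇒≤ (m%n<n i k))))))))
    where
    r = d + j ∸ k
    eq″ : r + k ≡ d + j
    eq″ = m∸n+n≡m (≮⇒≥ ge)
    lt′ : r < j
    lt′ = +-cancelʳ-< k r j (≤-trans (s≤s (≤-reflexive eq″)) (≤-trans (+-monoˡ-< j d<k) (≤-reflexive (+-comm k j))))

cycle-sequence : ∀ {n} {G : Graph n} {k} → CycleOfLength G k → Σ (ℕ → Fin n) (Cycle G k)
cycle-sequence {n} {G} (v , ws , refl , dis , ch) = g , record { per = per ; adj = adj ; inj = inj }
  where
  xs = v ∷ ws
  k  = suc (length ws)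
  g : ℕ → Fin n
  g i = nth v xs (i % k)
  per : ∀ i → g (k + i) ≡ g i
  per i = cong (nth v xs) (trans (cong (_% k) (+-comm k i)) ([m+n]%n≡m%n i k))
  step-adj : ∀ j → j < k → Adj G (nth v xs j) (nth v xs (suc j % k))
  step-adj j j<k with nth-chain v (xs ++ (v ∷ [])) j ch (subst (suc j <_) (sym (trans (length-++ xs) (+-comm k 1))) (s≤s j<k))
  ... | a with m≤n⇒m<n∨m≡n j<k
  ...   | inj₁ 1+j<k = subst₂ (Adj G) (nth-++ˡ v xs _ j j<k)
          (trans (nth-++ˡ v xs _ (suc j) 1+j<k) (cong (nth v xs) (sym (m<n⇒m%n≡m 1+j<k)))) a
  ...   | inj₂ refl = subst₂ (Adj G) (nth-++ˡ v xs _ j j<k)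
          (trans (nth-last v xs v) (cong (nth v xs) (sym (n%n≡0 k)))) a
  adj : ∀ i → Adj G (g i) (g (suc i))
  adj i = subst (λ j → Adj G (g i) (nth v xs j)) (sym (suc-% i k)) (step-adj (i % k) (m%n<n i k))
  inj : ∀ i d → 0 < d → d < k → g i ≢ g (d + i)
  inj i d pos d<k e = %-shift-≢ i d k pos d<k (nth-injective v xs (i % k) ((d + i) % k) dis (m%n<n i k) (m%n<n (d + i) k) e)

module CycleProps {n} {G : Graph n} (simple : IsSimple G) {k} {g : ℕ → Fin n} (C : Cycle G (suc k) g) where
  open Cycle C

  per* : ∀ m i → g (m * suc k + i) ≡ g i
  per* zero    i = refl
  per* (suc m) i = trans (cong g (+-assoc (suc k) (m * suc k) i)) (trans (per _) (per* m i))

  reduce : ∀ e i → g (e + i) ≡ g (e % suc k + i)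
  reduce e i = trans (cong (λ j → g (j + i)) (trans (m≡m%n+[m/n]*n e (suc k)) (+-comm (e % suc k) _)))
    (trans (cong g (+-assoc (e / suc k * suc k) (e % suc k) i)) (per* (e / suc k) (e % suc k + i)))

  offset : ∀ i j → Σ ℕ λ d → d < suc k × (∀ t → g (t + j) ≡ g (t + (d + i)))
  offset i j = e % suc k , m%n<n e (suc k) , λ t →
    trans (sym (per* i (t + j))) (trans (cong g (eq t)) (trans (reduce e (t + i)) (cong g (swap (e % suc k) t i))))
    where
    -- This represents `j - i` modulo `suc k` without subtraction.
    e = i * k + j
    eq : ∀ t → i * suc k + (t + j) ≡ e + (t + i)
    eq t = ring i k t j
      where
      ring : ∀ i k t j → i * (1 + k) + (t + j) ≡ i * k + j + (t + i)
      ring = solve-∀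
    swap : ∀ d t i → d + (t + i) ≡ t + (d + i)
    swap = solve-∀

  offset-0 : ∀ i d → d < suc k → g i ≡ g (d + i) → d ≡ 0
  offset-0 i zero    _  _ = refl
  offset-0 i (suc d) lt e = ⊥-elim (inj i (suc d) (s≤s z≤n) lt e)

  offset-< : ∀ i {d e} → d < e → e < suc k → g (d + i) ≢ g (e + i)
  offset-< i {d} {e} d<e e<k eq = inj (d + i) (e ∸ d) (m<n⇒0<n∸m d<e) (≤-<-trans (m∸n≤m e d) e<k)
    (trans eq (cong g (trans (cong (_+ i) (sym (m∸n+n≡m (<⇒≤ d<e)))) (+-assoc (e ∸ d) d i))))

  offset-unique : ∀ i {d e} → d < suc k → e < suc k → g (d + i) ≡ g (e + i) → d ≡ e
  offset-unique i {d} {e} d<k e<k eq with <-cmp d e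
  ... | tri< d<e _ _ = ⊥-elim (offset-< i d<e e<k eq)
  ... | tri≈ _ d≡e _ = d≡e
  ... | tri> _ _ e<d = ⊥-elim (offset-< i e<d d<k (sym eq))

  g-injective : ∀ {a b} → a < suc k → b < suc k → g a ≡ g b → a ≡ b
  g-injective {a} {b} a<k b<k e = offset-unique 0 a<k b<k (subst₂ (λ l m → g l ≡ g m) (sym (+-identityʳ a)) (sym (+-identityʳ b)) e)

  reduce₀ : ∀ i → g i ≡ g (i % suc k)
  reduce₀ i = subst₂ (λ a b → g a ≡ g b) (+-identityʳ i) (+-identityʳ _) (reduce i 0)

  pred-unique : ∀ i j → g (suc i) ≡ g (suc j) → g i ≡ g j
  pred-unique i j e with offset i j
  ... | d , d<k , sh with offset-0 (suc i) d d<k (trans e (trans (sh 1) (cong g (sym (+-suc d i)))))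
  ...   | refl = sym (sh 0)

  Chordless : Set
  Chordless = ∀ i j → Adj G (g i) (g j) → g j ≡ g (suc i) ⊎ g i ≡ g (suc j)

  -- A chord would close one of the two arcs into a shorter cycle.
  shortest⇒chordless : (∀ j → j < suc k → ¬ (3 ≤ j × CycleOfLength G j)) → Chordless
  shortest⇒chordless none i j a with offset i j
  ... | zero , _ , sh = contradiction (trans (sym a) (trans (cong (G (g i)) (sh 0)) (proj₂ simple (g i)))) λ ()
  ... | suc zero , _ , sh = inj₁ (sh 0)
  ... | suc (suc d) , d<k , sh with m≤n⇒m<n∨m≡n d<k
  ...   | inj₂ e = inj₂ (sym (trans (sh 1) (trans (cong (λ l → g (l + i)) e) (per i))))
  ...   | inj₁ lt = ⊥-elim (none (3 + d) lt (s≤s (s≤s (s≤s z≤n)) ,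
          segment-cycle g (2 + d) i arc-inj (λ j _ _ → adj j) (trans (proj₁ simple _ _) (subst (Adj G (g i)) (sh 0) a))))
    where
    arc-inj : ∀ j e → i ≤ j → 0 < e → e + j < 3 + d + i → g j ≢ g (e + j)
    arc-inj j e i≤j pos hi = inj j e pos (≤-trans (+-cancelʳ-< i e (3 + d) (≤-trans (s≤s (+-monoʳ-≤ e i≤j)) hi)) (<⇒≤ lt))

  neighbour : Chordless → ∀ i j → Adj G (g (suc i)) (g j) → g j ≡ g (suc (suc i)) ⊎ g j ≡ g i
  neighbour ch i j a with ch (suc i) j a
  ... | inj₁ e = inj₁ e
  ... | inj₂ e = inj₂ (sym (pred-unique i j e))

  On : Fin n → Set
  On v = Σ ℕ λ i → v ≡ g i

  on-segment : ∀ i → g i ∈ segment g (suc k) 0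
  on-segment i = subst (_∈ segment g (suc k) 0) (trans (cong g (+-identityʳ _)) (sym (reduce₀ i))) (∈-segment g (suc k) 0 (i % suc k) (m%n<n i (suc k)))

  path-window : Chordless → ∀ {a b c d} → Path4 G a b c d → On a → On b → On c → On d →
    Σ ℕ λ i → (a ≡ g i × b ≡ g (1 + i) × c ≡ g (2 + i) × d ≡ g (3 + i)) ⊎
              (d ≡ g i × c ≡ g (1 + i) × b ≡ g (2 + i) × a ≡ g (3 + i))
  path-window ch {a} {b} {c} {d} (path4 dis ab bc cd) (i , refl) (ib , refl) (ic , refl) (id′ , refl) = up-or-down
    where
    -- The index `i` moves up by three periods, to `3 + m`, which leaves room for a path running
    -- three steps downwards.
    m = 3 * k + i
    start : g i ≡ g (3 + m)
    start = trans (sym (per* 3 i)) (cong g (ring k i))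
      where
      ring : ∀ k i → 3 * (1 + k) + i ≡ 3 + (3 * k + i)
      ring = solve-∀
    a≢c = proj₁ (proj₂ (distinct-≢ dis))
    b≢d = proj₁ (proj₂ (proj₂ (proj₂ (proj₂ (distinct-≢ dis)))))
    up-or-down : Σ ℕ λ j → (a ≡ g j × b ≡ g (1 + j) × c ≡ g (2 + j) × d ≡ g (3 + j)) ⊎
              (d ≡ g j × c ≡ g (1 + j) × b ≡ g (2 + j) × a ≡ g (3 + j))
    up-or-down with neighbour ch (2 + m) ib (subst (λ v → Adj G v b) start ab)
    ... | inj₁ b≡ with neighbour ch (3 + m) ic (subst (λ v → Adj G v c) b≡ bc)
    ...   | inj₂ c≡ = ⊥-elim (a≢c (trans start (sym c≡)))
    ...   | inj₁ c≡ with neighbour ch (4 + m) id′ (subst (λ v → Adj G v d) c≡ cd)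
    ...     | inj₂ d≡ = ⊥-elim (b≢d (trans b≡ (sym d≡)))
    ...     | inj₁ d≡ = 3 + m , inj₁ (start , b≡ , c≡ , d≡)
    up-or-down | inj₂ b≡ with neighbour ch (1 + m) ic (subst (λ v → Adj G v c) b≡ bc)
    ...   | inj₁ c≡ = ⊥-elim (a≢c (trans start (sym c≡)))
    ...   | inj₂ c≡ with neighbour ch m id′ (subst (λ v → Adj G v d) c≡ cd)
    ...     | inj₁ d≡ = ⊥-elim (b≢d (trans b≡ (sym d≡)))
    ...     | inj₂ d≡ = m , inj₂ (d≡ , c≡ , b≡ , start)

  window-path : 3 ≤ k → ∀ i → Path4 G (g i) (g (1 + i)) (g (2 + i)) (g (3 + i))
  window-path 3≤k i = path4 (distinct4 (inj i 1 (s≤s z≤n) (lt 1 (s≤s z≤n))) (inj i 2 (s≤s z≤n) (lt 2 (s≤s (s≤s z≤n))))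
      (inj i 3 (s≤s z≤n) (lt 3 ≤-refl)) (inj (1 + i) 1 (s≤s z≤n) (lt 1 (s≤s z≤n)))
      (inj (1 + i) 2 (s≤s z≤n) (lt 2 (s≤s (s≤s z≤n)))) (inj (2 + i) 1 (s≤s z≤n) (lt 1 (s≤s z≤n))))
    (adj i) (adj (1 + i)) (adj (2 + i))
    where
    lt : ∀ d → d ≤ 3 → d < suc k
    lt d d≤3 = s≤s (≤-trans d≤3 3≤k)

-- Long cycles

window-sum : ∀ {n} (g : ℕ → Fin n) (x : Fin n → ℕ) →
  (∀ i → 1 ≤ sumL x (quad (g i) (g (1 + i)) (g (2 + i)) (g (3 + i)))) → ∀ L i →
  L ≤ sumL x (segment g L i) + sumL x (segment g L (1 + i)) + sumL x (segment g L (2 + i)) + sumL x (segment g L (3 + i))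
window-sum g x win zero    i = z≤n
window-sum g x win (suc L) i = ≤-trans (+-mono-≤ (win i) (window-sum g x win L (suc i)))
  (≤-reflexive (ring (x (g i)) (x (g (1 + i))) (x (g (2 + i))) (x (g (3 + i))) _ _ _ _))
  where
  ring : ∀ a b c d p q r s → a + (b + (c + (d + 0))) + (p + q + r + s) ≡ (a + p) + (b + q) + (c + r) + (d + s)
  ring = solve-∀

segment-snoc : ∀ {n} (g : ℕ → Fin n) (x : Fin n → ℕ) L i →
  x (g i) + sumL x (segment g L (suc i)) ≡ sumL x (segment g L i) + x (g (L + i))
segment-snoc g x zero    i = +-identityʳ _
segment-snoc g x (suc L) i = trans (cong (x (g i) +_) (segment-snoc g x L (suc i)))
  (trans (cong (λ j → x (g i) + (sumL x (segment g L (suc i)) + x (g j))) (+-suc L i)) (sym (+-assoc (x (g i)) _ _)))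

-- The all-one weight on a cycle of length k forces 4τ = k.
cycle-mod-4 : ∀ {n} {G : Graph n} → IsSimple G → Mengerian (H3 G) → ∀ {k g} → Cycle G (suc k) g → 3 ≤ k → suc k % 4 ≡ 0
cycle-mod-4 {n} {G} simple men {k} {g} C 3≤k = conclude (certificate men (segment g (suc k) 0) (λ _ → 1) 4 (λ _ _ → ≤-refl))
  where
  open Cycle C
  open CycleProps simple C
  conclude : (Σ (Fin n → ℕ) λ x → PathCover G x × 4 * sumL x (segment g (suc k) 0) ≤ sumL (λ _ → 1) (segment g (suc k) 0)) →
    suc k % 4 ≡ 0
  conclude (x , cov , le) = trans (cong (_% 4) (trans (≤-antisym lower upper) (*-comm 4 S))) (m*n%n≡0 S 4)
    where
    S = sumL x (segment g (suc k) 0)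
    rotate : ∀ i → sumL x (segment g (suc k) (suc i)) ≡ sumL x (segment g (suc k) i)
    rotate i = +-cancelˡ-≡ (x (g i)) _ _ (trans (segment-snoc g x (suc k) i)
      (trans (cong (λ v → sumL x (segment g (suc k) i) + x v) (per i)) (+-comm _ (x (g i)))))
    upper : 4 * S ≤ suc k
    upper = ≤-trans le (≤-reflexive (trans (sumL-1 (segment g (suc k) 0)) (length-segment g (suc k) 0)))
    -- The `suc k` windows use every vertex four times, since a full turn has the same `x`-weight
    -- from any starting point.
    lower : suc k ≤ 4 * S
    lower = ≤-trans (window-sum g x (λ i → cov (window-path 3≤k i)) (suc k) 0)
      (≤-reflexive (trans (cong₂ _+_ (cong₂ _+_ (cong (S +_) (rotate 0)) (trans (rotate 1) (rotate 0)))
        (trans (rotate 2) (trans (rotate 1) (rotate 0)))) (ring S)))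
      where
      ring : ∀ s → s + s + s + s ≡ 4 * s
      ring = solve-∀

every-other : ℕ → ℕ → List ℕ
every-other zero    i = []
every-other (suc L) i = i ∷ every-other L (2 + i)

-- Cyclic gaps 1,2,2,1,2,2,…,2: any four consecutive indices contain two of the chosen ones,
-- and consecutive chosen ones lie in a window containing no third.
chosen : ℕ → Bool
chosen 0 = true
chosen 1 = true
chosen 2 = false
chosen 3 = true
chosen 4 = false
chosen 5 = true
chosen (suc (suc (suc (suc (suc (suc i)))))) = even i
  where
  even : ℕ → Bool
  even zero          = true
  even (suc zero)    = false
  even (suc (suc i)) = even i

Increasing : ℕ → ℕ → List ℕ → Set
Increasing lo hi []       = ⊤
Increasing lo hi (x ∷ xs) = lo ≤ x × x < hi × Increasing (suc x) hi xs

increasing-bounds : ∀ {lo hi xs y} → Increasing lo hi xs → y ∈ xs → lo ≤ y × y < hi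
increasing-bounds (p , q , _)  (here refl) = p , q
increasing-bounds (p , q , inc) (there y∈) with increasing-bounds inc y∈
... | p′ , q′ = ≤-trans p (<⇒≤ p′) , q′

increasing-every-other : ∀ lo hi L i → lo ≤ i → 2 * L + i ≤ suc hi → Increasing lo hi (every-other L i)
increasing-every-other lo hi zero    i p q = tt
increasing-every-other lo hi (suc L) i p q = p ,
  ≤-pred (≤-trans (s≤s (s≤s (m≤n+m i (2 * L)))) (≤-trans (≤-reflexive (ring L i)) q)) ,
  increasing-every-other (suc i) hi L (2 + i) (n≤1+n (suc i)) (≤-trans (≤-reflexive (ring′ L i)) q)
  where
  ring : ∀ L i → 2 + (2 * L + i) ≡ 2 * (1 + L) + i
  ring = solve-∀
  ring′ : ∀ L i → 2 * L + (2 + i) ≡ 2 * (1 + L) + i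
  ring′ = solve-∀

every-other-chosen : ∀ L i {y} → y ∈ every-other L (6 + i) → chosen y ≡ chosen (6 + i)
every-other-chosen (suc L) i (here refl) = refl
every-other-chosen (suc L) i (there y∈)  = every-other-chosen L (2 + i) y∈

∈-every-other : ∀ L i a → a < L → 2 * a + i ∈ every-other L i
∈-every-other (suc L) i zero    _         = here refl
∈-every-other (suc L) i (suc a) (s≤s a<L) = there (subst (_∈ every-other L (2 + i)) (ring a i) (∈-every-other L (2 + i) a a<L))
  where
  ring : ∀ a i → 2 * a + (2 + i) ≡ 2 * (1 + a) + i
  ring = solve-∀

length-every-other : ∀ L i → length (every-other L i) ≡ L
length-every-other zero    i = refl
length-every-other (suc L) i = cong suc (length-every-other L (2 + i))

halve : ∀ i → Σ ℕ λ a → i ≡ 2 * a ⊎ i ≡ 1 + 2 * a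
halve zero = 0 , inj₁ refl
halve (suc i) with halve i
... | a , inj₁ refl = a , inj₂ refl
... | a , inj₂ refl = suc a , inj₁ (ring a)
  where
  ring : ∀ a → 2 + 2 * a ≡ 2 * (1 + a)
  ring = solve-∀

two-hits : ∀ a b c d → 2 ≤ a + b ⊎ 2 ≤ a + c ⊎ 2 ≤ a + d ⊎ 2 ≤ b + c ⊎ 2 ≤ b + d ⊎ 2 ≤ c + d → 2 ≤ a + (b + (c + (d + 0)))
two-hits a b c d = λ
  { (inj₁ p) → ≤-trans p (≤-trans (m≤m+n _ (c + d)) (≤-reflexive (r₁ a b c d)))
  ; (inj₂ (inj₁ p)) → ≤-trans p (≤-trans (m≤m+n _ (b + d)) (≤-reflexive (r₂ a b c d)))
  ; (inj₂ (inj₂ (inj₁ p))) → ≤-trans p (≤-trans (m≤m+n _ (b + c)) (≤-reflexive (r₃ a b c d)))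
  ; (inj₂ (inj₂ (inj₂ (inj₁ p)))) → ≤-trans p (≤-trans (m≤m+n _ (a + d)) (≤-reflexive (r₄ a b c d)))
  ; (inj₂ (inj₂ (inj₂ (inj₂ (inj₁ p))))) → ≤-trans p (≤-trans (m≤m+n _ (a + c)) (≤-reflexive (r₅ a b c d)))
  ; (inj₂ (inj₂ (inj₂ (inj₂ (inj₂ p))))) → ≤-trans p (≤-trans (m≤m+n _ (a + b)) (≤-reflexive (r₆ a b c d))) }
  where
  r₁ : ∀ a b c d → (a + b) + (c + d) ≡ a + (b + (c + (d + 0)))
  r₁ = solve-∀
  r₂ : ∀ a b c d → (a + c) + (b + d) ≡ a + (b + (c + (d + 0)))
  r₂ = solve-∀
  r₃ : ∀ a b c d → (a + d) + (b + c) ≡ a + (b + (c + (d + 0)))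
  r₃ = solve-∀
  r₄ : ∀ a b c d → (b + c) + (a + d) ≡ a + (b + (c + (d + 0)))
  r₄ = solve-∀
  r₅ : ∀ a b c d → (b + d) + (a + c) ≡ a + (b + (c + (d + 0)))
  r₅ = solve-∀
  r₆ : ∀ a b c d → (c + d) + (a + b) ≡ a + (b + (c + (d + 0)))
  r₆ = solve-∀

module _ (X : ℕ → ℕ) where

  Σₑ : ℕ → ℕ → ℕ
  Σₑ L i = sumL X (every-other L i)

  -- The `j` windows starting at `i`, `i + 2`, ... use the first two and the last two positions once
  -- and all others twice. Adding these two end pairs to the left-hand side makes the factor two
  -- uniform, which lets the induction go through.
  chained-windows : (∀ i → 1 ≤ X i + (X (1 + i) + (X (2 + i) + (X (3 + i) + 0)))) → ∀ j i →
    j + (X i + X (1 + i)) + (X (2 * j + i) + X (1 + (2 * j + i))) ≤ 2 * (Σₑ (suc j) i + Σₑ (suc j) (1 + i))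
  chained-windows win zero i = ≤-reflexive (ring (X i) (X (1 + i)))
    where
    ring : ∀ a b → 0 + (a + b) + (a + b) ≡ 2 * (a + 0 + (b + 0))
    ring = solve-∀
  chained-windows win (suc j) i = begin
    suc j + (X i + X (1 + i)) + (X (2 * suc j + i) + X (1 + (2 * suc j + i)))
      ≡⟨ cong (λ l → suc j + (X i + X (1 + i)) + (X l + X (1 + l))) (idx j i) ⟩
    suc j + (X i + X (1 + i)) + (X (2 * j + (2 + i)) + X (1 + (2 * j + (2 + i))))
      ≡⟨ r₁ j (X i) (X (1 + i)) (X (2 * j + (2 + i))) (X (1 + (2 * j + (2 + i)))) ⟩
    1 + (j + (X i + X (1 + i)) + (X (2 * j + (2 + i)) + X (1 + (2 * j + (2 + i)))))
      ≤⟨ +-monoˡ-≤ _ (win i) ⟩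
    X i + (X (1 + i) + (X (2 + i) + (X (3 + i) + 0))) + (j + (X i + X (1 + i)) + (X (2 * j + (2 + i)) + X (1 + (2 * j + (2 + i)))))
      ≡⟨ r₂ j (X i) (X (1 + i)) (X (2 + i)) (X (3 + i)) (X (2 * j + (2 + i))) (X (1 + (2 * j + (2 + i)))) ⟩
    2 * (X i + X (1 + i)) + (j + (X (2 + i) + X (3 + i)) + (X (2 * j + (2 + i)) + X (1 + (2 * j + (2 + i)))))
      ≤⟨ +-monoʳ-≤ (2 * (X i + X (1 + i))) (chained-windows win j (2 + i)) ⟩
    2 * (X i + X (1 + i)) + 2 * (Σₑ (suc j) (2 + i) + Σₑ (suc j) (3 + i))
      ≡⟨ r₃ (X i) (X (1 + i)) (Σₑ (suc j) (2 + i)) (Σₑ (suc j) (3 + i)) ⟩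
    2 * (Σₑ (suc (suc j)) i + Σₑ (suc (suc j)) (1 + i)) ∎
    where
    open ≤-Reasoning
    idx : ∀ j i → 2 * (1 + j) + i ≡ 2 * j + (2 + i)
    idx = solve-∀
    r₁ : ∀ j a b p q → 1 + j + (a + b) + (p + q) ≡ 1 + (j + (a + b) + (p + q))
    r₁ = solve-∀
    r₂ : ∀ j a b c d p q → a + (b + (c + (d + 0))) + (j + (a + b) + (p + q)) ≡ 2 * (a + b) + (j + (c + d) + (p + q))
    r₂ = solve-∀
    r₃ : ∀ a b p q → 2 * (a + b) + 2 * (p + q) ≡ 2 * ((a + p) + (b + q))
    r₃ = solve-∀

  last-two : ∀ j i → X (2 * j + i) + X (2 * j + (2 + i)) ≤ Σₑ (suc (suc j)) i
  last-two zero    i = +-monoʳ-≤ (X i) (m≤m+n _ 0)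
  last-two (suc j) i = ≤-trans (≤-reflexive (cong₂ (λ p q → X p + X q) (idx j i) (idx j (2 + i))))
    (≤-trans (last-two j (2 + i)) (m≤n+m _ (X i)))
    where
    idx : ∀ j i → 2 * (1 + j) + i ≡ 2 * j + (2 + i)
    idx = solve-∀

-- On `K = 10 + 2 * i` vertices the chosen set has two gaps of one and `4 + i` gaps of two. Gaps of
-- two alone would give `K / 2` chosen vertices, an even number when 4 divides `K`; two short gaps
-- make the number odd. Every pair of neighbouring chosen vertices is alone in some window only if
-- the short gaps are separated by at least two long ones on either side. The 8-cycle escapes
-- because two short gaps leave it only three long ones.
module LongCycle {n} {G : Graph n} (simple : IsSimple G) (men : Mengerian (H3 G)) {k i t : ℕ} (k≡ : k ≡ 9 + 2 * i)
  (odd : 6 + i ≡ suc (2 * t)) {g : ℕ → Fin n} (C : Cycle G (suc k) g) (ch : CycleProps.Chordless simple C) where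
  open Cycle C
  open CycleProps simple C

  j = suc i
  K = suc k

  K≡ : 6 + 2 * suc j ≡ K
  K≡ = trans (ring i) (cong suc (sym k≡))
    where
    ring : ∀ i → 6 + 2 * (1 + (1 + i)) ≡ 1 + (9 + 2 * i)
    ring = solve-∀

  rs xs : List ℕ
  rs = 0 ∷ 1 ∷ 3 ∷ 5 ∷ every-other (suc j) 6
  xs = 2 ∷ 4 ∷ every-other (suc j) 7

  small : ∀ l → l ≤ 9 → l < K
  small l l≤9 = s≤s (≤-trans l≤9 (≤-trans (m≤m+n 9 (2 * i)) (≤-reflexive (sym k≡))))

  rs-increasing : Increasing 0 K rs
  rs-increasing = z≤n , small 0 z≤n , s≤s z≤n , small 1 (s≤s z≤n) , s≤s (s≤s z≤n) , small 3 (s≤s (s≤s (s≤s z≤n))) ,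
    s≤s (s≤s (s≤s (s≤s z≤n))) , small 5 (s≤s (s≤s (s≤s (s≤s (s≤s z≤n))))) ,
    increasing-every-other 6 K (suc j) 6 ≤-refl (≤-trans (≤-reflexive (trans (+-comm (2 * suc j) 6) K≡)) (n≤1+n K))

  xs-increasing : Increasing 0 K xs
  xs-increasing = z≤n , small 2 (s≤s (s≤s z≤n)) , s≤s (s≤s (s≤s z≤n)) , small 4 (s≤s (s≤s (s≤s (s≤s z≤n)))) ,
    increasing-every-other 5 K (suc j) 7 (s≤s (s≤s (s≤s (s≤s (s≤s z≤n))))) (≤-reflexive (trans (+-comm (2 * suc j) 7) (cong suc K≡)))

  rs-chosen : ∀ {y} → y ∈ rs → chosen y ≡ true
  rs-chosen #0 = refl
  rs-chosen #1 = refl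
  rs-chosen #2 = refl
  rs-chosen #3 = refl
  rs-chosen (there (there (there (there p)))) = every-other-chosen (suc j) 0 p

  xs-chosen : ∀ {y} → y ∈ xs → chosen y ≡ false
  xs-chosen #0 = refl
  xs-chosen #1 = refl
  xs-chosen (there (there p)) = every-other-chosen (suc j) 1 p

  distinct-map : ∀ lo ys → Increasing lo K ys → Distinct (map g ys)
  distinct-map lo []       _            = tt
  distinct-map lo (y ∷ ys) (_ , _ , inc) = first , distinct-map (suc y) ys inc
    where
    first : ∀ v → v ∈ map g ys → g y ≢ v
    first v p e with ∈-map⁻ g p
    ... | b , b∈ , refl with increasing-bounds inc b∈
    ...   | y<b , b<K = <⇒≢ y<b (g-injective (<-trans y<b b<K) b<K e)

  apart : ∀ v → v ∈ map g xs → v ∉ map g rs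
  apart v p p′ = conclude (∈-map⁻ g p) (∈-map⁻ g p′)
    where
    conclude : (Σ ℕ λ a → a ∈ xs × v ≡ g a) → (Σ ℕ λ b → b ∈ rs × v ≡ g b) → ⊥
    conclude (a , a∈ , e) (b , b∈ , e′) = contradiction (trans (sym (xs-chosen a∈)) (trans (cong chosen a≡b) (rs-chosen b∈))) λ ()
      where
      a≡b : a ≡ b
      a≡b = g-injective (proj₂ (increasing-bounds xs-increasing a∈)) (proj₂ (increasing-bounds rs-increasing b∈)) (trans (sym e) e′)

  abstract
    z : ℕ → ℕ
    z l = count (map g rs) (g l)

    z-∈ : ∀ {l} → l ∈ rs → 1 ≤ z l
    z-∈ p = count-∈ (map g rs) _ (∈-map⁺ g p)

    z-cong : ∀ {l m} → g l ≡ g m → z l ≡ z m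
    z-cong = cong (count (map g rs))

    z-quad : ∀ l → z l + (z (1 + l) + (z (2 + l) + (z (3 + l) + 0))) ≡
      sumL (count (map g rs)) (quad (g l) (g (1 + l)) (g (2 + l)) (g (3 + l)))
    z-quad l = refl

  z-even : ∀ a → a ≤ suc j → 1 ≤ z (2 * a + 6)
  z-even a a≤ with m≤n⇒m<n∨m≡n a≤
  ... | inj₁ a< = z-∈ (there (there (there (there (∈-every-other (suc j) 6 a a<)))))
  -- The even index one step past the end of `rs` is `K`, which is the chosen vertex with index 0.
  ... | inj₂ refl = subst (1 ≤_)
    (sym (z-cong (trans (cong g (trans (+-comm (2 * suc j) 6) (trans K≡ (sym (+-identityʳ K))))) (per 0)))) (z-∈ #0)

  hits : ∀ l → _ → 2 ≤ z l + (z (1 + l) + (z (2 + l) + (z (3 + l) + 0)))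
  hits l = two-hits (z l) (z (1 + l)) (z (2 + l)) (z (3 + l))

  two : ∀ l → l < K → 2 ≤ z l + (z (1 + l) + (z (2 + l) + (z (3 + l) + 0)))
  two 0 _ = hits 0 (inj₁ (+-mono-≤ (z-∈ #0) (z-∈ #1)))
  two 1 _ = hits 1 (inj₂ (inj₁ (+-mono-≤ (z-∈ #1) (z-∈ #2))))
  two 2 _ = hits 2 (inj₂ (inj₂ (inj₂ (inj₂ (inj₁ (+-mono-≤ (z-∈ #2) (z-∈ #3)))))))
  two 3 _ = hits 3 (inj₂ (inj₁ (+-mono-≤ (z-∈ #2) (z-∈ #3))))
  two 4 _ = hits 4 (inj₂ (inj₂ (inj₂ (inj₁ (+-mono-≤ (z-∈ #3) (z-even 0 z≤n))))))
  two 5 _ = hits 5 (inj₁ (+-mono-≤ (z-∈ #3) (z-even 0 z≤n)))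
  two (suc (suc (suc (suc (suc (suc l)))))) lt with halve l
  ... | a , inj₁ refl = hits (6 + 2 * a) (inj₂ (inj₁ (+-mono-≤
        (subst (λ l → 1 ≤ z l) (r₀ a) (z-even a (<⇒≤ a<))) (subst (λ l → 1 ≤ z l) (r₁ a) (z-even (suc a) a<)))))
    where
    r₀ : ∀ a → 2 * a + 6 ≡ 6 + 2 * a
    r₀ = solve-∀
    r₁ : ∀ a → 2 * (1 + a) + 6 ≡ 2 + (6 + 2 * a)
    r₁ = solve-∀
    a< : a < suc j
    a< = *-cancelˡ-< 2 a (suc j) (+-cancelˡ-< 6 (2 * a) (2 * suc j) (≤-trans lt (≤-reflexive (sym K≡))))
  ... | a , inj₂ refl with m≤n⇒m<n∨m≡n a<
    where
    a< : a < suc j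
    a< = *-cancelˡ-< 2 a (suc j) (<-trans (n<1+n (2 * a)) (+-cancelˡ-< 6 (1 + 2 * a) (2 * suc j) (≤-trans lt (≤-reflexive (sym K≡)))))
  ...   | inj₁ 1+a< = hits (7 + 2 * a) (inj₂ (inj₂ (inj₂ (inj₂ (inj₁ (+-mono-≤
          (subst (λ l → 1 ≤ z l) (r₁ a) (z-even (suc a) (<⇒≤ 1+a<))) (subst (λ l → 1 ≤ z l) (r₂ a) (z-even (2 + a) 1+a<))))))))
    where
    r₁ : ∀ a → 2 * (1 + a) + 6 ≡ 1 + (7 + 2 * a)
    r₁ = solve-∀
    r₂ : ∀ a → 2 * (2 + a) + 6 ≡ 3 + (7 + 2 * a)
    r₂ = solve-∀
  -- This window starts at `K - 1`; its two hits are the chosen vertices 0 and 1 after the wrap.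
  ...   | inj₂ e = hits (7 + 2 * a) (inj₂ (inj₂ (inj₂ (inj₁ (+-mono-≤
          (subst (λ l → 1 ≤ z l) (r₁ a) (z-even (suc a) (≤-reflexive e)))
          (subst (1 ≤_) (sym (z-cong (trans (cong g wrap) (per 1)))) (z-∈ #1)))))))
    where
    r₁ : ∀ a → 2 * (1 + a) + 6 ≡ 1 + (7 + 2 * a)
    r₁ = solve-∀
    wrap : 2 + (7 + 2 * a) ≡ K + 1
    wrap = trans (r₂ a) (cong (_+ 1) (trans (cong (λ l → 6 + 2 * l) e) K≡))
      where
      r₂ : ∀ a → 2 + (7 + 2 * a) ≡ 6 + 2 * (1 + a) + 1
      r₂ = solve-∀

  two-in-window : ∀ l → 2 ≤ sumL (count (map g rs)) (quad (g l) (g (1 + l)) (g (2 + l)) (g (3 + l)))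
  two-in-window l = ≤-trans (two (l % K) (m%n<n l K)) (≤-reflexive (trans
    (sym (cong₂ _+_ (zz 0) (cong₂ _+_ (zz 1) (cong₂ _+_ (zz 2) (cong (_+ 0) (zz 3)))))) (z-quad l)))
    where
    zz : ∀ t → z (t + l) ≡ z (t + l % K)
    zz t = z-cong (trans (cong g (+-comm t l)) (trans (reduce l t) (cong g (+-comm (l % K) t))))

  meets : ∀ {a b c d} → Path4 G a b c d → (∀ v → v ∈ quad a b c d → v ∈ map g rs ++ map g xs) →
    2 ≤ sumL (count (map g rs)) (quad a b c d)
  meets {a} {b} {c} {d} P sub =
    conclude (count (map g rs)) two-in-window (path-window ch P (on (sub a #0)) (on (sub b #1)) (on (sub c #2)) (on (sub d #3)))
    where
    on : ∀ {v} → v ∈ map g rs ++ map g xs → On v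
    on p with ∈-++⁻ (map g rs) p
    ... | inj₁ q = let l , _ , e = ∈-map⁻ g q in l , e
    ... | inj₂ q = let l , _ , e = ∈-map⁻ g q in l , e
    ring : ∀ a b c d → a + (b + (c + (d + 0))) ≡ d + (c + (b + (a + 0)))
    ring = solve-∀
    conclude : ∀ (f : Fin n → ℕ) → (∀ l → 2 ≤ sumL f (quad (g l) (g (1 + l)) (g (2 + l)) (g (3 + l)))) →
      (Σ ℕ λ i → (a ≡ g i × b ≡ g (1 + i) × c ≡ g (2 + i) × d ≡ g (3 + i)) ⊎
                 (d ≡ g i × c ≡ g (1 + i) × b ≡ g (2 + i) × a ≡ g (3 + i))) → 2 ≤ sumL f (quad a b c d)
    conclude f h (l , inj₁ (refl , refl , refl , refl)) = h l
    conclude f h (l , inj₂ (refl , refl , refl , refl)) = ≤-trans (h l) (≤-reflexive (ring (f (g l)) (f (g (1 + l))) (f (g (2 + l))) (f (g (3 + l)))))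

  -- The odd cycle of length 5 + j: the windows starting at 1, 2, 4, 6, 8, …, K - 4, K - 3, K - 1.
  lower : ∀ x → PathCover G x → suc (2 * t) ≤ 2 * (sumL x (map g rs) + (sumL x (map g xs) + sumL x (map g xs)))
  lower x cov = begin
    suc (2 * t)  ≡⟨ trans (sym odd) (r₀ i) ⟩
    1 + 1 + 1 + 1 + 1 + j
      ≤⟨ +-monoˡ-≤ j (+-mono-≤ (+-mono-≤ (+-mono-≤ (+-mono-≤ (win 1) (win 2)) (win 4)) (wrap₀)) wrap₁) ⟩
    w 1 + w 2 + w 4 + (A + (B + (D + (X 0 + 0)))) + (D + (X 0 + (X 1 + (X 2 + 0)))) + j
      ≡⟨ r₁ j (X 0) (X 1) (X 2) (X 3) (X 4) (X 5) (X 6) (X 7) A B D ⟩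
    (j + (X 6 + X 7) + (B + D)) + (A + D) + (2 * X 0 + 2 * X 1 + 3 * X 2 + 2 * X 3 + 3 * X 4 + 2 * X 5)
      ≤⟨ +-monoˡ-≤ _ (+-mono-≤ (≤-trans (≤-reflexive (cong (λ l → j + (X 6 + X 7) + (X l + X (suc l))) (idx i))) (chained-windows X win j 6)) tail) ⟩
    2 * (E + O) + O + (2 * X 0 + 2 * X 1 + 3 * X 2 + 2 * X 3 + 3 * X 4 + 2 * X 5)
      -- The windows use each chosen vertex exactly twice and each other vertex at most three times.
      -- Weight two on the latter, doubled, allows four uses; the added terms are the difference.
      ≤⟨ m≤m+n _ (O + X 2 + X 4) ⟩
    2 * (E + O) + O + (2 * X 0 + 2 * X 1 + 3 * X 2 + 2 * X 3 + 3 * X 4 + 2 * X 5) + (O + X 2 + X 4)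
      ≡⟨ r₂ (X 0) (X 1) (X 2) (X 3) (X 4) (X 5) E O ⟩
    2 * ((X 0 + (X 1 + (X 3 + (X 5 + E)))) + ((X 2 + (X 4 + O)) + (X 2 + (X 4 + O))))
      ≡⟨ cong₂ (λ a b → 2 * ((X 0 + (X 1 + (X 3 + (X 5 + a)))) + ((X 2 + (X 4 + b)) + (X 2 + (X 4 + b))))) (comp (every-other (suc j) 6)) (comp (every-other (suc j) 7)) ⟩
    2 * (sumL x (map g rs) + (sumL x (map g xs) + sumL x (map g xs))) ∎
    where
    open ≤-Reasoning
    X : ℕ → ℕ
    X i = x (g i)
    w : ℕ → ℕ
    w i = X i + (X (1 + i) + (X (2 + i) + (X (3 + i) + 0)))
    win : ∀ i → 1 ≤ w i
    win l = cov (window-path (≤-trans (s≤s (s≤s (s≤s z≤n))) (≤-reflexive (sym k≡))) l)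
    A = X (7 + 2 * i)
    B = X (8 + 2 * i)
    D = X (9 + 2 * i)
    E = Σₑ X (suc j) 6
    O = Σₑ X (suc j) 7
    comp : ∀ ys → sumL X ys ≡ sumL x (map g ys)
    comp ys = cong sum (map-∘ ys)
    wrapX : ∀ i → X (K + i) ≡ X i
    wrapX l = cong x (per l)
    K≡′ : 10 + 2 * i ≡ K
    K≡′ = cong suc (sym k≡)
    K+0 : 10 + 2 * i ≡ K + 0
    K+0 = trans K≡′ (sym (+-identityʳ K))
    K+1 : 11 + 2 * i ≡ K + 1
    K+1 = trans (cong suc K≡′) (+-comm 1 K)
    K+2 : 12 + 2 * i ≡ K + 2
    K+2 = trans (cong (2 +_) K≡′) (+-comm 2 K)
    wrap₀ : 1 ≤ A + (B + (D + (X 0 + 0)))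
    wrap₀ = ≤-trans (win (7 + 2 * i)) (≤-reflexive (cong (λ v → A + (B + (D + (v + 0)))) (trans (cong X K+0) (wrapX 0))))
    wrap₁ : 1 ≤ D + (X 0 + (X 1 + (X 2 + 0)))
    wrap₁ = ≤-trans (win (9 + 2 * i)) (≤-reflexive (cong (D +_) (cong₂ _+_ (trans (cong X K+0) (wrapX 0))
      (cong₂ _+_ (trans (cong X K+1) (wrapX 1)) (cong (_+ 0) (trans (cong X K+2) (wrapX 2)))))))
    idx : ∀ i → 8 + 2 * i ≡ 2 * (1 + i) + 6
    idx = solve-∀
    tail : A + D ≤ O
    tail = ≤-trans (≤-reflexive (cong₂ (λ a b → X a + X b) (i₁ i) (i₂ i))) (last-two X i 7)
      where
      i₁ : ∀ i → 7 + 2 * i ≡ 2 * i + 7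
      i₁ = solve-∀
      i₂ : ∀ i → 9 + 2 * i ≡ 2 * i + 9
      i₂ = solve-∀
    r₀ : ∀ i → 6 + i ≡ 1 + 1 + 1 + 1 + 1 + (1 + i)
    r₀ = solve-∀
    r₁ : ∀ j x0 x1 x2 x3 x4 x5 x6 x7 a b d →
      (x1 + (x2 + (x3 + (x4 + 0)))) + (x2 + (x3 + (x4 + (x5 + 0)))) + (x4 + (x5 + (x6 + (x7 + 0)))) + (a + (b + (d + (x0 + 0)))) + (d + (x0 + (x1 + (x2 + 0)))) + j ≡
      (j + (x6 + x7) + (b + d)) + (a + d) + (2 * x0 + 2 * x1 + 3 * x2 + 2 * x3 + 3 * x4 + 2 * x5)
    r₁ = solve-∀
    r₂ : ∀ x0 x1 x2 x3 x4 x5 e o →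
      2 * (e + o) + o + (2 * x0 + 2 * x1 + 3 * x2 + 2 * x3 + 3 * x4 + 2 * x5) + (o + x2 + x4) ≡
      2 * ((x0 + (x1 + (x3 + (x5 + e)))) + ((x2 + (x4 + o)) + (x2 + (x4 + o))))
    r₂ = solve-∀

  impossible : ⊥
  impossible = odd-minor men t (map g rs) (map g xs) len (distinct-map 0 rs rs-increasing) apart meets lower
    where
    len : length (map g rs) ≡ suc (2 * t)
    len = trans (length-map g rs) (trans (cong (4 +_) (length-every-other (suc j) 6)) odd)

-- Trees

walk-closure : ∀ {n} {G : Graph n} (Q : Fin n → Set) → (∀ u v → Q u → Adj G u v → Q v) →
  ∀ {u v} → Walk G u v → Q u → Q v
walk-closure Q closed stop       q = q
walk-closure Q closed (step a w) q = walk-closure Q closed w (closed _ _ q a)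

length-filterᵇ : ∀ {A : Set} (p : A → Bool) xs → length (filterᵇ p xs) ≡ sumL (λ x → if p x then 1 else 0) xs
length-filterᵇ p [] = refl
length-filterᵇ p (x ∷ xs) with p x
... | true  = cong suc (length-filterᵇ p xs)
... | false = length-filterᵇ p xs

module _ {n} {G : Graph n} (simple : IsSimple G) where

  sym-adj : ∀ {u v} → Adj G u v → Adj G v u
  sym-adj {u} {v} a = trans (proj₁ simple v u) a

  adj-≢ : ∀ {u v} → Adj G u v → u ≢ v
  adj-≢ {u} a refl = contradiction (trans (sym a) (proj₂ simple u)) λ ()

  two-neighbours⇒¬leaf : ∀ {u a b} → Adj G u a → Adj G u b → a ≢ b → ¬ IsLeaf G u
  two-neighbours⇒¬leaf {u} {a} {b} ua ub a≢b leaf = contradiction 2≤1 (λ { (s≤s ()) })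
    where
    le : ∀ v → count (a ∷ b ∷ []) v * 1 ≤ (if G u v then 1 else 0)
    le v with v ∈ₗ? (a ∷ b ∷ [])
    ... | no v∉ rewrite count-∉ (a ∷ b ∷ []) v v∉ = z≤n
    ... | yes #0 rewrite ua = ≤-trans (≤-reflexive (*-identityʳ _)) (count≤1 (a ∷ b ∷ []) a ((λ { _ #0 → a≢b }) , (λ _ ()) , tt))
    ... | yes #1 rewrite ub = ≤-trans (≤-reflexive (*-identityʳ _)) (count≤1 (a ∷ b ∷ []) b ((λ { _ #0 → a≢b }) , (λ _ ()) , tt))
    2≤1 : 2 ≤ 1
    2≤1 = subst₂ _≤_ (sumV-count (a ∷ b ∷ []) (λ _ → 1)) (trans (sym (length-filterᵇ (G u) (allFin n))) leaf) (sumL-mono le (allFin n))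

  leaf-unique : ∀ {u a b} → IsLeaf G u → Adj G u a → Adj G u b → a ≡ b
  leaf-unique {u} {a} {b} leaf ua ub with a F.≟ b
  ... | yes e = e
  ... | no a≢b = ⊥-elim (two-neighbours⇒¬leaf ua ub a≢b leaf)

  ¬leaf⇒other : ∀ {u w} → Adj G u w → ¬ IsLeaf G u → Σ (Fin n) λ y → Adj G u y × y ≢ w
  ¬leaf⇒other {u} {w} uw ¬leaf with F.any? (λ y → (G u y B.≟ true) ×-dec ¬? (y F.≟ w))
  ... | yes found = found
  ... | no none = ⊥-elim (¬leaf (trans (length-filterᵇ (G u) (allFin n)) (trans (sumL-cong eq (allFin n)) (sumV-δ w (λ _ → 1)))))
    where
    eq : ∀ v → (if G u v then 1 else 0) ≡ δ w v * 1
    eq v with w F.≟ v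
    ... | yes refl rewrite uw = refl
    ... | no w≢v with G u v in e
    ...   | false = refl
    ...   | true  = ⊥-elim (none (v , e , w≢v ∘ sym))

  -- A local condition, hence easy to preserve when walks are extended, glued or redirected. In an
  -- acyclic graph it already forces distinct vertices, so paths in trees are handled through it.
  NonBacktracking : List (Fin n) → Set
  NonBacktracking []              = ⊤
  NonBacktracking (x ∷ [])        = ⊤
  NonBacktracking (x ∷ y ∷ [])    = Adj G x y
  NonBacktracking (x ∷ y ∷ z ∷ r) = Adj G x y × x ≢ z × NonBacktracking (y ∷ z ∷ r)

  nb-tail : ∀ x xs → NonBacktracking (x ∷ xs) → NonBacktracking xs
  nb-tail x []          _           = tt
  nb-tail x (y ∷ [])    _           = tt
  nb-tail x (y ∷ z ∷ r) (_ , _ , p) = p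

  nb-adj : ∀ {x y r} → NonBacktracking (x ∷ y ∷ r) → Adj G x y
  nb-adj {r = []}    a       = a
  nb-adj {r = _ ∷ _} (a , _) = a

  nb-cons : ∀ {v x} post → Adj G v x → v ∉ post → NonBacktracking (x ∷ post) → NonBacktracking (v ∷ x ∷ post)
  nb-cons []         a _  _ = a
  nb-cons (z ∷ post) a v∉ p = a , (λ e → v∉ (here e)) , p

  nb-suffix : ∀ pre {xs} → NonBacktracking (pre ++ xs) → NonBacktracking xs
  nb-suffix []        p = p
  nb-suffix (x ∷ pre) p = nb-suffix pre (nb-tail x (pre ++ _) p)

  nb-chain : ∀ xs → NonBacktracking xs → Chain G xs
  nb-chain []           _ = tt
  nb-chain (x ∷ [])     _ = tt
  nb-chain (x ∷ y ∷ xs) p = nb-adj p , nb-chain (y ∷ xs) (nb-tail x (y ∷ xs) p)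

  -- The two walks overlap in the edge between `x` and `w`, so every turn of the glued walk already
  -- occurs in one of them.
  nb-glue : ∀ ls {x w rs} → NonBacktracking (x ∷ w ∷ rs) → NonBacktracking (w ∷ x ∷ ls) → NonBacktracking (ls ʳ++ (x ∷ w ∷ rs))
  nb-glue []       right left          = right
  nb-glue (y ∷ ls) right (_ , w≢y , p) = nb-glue ls (sym-adj (nb-adj p) , w≢y ∘ sym , right) p

  -- The only new turn is at `x`, and `v` is not the predecessor of `x` because it is absent from
  -- `pre`.
  nb-redirect : ∀ pre {x post v ls} → NonBacktracking (pre ++ x ∷ post) → v ∉ pre → NonBacktracking (x ∷ v ∷ ls) →
    NonBacktracking (pre ++ x ∷ v ∷ ls)
  nb-redirect []              p v∉ q = q
  nb-redirect (y ∷ [])        p v∉ q = nb-adj p , (λ e → v∉ (here (sym e))) , q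
  nb-redirect (y ∷ z ∷ [])    (a , y≢x , p) v∉ q = a , y≢x , nb-redirect (z ∷ []) p (v∉ ∘ there) q
  nb-redirect (y ∷ z ∷ u ∷ r) (a , y≢u , p) v∉ q = a , y≢u , nb-redirect (z ∷ u ∷ r) p (v∉ ∘ there) q

chain-prefix : ∀ {n} {G : Graph n} xs {x post} → Chain G (xs ++ x ∷ post) → Chain G (xs ++ x ∷ [])
chain-prefix []           _        = tt
chain-prefix (y ∷ [])     (a , _)  = a , tt
chain-prefix (y ∷ z ∷ xs) (a , ch) = a , chain-prefix (z ∷ xs) ch

distinct-++ : ∀ {n} (xs : List (Fin n)) {ys} → Distinct (xs ++ ys) → Distinct xs × (∀ u → u ∈ xs → u ∉ ys)
distinct-++ []       d = tt , λ _ ()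
distinct-++ (x ∷ xs) {ys} (x∉ , d) with distinct-++ xs d
... | d′ , apart = ((λ y p → x∉ y (∈-++⁺ˡ p)) , d′) , λ { u (here refl) q → x∉ u (∈-++⁺ʳ xs q) refl ; u (there p) q → apart u p q }

distinct-ʳ++ : ∀ {n} (ls : List (Fin n)) {ys} → Distinct (ls ʳ++ ys) → Distinct ys × (∀ u → u ∈ ls → u ∉ ys)
distinct-ʳ++ []       d = d , λ _ ()
distinct-ʳ++ (x ∷ ls) d with distinct-ʳ++ ls d
... | (x∉ , d′) , apart = d′ , λ { u (here refl) q → x∉ u q refl ; u (there p) q → apart u p (there q) }

module Acyclic {n} {G : Graph n} (simple : IsSimple G) (acyclic : ¬ HasCycle G) where

  NB = NonBacktracking simple

  -- A return to `x` after one step is a loop and after two steps a backtrack. A later return closes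
  -- a cycle, as the vertices in between are known to be distinct.
  nb-fresh : ∀ x ys → NB (x ∷ ys) → Distinct ys → x ∉ ys
  nb-fresh x ys p dis x∈ with ∈-∃++ x∈
  ... | [] , post , refl = adj-≢ simple (nb-adj simple p) refl
  ... | a ∷ [] , post , refl = proj₁ (proj₂ p) refl
  ... | a ∷ b ∷ pre , post , refl = acyclic (x , a ∷ b ∷ pre , s≤s (s≤s z≤n) ,
      ((λ y y∈pre e → proj₂ (distinct-++ (a ∷ b ∷ pre) dis) y y∈pre (here (sym e))) , proj₁ (distinct-++ (a ∷ b ∷ pre) dis)) ,
      chain-prefix (x ∷ a ∷ b ∷ pre) (nb-chain simple _ p))

  nb-distinct : ∀ xs → NB xs → Distinct xs
  nb-distinct []       _ = tt
  nb-distinct (x ∷ ys) p = (λ { y y∈ refl → nb-fresh x ys p dis y∈ }) , dis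
    where
    dis : Distinct ys
    dis = nb-distinct ys (nb-tail simple x ys p)

  EndsInLeaf : List (Fin n) → Set
  EndsInLeaf []          = ⊥
  EndsInLeaf (x ∷ [])    = IsLeaf G x
  EndsInLeaf (x ∷ y ∷ r) = EndsInLeaf (y ∷ r)

  -- At a vertex that is not a leaf the walk can go on without turning back. By acyclicity it is a
  -- path, so `n` further steps without a leaf would produce `n + 2` distinct vertices.
  ray : ∀ w x → Adj G w x → Σ (List (Fin n)) λ ls → NB (w ∷ x ∷ ls) × EndsInLeaf (x ∷ ls)
  ray w x wx with extend n w x wx
    where
    extend : ∀ m w x → Adj G w x → Σ (List (Fin n)) λ ls → NB (w ∷ x ∷ ls) × (EndsInLeaf (x ∷ ls) ⊎ length ls ≡ m)
    extend zero    w x a = [] , a , inj₂ refl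
    extend (suc m) w x a with degree G x ≟ 1
    ... | yes leaf = [] , a , inj₁ leaf
    ... | no ¬leaf with ¬leaf⇒other simple (sym-adj simple a) ¬leaf
    ...   | y , xy , y≢w with extend m x y xy
    ...     | ls , nb , inj₁ end = y ∷ ls , (a , y≢w ∘ sym , nb) , inj₁ end
    ...     | ls , nb , inj₂ e   = y ∷ ls , (a , y≢w ∘ sym , nb) , inj₂ (cong suc e)
  ... | ls , nb , inj₁ end = ls , nb , end
  ... | ls , nb , inj₂ e   = ⊥-elim (1+n≰n (≤-trans (n≤1+n (suc n)) (subst (λ k → suc (suc k) ≤ n) e (distinct-length (w ∷ x ∷ ls) (nb-distinct (w ∷ x ∷ ls) nb)))))

  ray-support : ∀ w x ls → NB (w ∷ x ∷ ls) → EndsInLeaf (x ∷ ls) → Σ (Fin n) λ u → u ∈ w ∷ x ∷ ls × AdjToLeaf G u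
  ray-support w x []       a            leaf = w , here refl , x , a , leaf
  ray-support w x (y ∷ ls) (_ , _ , nb) end with ray-support x y ls nb end
  ... | u , u∈ , s = u , there u∈ , s

  -- A branch that leaves the path `xs` never returns to it: the part of `xs` up to `x` followed by
  -- the branch is non-backtracking, and so is the reversed branch followed by the part from `x` on.
  -- Both therefore have distinct vertices.
  branch-avoids : ∀ {xs x v ls u} → NB xs → x ∈ xs → v ∉ xs → NB (x ∷ v ∷ ls) → u ∈ v ∷ ls → u ∉ xs
  branch-avoids {x = x} {v} {ls} {u} nb x∈ v∉ nbr u∈ u∈xs with ∈-∃++ x∈
  ... | pre , post , refl with ∈-++⁻ pre u∈xs
  ...   | inj₁ u∈pre = proj₂ (distinct-++ pre (nb-distinct _ (nb-redirect simple pre nb (λ p → v∉ (∈-++⁺ˡ p)) nbr))) u u∈pre (there u∈)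
  ...   | inj₂ u∈post with distinct-ʳ++ ls (nb-distinct _ (nb-glue simple ls
            (nb-cons simple post (sym-adj simple (nb-adj simple nbr)) (λ p → v∉ (∈-++⁺ʳ pre (there p))) (nb-suffix simple pre nb)) nbr))
  ...     | (v-fresh , _) , apart with u∈
  ...       | here refl = v-fresh u u∈post refl
  ...       | there u∈ls = apart u u∈ls (there u∈post)

  -- Rays through the two outer edges prolong the given path in both directions until they reach
  -- leaves.
  spine-list : ∀ {a b c d} → Path4 G a b c d → Σ (Fin n) λ x → Σ (List (Fin n)) λ xs →
    NB (x ∷ xs) × IsLeaf G x × EndsInLeaf (x ∷ xs) × 4 ≤ length (x ∷ xs)
  spine-list {a} {b} {c} {d} (path4 dis ab bc cd) with ray b a (sym-adj simple ab) | ray c d cd | distinct-≢ dis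
  ... | ls , nbl , endl | rs , nbr , endr | _ , a≢c , _ , _ , b≢d , _ =
    start ls a (b ∷ c ∷ d ∷ rs) (nb-glue simple (a ∷ ls) (bc , b≢d , nbr) (sym-adj simple bc , a≢c ∘ sym , nbl)) endl endr (s≤s (s≤s (s≤s (s≤s z≤n))))
    where
    start : ∀ ls a rs → NB (ls ʳ++ (a ∷ rs)) → EndsInLeaf (a ∷ ls) → EndsInLeaf (a ∷ rs) → 4 ≤ length (a ∷ rs) →
      Σ (Fin n) λ x → Σ (List (Fin n)) λ xs → NB (x ∷ xs) × IsLeaf G x × EndsInLeaf (x ∷ xs) × 4 ≤ length (x ∷ xs)
    start []       a rs nb leaf end len = a , rs , nb , leaf , end , len
    start (y ∷ ls) a rs nb leaf end len = start ls y (a ∷ rs) nb leaf end (≤-trans len (n≤1+n _))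

  ends-nth : ∀ o x xs → EndsInLeaf (x ∷ xs) → IsLeaf G (nth o (x ∷ xs) (length xs))
  ends-nth o x []       leaf = leaf
  ends-nth o x (y ∷ xs) end  = ends-nth o y xs end

-- A path from leaf to leaf, of length 3 + m, without chords.
record Spine {n} (G : Graph n) (w : ℕ → Fin n) (m : ℕ) : Set where
  field
    adj     : ∀ i → i < 3 + m → Adj G (w i) (w (suc i))
    inj     : ∀ i j → i ≤ 3 + m → j ≤ 3 + m → w i ≡ w j → i ≡ j
    chord   : ∀ i j → i ≤ 3 + m → j ≤ 3 + m → Adj G (w i) (w j) → j ≡ suc i ⊎ i ≡ suc j
    leaf₀   : IsLeaf G (w 0)
    leafₘ   : IsLeaf G (w (3 + m))

module Spines {n} {G : Graph n} (simple : IsSimple G) (acyclic : ¬ HasCycle G) where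
  open Acyclic simple acyclic public

  record SpineOf (xs : List (Fin n)) : Set where
    field
      w  : ℕ → Fin n
      m  : ℕ
      spine : Spine G w m
      nb : NB xs
      on  : ∀ i → i ≤ 3 + m → w i ∈ xs
      off : ∀ v → v ∈ xs → Σ ℕ λ i → i ≤ 3 + m × v ≡ w i

  acyclic-length : ∀ k → 3 ≤ k → ¬ CycleOfLength G k
  acyclic-length k 3≤k (v , ws , e , dis , ch) = acyclic (v , ws , ≤-pred (subst (3 ≤_) (sym e) 3≤k) , dis , ch)

  spine-of : ∀ {a b c d} → Path4 G a b c d → Σ (List (Fin n)) SpineOf
  spine-of P with spine-list P
  ... | x , xs@(x₁ ∷ x₂ ∷ x₃ ∷ r) , nb , leaf , end , len = x ∷ xs , record
    { w = w ; m = length r ; nb = nb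
    ; spine = record { adj = λ i i< → nth-chain x (x ∷ xs) i (nb-chain simple _ nb) (s≤s i<)
                     ; inj = λ i j i≤ j≤ → nth-injective x (x ∷ xs) i j dis (s≤s i≤) (s≤s j≤)
                     ; chord = chord ; leaf₀ = leaf ; leafₘ = ends-nth x x xs end }
    ; on = λ i i≤ → nth-∈ x (x ∷ xs) i (s≤s i≤)
    ; off = λ v p → let i , i< , e = ∈-nth x (x ∷ xs) p in i , ≤-pred i< , e }
    where
    w = nth x (x ∷ xs)
    m = length r
    dis = nb-distinct (x ∷ xs) nb
    gap : ∀ i d → suc (suc d) + i ≤ 3 + m → ¬ Adj G (w i) (w (suc (suc d) + i))
    gap i d hi a = acyclic-length (3 + d) (s≤s (s≤s (s≤s z≤n)))
      (segment-cycle w (2 + d) i (λ j e _ pos lt → nth-distinct x (x ∷ xs) j e dis pos (≤-trans lt (s≤s hi)))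
        (λ j _ lt → nth-chain x (x ∷ xs) j (nb-chain simple _ nb) (s≤s (≤-trans lt hi))) (sym-adj simple a))
    up : ∀ i j → i < j → j ≤ 3 + m → Adj G (w i) (w j) → j ≡ suc i
    up i j i<j j≤ a with m≤n⇒m<n∨m≡n i<j
    ... | inj₂ e = sym e
    ... | inj₁ lt = ⊥-elim (gap i (j ∸ suc (suc i)) (subst (_≤ 3 + m) (sym eq) j≤) (subst (λ l → Adj G (w i) (w l)) (sym eq) a))
      where
      eq : suc (suc (j ∸ suc (suc i))) + i ≡ j
      eq = trans (sym (trans (+-suc _ (suc i)) (cong suc (+-suc _ i)))) (m∸n+n≡m lt)
    chord : ∀ i j → i ≤ 3 + m → j ≤ 3 + m → Adj G (w i) (w j) → j ≡ suc i ⊎ i ≡ suc j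
    chord i j i≤ j≤ a with <-cmp i j
    ... | tri< i<j _ _ = inj₁ (up i j i<j j≤ a)
    ... | tri≈ _ refl _ = ⊥-elim (adj-≢ simple a refl)
    ... | tri> _ _ j<i = inj₂ (up j i j<i i≤ (sym-adj simple a))
  ... | x , [] , _ , _ , _ , s≤s ()
  ... | x , _ ∷ [] , _ , _ , _ , s≤s (s≤s ())
  ... | x , _ ∷ _ ∷ [] , _ , _ , _ , s≤s (s≤s (s≤s ()))

  module _ {xs} (S : SpineOf xs) where
    open SpineOf S
    open Spine spine

    inner-¬leaf : ∀ i → i ≤ 1 + m → ¬ IsLeaf G (w (suc i))
    inner-¬leaf i i≤ = two-neighbours⇒¬leaf simple (sym-adj simple (adj i (s≤s (≤-trans i≤ (n≤1+n _))))) (adj (suc i) (s≤s (s≤s i≤)))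
      λ e → contradiction (inj i (2 + i) (≤-trans i≤ (≤-trans (n≤1+n _) (n≤1+n _))) (s≤s (s≤s i≤)) e) (<⇒≢ (n≤1+n (suc i)))

  -- Common ground of both directions: the shape expressed by `brush` follows from the absence of
  -- spiders on one side and from the bound on the vertices adjacent to leaves on the other.
  module Brushes (connected : Connected G) {xs} (S : SpineOf xs)
    (brush : ∀ i v → i ≤ 3 + SpineOf.m S → v ∉ xs → Adj G (SpineOf.w S i) v → IsLeaf G v × (i ≡ 1 ⊎ i ≡ 2 + SpineOf.m S)) where
    open SpineOf S
    open Spine spine

    data Level (v : Fin n) : ℕ → Set where
      left  : IsLeaf G v → Adj G v (w 1) → Level v 0
      right : IsLeaf G v → Adj G v (w (2 + m)) → Level v (3 + m)
      inner : ∀ i → i ≤ 1 + m → v ≡ w (suc i) → Level v (suc i)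

    spine-level : ∀ i → i ≤ 3 + m → Level (w i) i
    spine-level zero i≤ = left leaf₀ (adj 0 (s≤s z≤n))
    spine-level (suc i) (s≤s i≤) with m≤n⇒m<n∨m≡n i≤
    ... | inj₁ lt = inner i (≤-pred lt) refl
    ... | inj₂ refl = right leafₘ (sym-adj simple (adj (2 + m) ≤-refl))

    has-level : ∀ v → Σ ℕ (Level v)
    has-level v = walk-closure (λ v → Σ ℕ (Level v)) closed (connected (w 0) v) (0 , spine-level 0 z≤n)
      where
      closed : ∀ u v → Σ ℕ (Level u) → Adj G u v → Σ ℕ (Level v)
      closed u v (_ , left leaf a) uv = 1 , inner 0 z≤n (leaf-unique simple leaf uv a)
      closed u v (_ , right leaf a) uv = 2 + m , inner (1 + m) ≤-refl (leaf-unique simple leaf uv a)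
      closed u v (_ , inner i i≤ refl) uv with v ∈ₗ? xs
      ... | yes p = let j , j≤ , e = off v p in j , subst (λ v → Level v j) (sym e) (spine-level j j≤)
      ... | no v∉ with brush (suc i) v (s≤s (≤-trans i≤ (n≤1+n _))) v∉ uv
      ...   | leaf , inj₁ e = 0 , left leaf (subst (λ l → Adj G v (w l)) e (sym-adj simple uv))
      ...   | leaf , inj₂ e = 3 + m , right leaf (subst (λ l → Adj G v (w l)) e (sym-adj simple uv))

    level-single : ∀ {u v i} → i ≤ 1 + m → Level u (suc i) → Level v (suc i) → u ≡ v
    level-single i≤ (inner i _ e) (inner .i _ e′) = trans e (sym e′)
    level-single i≤ (right _ _) _ = ⊥-elim (1+n≰n i≤)
    level-single i≤ (inner _ i≤′ _) (right _ _) = ⊥-elim (1+n≰n i≤)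

    level-adj : ∀ {u v i j} → Level u i → Level v j → Adj G u v → j ≡ suc i ⊎ i ≡ suc j
    level-adj (inner i i≤ refl) (inner j j≤ refl) uv = chord (suc i) (suc j) (s≤s (≤-trans i≤ (n≤1+n _))) (s≤s (≤-trans j≤ (n≤1+n _))) uv
    level-adj (left leaf a) (inner j j≤ refl) uv = inj₁ (inj (suc j) 1 (s≤s (≤-trans j≤ (n≤1+n _))) (s≤s z≤n) (leaf-unique simple leaf uv a))
    level-adj (inner i i≤ refl) (left leaf a) uv = inj₂ (inj (suc i) 1 (s≤s (≤-trans i≤ (n≤1+n _))) (s≤s z≤n) (leaf-unique simple leaf (sym-adj simple uv) a))
    level-adj (right leaf a) (inner j j≤ refl) uv = inj₂ (cong suc (sym (inj (suc j) (2 + m) (s≤s (≤-trans j≤ (n≤1+n _))) (n≤1+n _) (leaf-unique simple leaf uv a))))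
    level-adj (inner i i≤ refl) (right leaf a) uv = inj₁ (cong suc (sym (inj (suc i) (2 + m) (s≤s (≤-trans i≤ (n≤1+n _))) (n≤1+n _) (leaf-unique simple leaf (sym-adj simple uv) a))))
    level-adj (left leaf a) (left leaf′ _) uv = ⊥-elim (inner-¬leaf S 0 z≤n (subst (IsLeaf G) (leaf-unique simple leaf uv a) leaf′))
    level-adj (left leaf a) (right leaf′ _) uv = ⊥-elim (inner-¬leaf S 0 z≤n (subst (IsLeaf G) (leaf-unique simple leaf uv a) leaf′))
    level-adj (right leaf a) (left leaf′ _) uv = ⊥-elim (inner-¬leaf S (1 + m) ≤-refl (subst (IsLeaf G) (leaf-unique simple leaf uv a) leaf′))
    level-adj (right leaf a) (right leaf′ _) uv = ⊥-elim (inner-¬leaf S (1 + m) ≤-refl (subst (IsLeaf G) (leaf-unique simple leaf uv a) leaf′))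

    supports : ∀ u → AdjToLeaf G u → u ≡ w 1 ⊎ u ≡ w (2 + m)
    supports u (l , ul , leaf) with has-level l
    ... | _ , left _ a = inj₁ (leaf-unique simple leaf (sym-adj simple ul) a)
    ... | _ , right _ a = inj₂ (leaf-unique simple leaf (sym-adj simple ul) a)
    ... | _ , inner i i≤ refl = ⊥-elim (inner-¬leaf S i i≤ leaf)

-- Mengerian graphs

missing-vertex : ∀ {n} (xs : List (Fin n)) → length xs < n → Σ (Fin n) λ v → v ∉ xs
missing-vertex {n} xs lt with F.any? (λ v → ¬? (v ∈ₗ? xs))
... | yes found = found
... | no none = ⊥-elim (<⇒≱ lt (F.injective⇒≤ {f = λ v → index (mem v)} inj))
  where
  mem : ∀ v → v ∈ xs
  mem v with v ∈ₗ? xs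
  ... | yes p = p
  ... | no ¬p = ⊥-elim (none (v , ¬p))
  inj : ∀ {u v} → index (mem u) ≡ index (mem v) → u ≡ v
  inj {u} {v} e = trans (lookup-index (mem u)) (trans (cong (L.lookup xs) e) (sym (lookup-index (mem v))))

exit : ∀ {n} {G : Graph n} (xs : List (Fin n)) {u v} → u ∈ xs → v ∉ xs → Walk G u v →
  Σ (Fin n) λ a → Σ (Fin n) λ b → a ∈ xs × b ∉ xs × Adj G a b
exit xs u∈ v∉ stop = ⊥-elim (v∉ u∈)
exit xs u∈ v∉ (step {v = b} a w) with b ∈ₗ? xs
... | yes b∈ = exit xs b∈ v∉ w
... | no b∉ = _ , b , u∈ , b∉ , a

reflects : ∀ {P Q : Set} (p : Dec P) (q : Dec Q) {b} → (P → b ≡ true) → (Q → b ≡ true) → (b ≡ true → P ⊎ Q) → b ≡ ⌊ p ⌋ ∨ ⌊ q ⌋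
reflects (yes p) _       f _ _ = f p
reflects (no _)  (yes q) _ f _ = f q
reflects (no ¬p) (no ¬q) {false} _ _ _ = refl
reflects (no ¬p) (no ¬q) {true} _ _ f with f refl
... | inj₁ p = ⊥-elim (¬p p)
... | inj₂ q = ⊥-elim (¬q q)

module Forward {n} {G : Graph n} (simple : IsSimple G) (5≤n : 5 ≤ n) (connected : Connected G) (men : Mengerian (H3 G)) where

  private
    sy : ∀ {u v} → Adj G u v → Adj G v u
    sy = sym-adj simple
    ne : ∀ {u v} → Adj G u v → u ≢ v
    ne = adj-≢ simple

  exit-list : ∀ x xs → length (x ∷ xs) ≤ 4 → Σ (Fin n) λ a → Σ (Fin n) λ b → a ∈ x ∷ xs × b ∉ x ∷ xs × Adj G a b
  exit-list x xs len with missing-vertex (x ∷ xs) (≤-trans (s≤s len) 5≤n)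
  ... | v , v∉ = exit (x ∷ xs) (here refl) v∉ (connected x v)

  cycle₃ : ∀ {a b c} → Adj G a b → Adj G b c → Adj G c a → CycleOfLength G 3
  cycle₃ {a} {b} {c} ab bc ca = a , b ∷ c ∷ [] , refl ,
    ((λ { _ #0 → ne ab ; _ #1 → ne (sy ca) }) , (λ { _ #0 → ne bc }) , (λ _ ()) , tt) , ab , bc , ca , tt

  cycle₄ : ∀ {a b c d} → Adj G a b → Adj G b c → Adj G c d → Adj G d a → a ≢ c → b ≢ d → CycleOfLength G 4
  cycle₄ {a} {b} {c} {d} ab bc cd da a≢c b≢d = a , b ∷ c ∷ d ∷ [] , refl ,
    distinct4 (ne ab) a≢c (ne (sy da)) (ne bc) b≢d (ne cd) , ab , bc , cd , da , tt

  cycle₅ : ∀ {a b c d e} → Adj G a b → Adj G b c → Adj G c d → Adj G d e → Adj G e a →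
    a ≢ c → a ≢ d → b ≢ d → b ≢ e → c ≢ e → CycleOfLength G 5
  cycle₅ {a} {b} {c} {d} {e} ab bc cd de ea a≢c a≢d b≢d b≢e c≢e = a , b ∷ c ∷ d ∷ e ∷ [] , refl ,
    ((λ { _ #0 → ne ab ; _ #1 → a≢c ; _ #2 → a≢d ; _ #3 → ne (sy ea) }) ,
     distinct4 (ne bc) b≢d b≢e (ne cd) c≢e (ne de)) , ab , bc , cd , de , ea , tt

  -- In the absence of short cycles, two non-leaf neighbours and a third one span an induced spider.
  no-branching : (∀ k → 3 ≤ k → k ≤ 5 → ¬ CycleOfLength G k) → ∀ {w x y z} → Adj G w x → Adj G w y → Adj G w z →
    x ≢ y → x ≢ z → y ≢ z → ¬ IsLeaf G x → ¬ IsLeaf G y → ⊥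
  no-branching short {w} {x} {y} {z} wx wy wz x≢y x≢z y≢z ¬lx ¬ly
    with ¬leaf⇒other simple (sy wx) ¬lx | ¬leaf⇒other simple (sy wy) ¬ly
  ... | x′ , xx′ , x′≢w | y′ , yy′ , y′≢w =
    no-spider simple men distinct (sy xx′) (sy wx) wy yy′ wz l-leaf l′-leaf
    where
    no₃ : ¬ CycleOfLength G 3
    no₃ = short 3 ≤-refl (s≤s (s≤s (s≤s z≤n)))
    no₄ : ¬ CycleOfLength G 4
    no₄ = short 4 (n≤1+n 3) (n≤1+n 4)
    no₅ : ¬ CycleOfLength G 5
    no₅ = short 5 (≤-trans (n≤1+n 3) (n≤1+n 4)) ≤-refl
    x′≢y : x′ ≢ y
    x′≢y refl = no₃ (cycle₃ wx xx′ (sy wy))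
    x′≢y′ : x′ ≢ y′
    x′≢y′ refl = no₄ (cycle₄ wx xx′ (sy yy′) (sy wy) (x′≢w ∘ sym) x≢y)
    x′≢z : x′ ≢ z
    x′≢z refl = no₃ (cycle₃ wx xx′ (sy wz))
    x≢y′ : x ≢ y′
    x≢y′ refl = no₃ (cycle₃ wy yy′ (sy wx))
    y′≢z : y′ ≢ z
    y′≢z refl = no₃ (cycle₃ wy yy′ (sy wz))
    distinct : Distinct (x′ ∷ x ∷ w ∷ y ∷ y′ ∷ z ∷ [])
    distinct = (λ { _ #0 → ne (sy xx′) ; _ #1 → x′≢w ; _ #2 → x′≢y ; _ #3 → x′≢y′ ; _ (there #3) → x′≢z }) ,
      (λ { _ #0 → ne (sy wx) ; _ #1 → x≢y ; _ #2 → x≢y′ ; _ #3 → x≢z }) ,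
      distinct4 (ne wy) (y′≢w ∘ sym) (ne wz) (ne yy′) y≢z y′≢z
    l-leaf : ∀ v → v ∈ x′ ∷ x ∷ w ∷ y ∷ y′ ∷ z ∷ [] → Adj G x′ v → v ≡ x
    l-leaf v #0 a = ⊥-elim (ne a refl)
    l-leaf v #1 a = refl
    l-leaf v #2 a = ⊥-elim (no₃ (cycle₃ wx xx′ a))
    l-leaf v #3 a = ⊥-elim (no₄ (cycle₄ wx xx′ a (sy wy) (x′≢w ∘ sym) x≢y))
    l-leaf v (there #3) a = ⊥-elim (no₅ (cycle₅ wx xx′ a (sy yy′) (sy wy) (x′≢w ∘ sym) (y′≢w ∘ sym) x≢y′ x≢y x′≢y))
    l-leaf v (there (there #3)) a = ⊥-elim (no₄ (cycle₄ wx xx′ a (sy wz) (x′≢w ∘ sym) x≢z))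
    l′-leaf : ∀ v → v ∈ x′ ∷ x ∷ w ∷ y ∷ y′ ∷ z ∷ [] → Adj G y′ v → v ≡ y
    l′-leaf v #0 a = ⊥-elim (no₅ (cycle₅ wx xx′ (sy a) (sy yy′) (sy wy) (x′≢w ∘ sym) (y′≢w ∘ sym) x≢y′ x≢y x′≢y))
    l′-leaf v #1 a = ⊥-elim (no₄ (cycle₄ wy yy′ a (sy wx) (y′≢w ∘ sym) (x≢y ∘ sym)))
    l′-leaf v #2 a = ⊥-elim (no₃ (cycle₃ wy yy′ a))
    l′-leaf v #3 a = refl
    l′-leaf v (there #3) a = ⊥-elim (ne a refl)
    l′-leaf v (there (there #3)) a = ⊥-elim (no₄ (cycle₄ wy yy′ a (sy wz) (y′≢w ∘ sym) y≢z))

  module Tree (acyclic : ¬ HasCycle G) where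
    open Spines simple acyclic

    with-path : ∀ {a b c d} → Path4 G a b c d → PathWithDoubleStars G
    with-path P with spine-of P
    ... | xs , S = (connected , acyclic) , w 1 , w (2 + m) , Brushes.supports connected S brush
      where
      open SpineOf S
      open Spine spine
      branch : ∀ {w x y z} → Adj G w x → Adj G w y → Adj G w z → x ≢ y → x ≢ z → y ≢ z → ¬ IsLeaf G x → ¬ IsLeaf G y → ⊥
      branch = no-branching (λ k 3≤k _ → acyclic-length k 3≤k)
      off-≢ : ∀ {v} → v ∉ xs → ∀ i → i ≤ 3 + m → w i ≢ v
      off-≢ v∉ i i≤ refl = v∉ (on i i≤)
      brush : ∀ i v → i ≤ 3 + m → v ∉ xs → Adj G (w i) v → IsLeaf G v × (i ≡ 1 ⊎ i ≡ 2 + m)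
      brush zero v _ v∉ a = ⊥-elim (off-≢ v∉ 1 (s≤s z≤n) (leaf-unique simple leaf₀ (adj 0 (s≤s z≤n)) a))
      brush (suc i) v (s≤s i≤) v∉ a with m≤n⇒m<n∨m≡n i≤
      ... | inj₂ refl = ⊥-elim (off-≢ v∉ (2 + m) (n≤1+n _) (leaf-unique simple leafₘ (sy (adj (2 + m) ≤-refl)) a))
      ... | inj₁ (s≤s i≤1+m) = at i i≤1+m refl
        where
        prev≢next : w i ≢ w (2 + i)
        prev≢next e = contradiction (inj i (2 + i) (≤-trans i≤ (n≤1+n _)) (s≤s (s≤s i≤1+m)) e) (<⇒≢ (n≤1+n (suc i)))
        prev : Adj G (w (suc i)) (w i)
        prev = sy (adj i (s≤s i≤))
        next : Adj G (w (suc i)) (w (2 + i))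
        next = adj (suc i) (s≤s (s≤s i≤1+m))
        prev≢v : w i ≢ v
        prev≢v = off-≢ v∉ i (≤-trans i≤ (n≤1+n _))
        next≢v : w (2 + i) ≢ v
        next≢v = off-≢ v∉ (2 + i) (s≤s (s≤s i≤1+m))
        -- At `w 1` and `w (2 + m)` one spine neighbour is available as a non-leaf, so a non-leaf
        -- `v` would give a branching. Strictly between them both spine neighbours are non-leaves,
        -- and then any `v` does.
        at : ∀ j → j ≤ 1 + m → j ≡ i → IsLeaf G v × (suc i ≡ 1 ⊎ suc i ≡ 2 + m)
        at zero _ refl with degree G v ≟ 1
        ... | yes leaf = leaf , inj₁ refl
        ... | no ¬leaf = ⊥-elim (branch a next prev (next≢v ∘ sym) (prev≢v ∘ sym) (prev≢next ∘ sym) ¬leaf (inner-¬leaf S 1 (s≤s z≤n)))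
        at (suc j) j≤ refl with m≤n⇒m<n∨m≡n j≤
        ... | inj₁ lt = ⊥-elim (branch prev next a prev≢next prev≢v next≢v (inner-¬leaf S j (≤-trans (n≤1+n j) j≤)) (inner-¬leaf S (2 + j) lt))
        ... | inj₂ refl with degree G v ≟ 1
        ...   | yes leaf = leaf , inj₂ refl
        ...   | no ¬leaf = ⊥-elim (branch a prev next (prev≢v ∘ sym) (next≢v ∘ sym) prev≢next ¬leaf (inner-¬leaf S j (≤-trans (n≤1+n j) j≤)))

    -- An edge from a neighbour of `w` to a vertex other than `w` would complete a path on four
    -- vertices with a second neighbour of `w`, or else a triangle.
    star : (∀ {a b c d} → ¬ Path4 G a b c d) → ∀ {w a b} → Adj G w a → Adj G w b → a ≢ b → PathWithDoubleStars G
    star none {w} {a} {b} wa wb a≢b = (connected , acyclic) , w , w , supp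
      where
      far : ∀ u v → Adj G w u → Adj G u v → v ≡ w
      far u v wu uv with v F.≟ w | u F.≟ a
      ... | yes e | _ = e
      ... | no v≢w | yes refl = ⊥-elim (none (path4 (distinct4 (ne (sy wb)) (a≢b ∘ sym) (λ { refl → acyclic-length 3 ≤-refl (cycle₃ wa uv (sy wb)) })
              (ne wa) (v≢w ∘ sym) (ne uv)) (sy wb) wa uv))
      ... | no v≢w | no u≢a = ⊥-elim (none (path4 (distinct4 (ne (sy wa)) (u≢a ∘ sym) (λ { refl → acyclic-length 3 ≤-refl (cycle₃ wu uv (sy wa)) })
              (ne wu) (v≢w ∘ sym) (ne uv)) (sy wa) wu uv))
      near : ∀ v → v ≡ w ⊎ Adj G w v
      near v = walk-closure (λ v → v ≡ w ⊎ Adj G w v) closed (connected w v) (inj₁ refl)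
        where
        closed : ∀ u v → u ≡ w ⊎ Adj G w u → Adj G u v → v ≡ w ⊎ Adj G w v
        closed u v (inj₁ refl) uv = inj₂ uv
        closed u v (inj₂ wu) uv = inj₁ (far u v wu uv)
      supp : ∀ u → AdjToLeaf G u → u ≡ w ⊎ u ≡ w
      supp u (l , ul , leaf) with near u
      ... | inj₁ e = inj₁ e
      ... | inj₂ wu with far u l wu ul
      ...   | refl = ⊥-elim (two-neighbours⇒¬leaf simple wa wb a≢b leaf)

    two-neighbours : Σ (Fin n) λ w → Σ (Fin n) λ a → Σ (Fin n) λ b → Adj G w a × Adj G w b × a ≢ b
    two-neighbours with missing-vertex [] (≤-trans (s≤s z≤n) 5≤n)
    ... | v , _ with exit-list v [] (s≤s z≤n)
    ... | _ , a , #0 , _ , va with exit-list v (a ∷ []) (s≤s (s≤s z≤n))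
    ...   | _ , b , #0 , b∉ , vb = v , a , b , va , vb , λ { refl → b∉ #1 }
    ...   | _ , b , #1 , b∉ , ab = a , v , b , sy va , ab , λ { refl → b∉ #0 }

    tree : PathWithDoubleStars G
    tree with F.any? (λ a → F.any? λ b → F.any? λ c → F.any? λ d → path4? G a b c d)
    ... | yes (_ , _ , _ , _ , P) = with-path P
    ... | no none = let w , a , b , wa , wb , a≢b = two-neighbours in star (λ P → none (_ , _ , _ , _ , P)) wa wb a≢b

  -- Both forbidden configurations have five vertices with three suitable 4-subsets. For pendants
  -- `w` at `A` and `v` at `B` they omit `v`, `w` or `C`; for a tail from `A` over `w` to `v` they
  -- omit `v`, `B` or `C`.
  module Triangle {A B C} (AB : Adj G A B) (BC : Adj G B C) (CA : Adj G C A) where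

    Off : Fin n → Set
    Off v = v ∉ A ∷ B ∷ C ∷ []

    no-pendants : ∀ {w v} → Off w → Off v → w ≢ v → Adj G A w → Adj G B v → ⊥
    no-pendants {w} {v} w∉ v∉ w≢v Aw Bv = three-of-five men {v} {w} {C} {A} {B}
      ((λ { _ #0 → w≢v ∘ sym ; _ #1 refl → v∉ #2 ; _ #2 refl → v∉ #0 ; _ #3 refl → v∉ #1 }) ,
       distinct4 (λ { refl → w∉ #2 }) (λ { refl → w∉ #0 }) (λ { refl → w∉ #1 }) (ne CA) (ne (sy BC)) (ne AB))
      (edge (path4 (distinct4 (ne BC) (ne (sy AB)) (λ { refl → w∉ #1 }) (ne CA) (λ { refl → w∉ #2 }) (ne Aw)) BC CA Aw) #3 #1 #2 #0)
      (edge (path4 (distinct4 (ne (sy Bv)) (λ { refl → v∉ #2 }) (λ { refl → v∉ #0 }) (ne BC) (ne (sy AB)) (ne CA)) (sy Bv) BC CA) #0 #3 #1 #2)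
      (edge (path4 (distinct4 (ne (sy Aw)) (λ { refl → w∉ #1 }) w≢v (ne AB) (λ { refl → v∉ #0 }) (ne Bv)) (sy Aw) AB Bv) #1 #2 #3 #0)

    no-tail : ∀ {w v} → Off w → Off v → Adj G A w → Adj G w v → ⊥
    no-tail {w} {v} w∉ v∉ Aw wv = three-of-five men {v} {B} {C} {A} {w}
      ((λ { _ #0 refl → v∉ #1 ; _ #1 refl → v∉ #2 ; _ #2 refl → v∉ #0 ; _ #3 → ne (sy wv) }) ,
       distinct4 (ne BC) (ne (sy AB)) (λ { refl → w∉ #1 }) (ne CA) (λ { refl → w∉ #2 }) (ne Aw))
      (edge (path4 (distinct4 (ne BC) (ne (sy AB)) (λ { refl → w∉ #1 }) (ne CA) (λ { refl → w∉ #2 }) (ne Aw)) BC CA Aw) #0 #1 #2 #3)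
      (edge (path4 (distinct4 (ne (sy wv)) (λ { refl → v∉ #0 }) (λ { refl → v∉ #2 }) (ne (sy Aw)) (λ { refl → w∉ #2 }) (ne (sy CA))) (sy wv) (sy Aw) (sy CA)) #0 #3 #2 #1)
      (edge (path4 (distinct4 (ne (sy wv)) (λ { refl → v∉ #0 }) (λ { refl → v∉ #1 }) (ne (sy Aw)) (λ { refl → w∉ #1 }) (ne AB)) (sy wv) (sy Aw) AB) #0 #3 #2 #1)

  module TriangleStar {A B C} (AB : Adj G A B) (BC : Adj G B C) (CA : Adj G C A) {w} (w∉ : w ∉ A ∷ B ∷ C ∷ []) (Aw : Adj G A w) where
    open Triangle AB BC CA
    module Swapped = Triangle (sy CA) (sy BC) (sy AB)

    swap : ∀ {v} → Off v → v ∉ A ∷ C ∷ B ∷ []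
    swap v∉ #0 = v∉ #0
    swap v∉ #1 = v∉ #2
    swap v∉ #2 = v∉ #1

    second : Σ (Fin n) λ v → Off v × v ≢ w × Adj G A v
    second with exit-list w (A ∷ B ∷ C ∷ []) ≤-refl
    ... | _ , v , #0 , v∉ , a = ⊥-elim (no-tail w∉ (v∉ ∘ there) Aw a)
    ... | _ , v , #1 , v∉ , a = v , v∉ ∘ there , (λ { refl → v∉ #0 }) , a
    ... | _ , v , #2 , v∉ , a = ⊥-elim (no-pendants w∉ (v∉ ∘ there) (λ { refl → v∉ #0 }) Aw a)
    ... | _ , v , #3 , v∉ , a = ⊥-elim (Swapped.no-pendants (swap w∉) (swap (v∉ ∘ there)) (λ { refl → v∉ #0 }) Aw a)

    -- `no-pendants` speaks of two different vertices, so alone it does not exclude a vertex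
    -- adjacent to both `A` and `B`. Another neighbour of `A` off the triangle, which exists because
    -- there are at least five vertices, closes this gap.
    other : ∀ u → Σ (Fin n) λ v → Off v × v ≢ u × Adj G A v
    other u with w F.≟ u
    ... | no w≢u = w , w∉ , w≢u , Aw
    ... | yes refl = second

    no-B : ∀ {v} → Off v → ¬ Adj G B v
    no-B {v} v∉ a = let u , u∉ , u≢v , Au = other v in no-pendants u∉ v∉ u≢v Au a

    no-C : ∀ {v} → Off v → ¬ Adj G C v
    no-C {v} v∉ a = let u , u∉ , u≢v , Au = other v in Swapped.no-pendants (swap u∉) (swap v∉) u≢v Au a

    position : ∀ v → v ∈ A ∷ B ∷ C ∷ [] ⊎ (Off v × Adj G A v)
    position v = walk-closure _ closed (connected A v) (inj₁ #0)
      where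
      closed : ∀ u v → u ∈ A ∷ B ∷ C ∷ [] ⊎ (Off u × Adj G A u) → Adj G u v → v ∈ A ∷ B ∷ C ∷ [] ⊎ (Off v × Adj G A v)
      closed u v q a with v ∈ₗ? (A ∷ B ∷ C ∷ [])
      ... | yes v∈ = inj₁ v∈
      closed u v (inj₁ #0) a | no v∉ = inj₂ (v∉ , a)
      closed u v (inj₁ #1) a | no v∉ = ⊥-elim (no-B v∉ a)
      closed u v (inj₁ #2) a | no v∉ = ⊥-elim (no-C v∉ a)
      closed u v (inj₂ (u∉ , Au)) a | no v∉ = ⊥-elim (no-tail u∉ v∉ Au a)

    starPlusEdge : StarPlusEdge G
    starPlusEdge = A , B , C , ne (sy AB) , ne CA , ne BC , λ u v → to u v , from u v
      where
      to : ∀ u v → Adj G u v → (u ≡ A × v ≢ A) ⊎ (v ≡ A × u ≢ A) ⊎ (u ≡ B × v ≡ C) ⊎ (u ≡ C × v ≡ B)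
      to u v a with position u | position v
      ... | inj₁ #0 | _ = inj₁ (refl , λ { refl → ne a refl })
      ... | _ | inj₁ #0 = inj₂ (inj₁ (refl , λ { refl → ne a refl }))
      ... | inj₁ #1 | inj₁ #1 = ⊥-elim (ne a refl)
      ... | inj₁ #1 | inj₁ #2 = inj₂ (inj₂ (inj₁ (refl , refl)))
      ... | inj₁ #2 | inj₁ #1 = inj₂ (inj₂ (inj₂ (refl , refl)))
      ... | inj₁ #2 | inj₁ #2 = ⊥-elim (ne a refl)
      ... | inj₁ #1 | inj₂ (v∉ , _) = ⊥-elim (no-B v∉ a)
      ... | inj₁ #2 | inj₂ (v∉ , _) = ⊥-elim (no-C v∉ a)
      ... | inj₂ (u∉ , _) | inj₁ #1 = ⊥-elim (no-B u∉ (sy a))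
      ... | inj₂ (u∉ , _) | inj₁ #2 = ⊥-elim (no-C u∉ (sy a))
      ... | inj₂ (u∉ , Au) | inj₂ (v∉ , _) = ⊥-elim (no-tail u∉ v∉ Au a)
      fromA : ∀ v → v ≢ A → Adj G A v
      fromA v v≢A with position v
      ... | inj₁ #0 = ⊥-elim (v≢A refl)
      ... | inj₁ #1 = AB
      ... | inj₁ #2 = sy CA
      ... | inj₂ (_ , a) = a
      from : ∀ u v → (u ≡ A × v ≢ A) ⊎ (v ≡ A × u ≢ A) ⊎ (u ≡ B × v ≡ C) ⊎ (u ≡ C × v ≡ B) → Adj G u v
      from u v (inj₁ (refl , v≢A)) = fromA v v≢A
      from u v (inj₂ (inj₁ (refl , u≢A))) = sy (fromA u u≢A)
      from u v (inj₂ (inj₂ (inj₁ (refl , refl)))) = BC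
      from u v (inj₂ (inj₂ (inj₂ (refl , refl)))) = sy BC

  triangle : ∀ {g} → Cycle G 3 g → StarPlusEdge G
  triangle {g} C with exit-list (g 0) (segment g 2 1) (s≤s (s≤s (s≤s z≤n)))
  ... | a , w , a∈ , w∉ , aw with segment-∈ g 3 0 a∈
  ...   | d , _ , refl = TriangleStar.starPlusEdge (adj i) (adj (1 + i)) (subst (Adj G (g (2 + i))) (per i) (adj (2 + i))) off aw
    where
    open Cycle C
    i = d + 0
    off : w ∉ g i ∷ g (1 + i) ∷ g (2 + i) ∷ []
    off #0 = w∉ (CycleProps.on-segment simple C i)
    off #1 = w∉ (CycleProps.on-segment simple C (1 + i))
    off #2 = w∉ (CycleProps.on-segment simple C (2 + i))

  -- A vertex `w` attached at `g i` can replace either cycle neighbour of `g i` at the end of a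
  -- path: omitting `w`, `g (1 + i)` or `g (3 + i)` from the five vertices leaves a hyperedge each
  -- time.
  no-4-cycle : ∀ {g} → ¬ Cycle G 4 g
  no-4-cycle {g} C with exit-list (g 0) (segment g 3 1) ≤-refl
  ... | a , w , a∈ , w∉ , aw with segment-∈ g 4 0 a∈
  ...   | d , _ , refl = three-of-five men {w} {g (1 + i)} {g (3 + i)} {g i} {g (2 + i)}
      ((λ { _ #0 → off (1 + i) ; _ #1 → off (3 + i) ; _ #2 → off i ; _ #3 → off (2 + i) }) ,
       distinct4 d13 (≢-sym d01) d12 (≢-sym d03) (≢-sym d23) d02)
      (edge (path4 (distinct4 d01 d02 d03 d12 d13 d23) (adj i) (adj (1 + i)) (adj (2 + i))) #2 #0 #3 #1)
      (edge (path4 (distinct4 (off i) (off (3 + i)) (off (2 + i)) d03 d02 (≢-sym d23)) (sy aw) (sy close) (sy (adj (2 + i)))) #0 #2 #1 #3)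
      (edge (path4 (distinct4 (off i) (off (1 + i)) (off (2 + i)) d01 d02 d12) (sy aw) (adj i) (adj (1 + i))) #0 #2 #1 #3)
    where
    open Cycle C
    i = d + 0
    off : ∀ j → w ≢ g j
    off j refl = w∉ (CycleProps.on-segment simple C j)
    close : Adj G (g (3 + i)) (g i)
    close = subst (Adj G (g (3 + i))) (per i) (adj (3 + i))
    d01 = inj i 1 (s≤s z≤n) (s≤s (s≤s z≤n))
    d02 = inj i 2 (s≤s z≤n) (s≤s (s≤s (s≤s z≤n)))
    d03 = inj i 3 (s≤s z≤n) ≤-refl
    d12 = inj (1 + i) 1 (s≤s z≤n) (s≤s (s≤s z≤n))
    d13 = inj (1 + i) 2 (s≤s z≤n) (s≤s (s≤s (s≤s z≤n)))
    d23 = inj (2 + i) 1 (s≤s z≤n) (s≤s (s≤s z≤n))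

  module Eight {g} (C : Cycle G 8 g) (none : ∀ j → j < 8 → ¬ (3 ≤ j × CycleOfLength G j)) where
    open Cycle C
    open CycleProps simple C

    chordless : Chordless
    chordless = shortest⇒chordless none

    apart₂ : ∀ i → g i ≢ g (2 + i)
    apart₂ i = inj i 2 (s≤s z≤n) (s≤s (s≤s (s≤s z≤n)))

    ¬leaf : ∀ i → ¬ IsLeaf G (g i)
    -- Passing to `8 + i` makes the predecessor of `g i` available as `g (7 + i)`.
    ¬leaf i = subst (λ v → ¬ IsLeaf G v) (per i) (two-neighbours⇒¬leaf simple (sy (adj (7 + i))) (adj (8 + i)) (apart₂ (7 + i)))

    on : ∀ v → On v
    on v = walk-closure On closed (connected (g 0) v) (0 , refl)
      where
      closed : ∀ u v → On u → Adj G u v → On v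
      closed u v (i , refl) a with v ∈ₗ? segment g 8 0
      ... | yes p = let d , _ , e = segment-∈ g 8 0 p in d + 0 , e
      ... | no v∉ = ⊥-elim (no-branching (λ k 3≤k k≤5 c → none k (s≤s (≤-trans k≤5 (≤-trans (n≤1+n 5) (n≤1+n 6)))) (3≤k , c))
        (sy (adj (7 + i))) (adj (8 + i)) (subst (λ u → Adj G u v) (sym (per i)) a) (apart₂ (7 + i)) (off (7 + i)) (off (9 + i)) (¬leaf (7 + i)) (¬leaf (9 + i)))
        where
        off : ∀ j → g j ≢ v
        off j refl = v∉ (on-segment j)

    pos : Fin n → ℕ
    pos v = proj₁ (on v) % 8

    pos<8 : ∀ v → pos v < 8
    pos<8 v = m%n<n (proj₁ (on v)) 8

    g-pos : ∀ v → v ≡ g (pos v)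
    g-pos v = trans (proj₂ (on v)) (reduce₀ (proj₁ (on v)))

    agree : ∀ a b → a < 8 → b < 8 → G (g a) (g b) ≡ (⌊ b ≟ suc a % 8 ⌋ ∨ ⌊ a ≟ suc b % 8 ⌋)
    agree a b a<8 b<8 = reflects (b ≟ suc a % 8) (a ≟ suc b % 8)
      (λ e → trans (cong (λ l → G (g a) (g l)) e) (trans (cong (G (g a)) (sym (reduce₀ (suc a)))) (adj a)))
      (λ e → sy (trans (cong (λ l → G (g b) (g l)) e) (trans (cong (G (g b)) (sym (reduce₀ (suc b)))) (adj b))))
      λ e → back (chordless a b e)
      where
      back : g b ≡ g (suc a) ⊎ g a ≡ g (suc b) → b ≡ suc a % 8 ⊎ a ≡ suc b % 8
      back (inj₁ e) = inj₁ (g-injective b<8 (m%n<n (suc a) 8) (trans e (reduce₀ (suc a))))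
      back (inj₂ e) = inj₂ (g-injective a<8 (m%n<n (suc b) 8) (trans e (reduce₀ (suc b))))

    iso : Iso G C8
    iso = f , (f-inj , f-surj) , adjacency
      where
      f : Fin n → Fin 8
      f v = fromℕ< (pos<8 v)
      toℕ-f : ∀ v → toℕ (f v) ≡ pos v
      toℕ-f v = F.toℕ-fromℕ< (pos<8 v)
      f-inj : ∀ {u v} → f u ≡ f v → u ≡ v
      f-inj {u} {v} e = trans (g-pos u) (trans (cong g (trans (sym (toℕ-f u)) (trans (cong toℕ e) (toℕ-f v)))) (sym (g-pos v)))
      f-surj : ∀ y → Σ (Fin n) λ x → ∀ {z} → z ≡ x → f z ≡ y
      f-surj y = g (toℕ y) , λ { refl → F.toℕ-injective (trans (toℕ-f (g (toℕ y)))
        (g-injective (pos<8 _) (F.toℕ<n y) (sym (g-pos (g (toℕ y)))))) }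
      adjacency : ∀ u v → G u v ≡ C8 (f u) (f v)
      adjacency u v = trans (cong₂ G (g-pos u) (g-pos v)) (trans (agree (pos u) (pos v) (pos<8 u) (pos<8 v))
        (cong₂ (λ a b → ⌊ b ≟ suc a % 8 ⌋ ∨ ⌊ a ≟ suc b % 8 ⌋) (sym (toℕ-f u)) (sym (toℕ-f v))))

  forward : Iso G C8 ⊎ PathWithDoubleStars G ⊎ StarPlusEdge G
  forward with shortest-cycle G
  ... | inj₂ acyclic = inj₂ (inj₁ (Tree.tree acyclic))
  ... | inj₁ (zero , (() , _) , _)
  ... | inj₁ (suc k , (3≤k , cyc) , none) = from-cycle k (≤-pred 3≤k) (cycle-sequence cyc) none
    where
    Goal = Iso G C8 ⊎ PathWithDoubleStars G ⊎ StarPlusEdge G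
    multiple : ∀ k q → suc k ≡ q * 4 → 4 ≤ k → Σ (ℕ → Fin n) (Cycle G (suc k)) → (∀ j → j < suc k → ¬ (3 ≤ j × CycleOfLength G j)) → Goal
    multiple k 0 () _ _ _
    multiple .3 1 refl (s≤s (s≤s (s≤s ()))) _ _
    multiple .7 2 refl _ (g , C) none = inj₁ (Eight.iso C none)
    -- Here `suc k` is `12 + 4 * q`, and the minor has `7 + 2 * q` vertices, an odd number.
    multiple k (suc (suc (suc q))) e _ (g , C) none =
      ⊥-elim (LongCycle.impossible simple men {i = 1 + 2 * q} {t = 3 + q} (trans (suc-injective e) (r₁ q)) (r₂ q) C
        (CycleProps.shortest⇒chordless simple C none))
      where
      r₁ : ∀ q → 11 + q * 4 ≡ 9 + 2 * (1 + 2 * q)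
      r₁ = solve-∀
      r₂ : ∀ q → 6 + (1 + 2 * q) ≡ 1 + 2 * (3 + q)
      r₂ = solve-∀
    from-cycle : ∀ k → 2 ≤ k → Σ (ℕ → Fin n) (Cycle G (suc k)) → (∀ j → j < suc k → ¬ (3 ≤ j × CycleOfLength G j)) → Goal
    from-cycle 2 _ (_ , C) _ = inj₂ (inj₂ (triangle C))
    from-cycle 3 _ (_ , C) _ = ⊥-elim (no-4-cycle C)
    from-cycle 1 (s≤s ()) _ _
    from-cycle k@(suc (suc (suc (suc _)))) _ (g , C) none = multiple k (suc k / 4)
      (trans (m≡m%n+[m/n]*n (suc k) 4) (cong (_+ suc k / 4 * 4) (cycle-mod-4 simple men C (s≤s (s≤s (s≤s z≤n))))))
      (s≤s (s≤s (s≤s (s≤s z≤n)))) (g , C) none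

-- Levelled graphs

-- The only possible hyperedge is the whole vertex set, so any numbering serves as levels; `r = 3`
-- makes `exchange` vacuous.
four-vertices : (G : Graph 4) → Levelled (H3 G)
four-vertices G = record
  { H? = H3? G ; level = toℕ ; r = 3 ; windows = windows
  ; single = λ u v _ _ e → F.toℕ-injective e ; exchange = λ () }
  where
  windows : ∀ s → H3 G s → Window toℕ 3 s
  windows s (c4 , _) = window 0 (s≤s (s≤s z≤n)) zero (suc zero) (suc (suc zero)) (suc (suc (suc zero)))
    (full zero) (full (suc zero)) (full (suc (suc zero))) (full (suc (suc (suc zero)))) only refl refl refl refl
    where
    full : ∀ v → v ∈ₛ s
    full v = trans (cong (λ s → lookup s v) (∣p∣≡n⇒p≡⊤ {p = s} c4)) (lookup-replicate v true)
    only : ∀ v → v ∈ₛ s → v ≡ zero ⊎ v ≡ suc zero ⊎ v ≡ suc (suc zero) ⊎ v ≡ suc (suc (suc zero))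
    only zero                   _ = inj₁ refl
    only (suc zero)             _ = inj₂ (inj₁ refl)
    only (suc (suc zero))       _ = inj₂ (inj₂ (inj₁ refl))
    only (suc (suc (suc zero))) _ = inj₂ (inj₂ (inj₂ refl))

-- A path on four vertices consists of the centre, both ends of the additional edge and one further
-- leaf. Only the level of these further leaves can have several vertices.
star-plus-edge : ∀ {n} (G : Graph n) → StarPlusEdge G → Levelled (H3 G)
star-plus-edge {n} G (c , a , b , a≢c , b≢c , a≢b , char) = record
  { H? = H3? G ; level = level ; r = 3 ; windows = windows ; single = single ; exchange = λ () }
  where
  level : Fin n → ℕ
  level v with v F.≟ c | v F.≟ a | v F.≟ b
  ... | yes _ | _     | _     = 1
  ... | no _  | yes _ | _     = 2
  ... | no _  | no _  | yes _ = 3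
  ... | no _  | no _  | no _  = 0
  level-c : level c ≡ 1
  level-c with c F.≟ c | c F.≟ a | c F.≟ b
  ... | yes _ | _ | _ = refl
  ... | no ¬p | _ | _ = ⊥-elim (¬p refl)
  level-a : level a ≡ 2
  level-a with a F.≟ c | a F.≟ a | a F.≟ b
  ... | yes p | _     | _ = ⊥-elim (a≢c p)
  ... | no _  | yes _ | _ = refl
  ... | no _  | no ¬p | _ = ⊥-elim (¬p refl)
  level-b : level b ≡ 3
  level-b with b F.≟ c | b F.≟ a | b F.≟ b
  ... | yes p | _     | _     = ⊥-elim (b≢c p)
  ... | no _  | yes p | _     = ⊥-elim (a≢b (sym p))
  ... | no _  | no _  | yes _ = refl
  ... | no _  | no _  | no ¬p = ⊥-elim (¬p refl)
  level-0 : ∀ v → v ≢ c → v ≢ a → v ≢ b → level v ≡ 0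
  level-0 v v≢c v≢a v≢b with v F.≟ c | v F.≟ a | v F.≟ b
  ... | yes p | _     | _     = ⊥-elim (v≢c p)
  ... | no _  | yes p | _     = ⊥-elim (v≢a p)
  ... | no _  | no _  | yes p = ⊥-elim (v≢b p)
  ... | no _  | no _  | no _  = refl
  single : ∀ u v → 1 ≤ level u → level u ≤ 3 → level u ≡ level v → u ≡ v
  single u v lo _ e with u F.≟ c | u F.≟ a | u F.≟ b | v F.≟ c | v F.≟ a | v F.≟ b
  ... | yes refl | _ | _ | yes refl | _ | _ = refl
  ... | no _ | yes refl | _ | no _ | yes refl | _ = refl
  ... | no _ | no _ | yes refl | no _ | no _ | yes refl = refl
  ... | yes _ | _ | _ | no _ | yes _ | _ = contradiction e λ ()
  ... | yes _ | _ | _ | no _ | no _ | yes _ = contradiction e λ ()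
  ... | yes _ | _ | _ | no _ | no _ | no _ = contradiction e λ ()
  ... | no _ | yes _ | _ | yes _ | _ | _ = contradiction e λ ()
  ... | no _ | yes _ | _ | no _ | no _ | yes _ = contradiction e λ ()
  ... | no _ | yes _ | _ | no _ | no _ | no _ = contradiction e λ ()
  ... | no _ | no _ | yes _ | yes _ | _ | _ = contradiction e λ ()
  ... | no _ | no _ | yes _ | no _ | yes _ | _ = contradiction e λ ()
  ... | no _ | no _ | yes _ | no _ | no _ | no _ = contradiction e λ ()
  ... | no _ | no _ | no _ | _ | _ | _ = contradiction lo λ ()

  edge-off-c : ∀ u v → Adj G u v → u ≢ c → v ≢ c → (u ≡ a × v ≡ b) ⊎ (u ≡ b × v ≡ a)
  edge-off-c u v uv u≢c v≢c with proj₁ (char u v) uv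
  ... | inj₁ (e , _)        = ⊥-elim (u≢c e)
  ... | inj₂ (inj₁ (e , _)) = ⊥-elim (v≢c e)
  ... | inj₂ (inj₂ e)       = e

  Shape : List (Fin n) → Set
  Shape xs = Σ (Fin n) λ l → l ∈ xs × c ∈ xs × a ∈ xs × b ∈ xs × l ≢ c × l ≢ a × l ≢ b ×
    (∀ v → v ∈ xs → v ≡ l ⊎ v ≡ c ⊎ v ≡ a ⊎ v ≡ b)

  shape : ∀ {p q r s} → Path4 G p q r s → Shape (quad p q r s)
  shape {p} {q} {r} {s} (path4 dis pq qr rs) with distinct-≢ dis
  ... | p≢q , p≢r , p≢s , q≢r , q≢s , r≢s with q F.≟ c | r F.≟ c
  ...   | yes refl | yes refl = ⊥-elim (q≢r refl)
  ...   | yes refl | no r≢c with edge-off-c r s rs r≢c (q≢s ∘ sym)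
  ...     | inj₁ (refl , refl) = p , #0 , #1 , #2 , #3 , p≢q , p≢r , p≢s , λ v m → ∈quad m
  ...     | inj₂ (refl , refl) = p , #0 , #1 , #3 , #2 , p≢q , p≢s , p≢r ,
            λ { v #0 → inj₁ refl ; v #1 → inj₂ (inj₁ refl) ; v #2 → inj₂ (inj₂ (inj₂ refl)) ; v #3 → inj₂ (inj₂ (inj₁ refl)) }
  shape {p} {q} {r} {s} (path4 dis pq qr rs) | p≢q , p≢r , p≢s , q≢r , q≢s , r≢s | no q≢c | yes refl with edge-off-c p q pq p≢r q≢c
  ...     | inj₁ (refl , refl) = s , #3 , #2 , #0 , #1 , r≢s ∘ sym , p≢s ∘ sym , q≢s ∘ sym ,
            λ { v #0 → inj₂ (inj₂ (inj₁ refl)) ; v #1 → inj₂ (inj₂ (inj₂ refl)) ; v #2 → inj₂ (inj₁ refl) ; v #3 → inj₁ refl }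
  ...     | inj₂ (refl , refl) = s , #3 , #2 , #1 , #0 , r≢s ∘ sym , q≢s ∘ sym , p≢s ∘ sym ,
            λ { v #0 → inj₂ (inj₂ (inj₂ refl)) ; v #1 → inj₂ (inj₂ (inj₁ refl)) ; v #2 → inj₂ (inj₁ refl) ; v #3 → inj₁ refl }
  shape {p} {q} {r} {s} (path4 dis pq qr rs) | p≢q , p≢r , p≢s , q≢r , q≢s , r≢s | no q≢c | no r≢c =
    ⊥-elim (outer (p F.≟ c) (s F.≟ c))
    where
    -- Both outer vertices of the path would have to be the centre.
    third : ∀ {u v w} → (u ≡ a × v ≡ b) ⊎ (u ≡ b × v ≡ a) → (v ≡ a × w ≡ b) ⊎ (v ≡ b × w ≡ a) → u ≡ w
    third (inj₁ (refl , refl)) (inj₁ (e , _)) = ⊥-elim (a≢b (sym e))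
    third (inj₁ (refl , refl)) (inj₂ (_ , e)) = sym e
    third (inj₂ (refl , refl)) (inj₁ (_ , e)) = sym e
    third (inj₂ (refl , refl)) (inj₂ (e , _)) = ⊥-elim (a≢b e)
    outer : Dec (p ≡ c) → Dec (s ≡ c) → ⊥
    outer (yes refl) (yes refl) = p≢s refl
    outer (no p≢c) _ = p≢r (third (edge-off-c p q pq p≢c q≢c) (edge-off-c q r qr q≢c r≢c))
    outer _ (no s≢c) = q≢s (third (edge-off-c q r qr q≢c r≢c) (edge-off-c r s rs r≢c s≢c))

  windows : ∀ s → H3 G s → Window level 3 s
  windows s Hs with H3⇒path s Hs
  ... | pathIn P sub only with shape P
  ...   | l , l∈ , c∈ , a∈ , b∈ , l≢c , l≢a , l≢b , all = window 0 (s≤s (s≤s z≤n)) l c a b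
    (sub l l∈) (sub c c∈) (sub a a∈) (sub b b∈) (λ v v∈ → all v (only v v∈)) (level-0 l l≢c l≢a l≢b) level-c level-a level-b

module DoubleStars {n} {G : Graph n} (simple : IsSimple G) (connected : Connected G) (acyclic : ¬ HasCycle G)
  (p q : Fin n) (supported : ∀ u → AdjToLeaf G u → u ≡ p ⊎ u ≡ q) where
  open Spines simple acyclic

  module _ {xs} (S : SpineOf xs) where
    open SpineOf S
    open Spine spine

    -- `w 1` and `w (2 + m)` are distinct and both adjacent to leaves, so they exhaust the permitted
    -- vertices `p` and `q`.
    ends : ∀ u → AdjToLeaf G u → u ≡ w 1 ⊎ u ≡ w (2 + m)
    ends u s = pick (supported (w 1) (w 0 , sym-adj simple (adj 0 (s≤s z≤n)) , leaf₀))
                    (supported (w (2 + m)) (w (3 + m) , adj (2 + m) ≤-refl , leafₘ)) (supported u s)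
      where
      w₁≢ : w 1 ≢ w (2 + m)
      w₁≢ e = contradiction (inj 1 (2 + m) (s≤s z≤n) (n≤1+n _) e) λ ()
      pick : w 1 ≡ p ⊎ w 1 ≡ q → w (2 + m) ≡ p ⊎ w (2 + m) ≡ q → u ≡ p ⊎ u ≡ q → u ≡ w 1 ⊎ u ≡ w (2 + m)
      pick (inj₁ e) (inj₁ e′) _ = ⊥-elim (w₁≢ (trans e (sym e′)))
      pick (inj₂ e) (inj₂ e′) _ = ⊥-elim (w₁≢ (trans e (sym e′)))
      pick (inj₁ e) (inj₂ e′) (inj₁ f) = inj₁ (trans f (sym e))
      pick (inj₁ e) (inj₂ e′) (inj₂ f) = inj₂ (trans f (sym e′))
      pick (inj₂ e) (inj₁ e′) (inj₁ f) = inj₂ (trans f (sym e′))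
      pick (inj₂ e) (inj₁ e′) (inj₂ f) = inj₁ (trans f (sym e))

    -- If `v` is not a leaf, the ray through `v` ends in a leaf whose neighbour lies on the branch.
    -- By `ends` that neighbour lies on the spine, which the branch never meets again.
    brush : ∀ i v → i ≤ 3 + m → v ∉ xs → Adj G (w i) v → IsLeaf G v × (i ≡ 1 ⊎ i ≡ 2 + m)
    brush i v i≤ v∉ a with degree G v ≟ 1
    ... | yes leaf with ends (w i) (v , a , leaf)
    ...   | inj₁ e = leaf , inj₁ (inj i 1 i≤ (s≤s z≤n) e)
    ...   | inj₂ e = leaf , inj₂ (inj i (2 + m) i≤ (n≤1+n _) e)
    brush i v i≤ v∉ a | no ¬leaf with ray (w i) v a
    ... | [] , _ , leaf = ⊥-elim (¬leaf leaf)
    ... | y ∷ ls , nb′ , end with ray-support v y ls (nb-tail simple (w i) (v ∷ y ∷ ls) nb′) end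
    ...   | u , u∈ , s = ⊥-elim (branch-avoids {ls = y ∷ ls} nb (on i i≤) v∉ nb′ u∈ (u∈xs (ends u s)))
      where
      u∈xs : u ≡ w 1 ⊎ u ≡ w (2 + m) → u ∈ xs
      u∈xs (inj₁ refl) = on 1 (s≤s z≤n)
      u∈xs (inj₂ refl) = on (2 + m) (n≤1+n _)

    open Brushes connected S brush

    lev : Fin n → ℕ
    lev v = proj₁ (has-level v)

    lv : ∀ v → Level v (lev v)
    lv v = proj₂ (has-level v)

    level≤ : ∀ {v i} → Level v i → i ≤ 3 + m
    level≤ (left _ _)      = z≤n
    level≤ (right _ _)     = ≤-refl
    level≤ (inner i i≤ _) = s≤s (≤-trans i≤ (n≤1+n _))

    ¬leaf-level : ∀ {v i} → ¬ IsLeaf G v → Level v i → Σ ℕ λ j → i ≡ suc j × j ≤ 1 + m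
    ¬leaf-level ¬leaf (left leaf _)  = ⊥-elim (¬leaf leaf)
    ¬leaf-level ¬leaf (right leaf _) = ⊥-elim (¬leaf leaf)
    ¬leaf-level ¬leaf (inner i i≤ _) = i , refl , i≤

    same-level : ∀ {u v} → ¬ IsLeaf G v → lev u ≡ lev v → u ≡ v
    same-level {u} {v} ¬leaf e with ¬leaf-level ¬leaf (lv v)
    ... | j , e′ , j≤ = level-single j≤ (subst (Level u) (trans e e′) (lv u)) (subst (Level v) e′ (lv v))

    -- The inner vertices of a path are not leaves, and such a vertex is alone on its level. Turning
    -- back would bring the path to the same vertex again.
    increasing : ∀ {a b c d} → (P : Path4 G a b c d) → lev b ≡ suc (lev a) → lev c ≡ 2 + lev a × lev d ≡ 3 + lev a
    increasing {a} {b} {c} {d} (path4 dis ab bc cd) e with distinct-≢ dis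
    ... | _ , a≢c , _ , _ , b≢d , _ = c≡ , d≡
      where
      c≡ : lev c ≡ 2 + lev a
      c≡ with level-adj (lv b) (lv c) bc
      ... | inj₁ e′ = trans e′ (cong suc e)
      ... | inj₂ e′ = ⊥-elim (a≢c (same-level (two-neighbours⇒¬leaf simple (sym-adj simple bc) cd b≢d) (suc-injective (trans (sym e) e′))))
      d≡ : lev d ≡ 3 + lev a
      d≡ with level-adj (lv c) (lv d) cd
      ... | inj₁ e′ = trans e′ (cong suc c≡)
      ... | inj₂ e′ = ⊥-elim (b≢d (sym (same-level (two-neighbours⇒¬leaf simple (sym-adj simple ab) bc a≢c) (trans (suc-injective (trans (sym e′) c≡)) (sym e)))))

    reverse : ∀ {a b c d} → Path4 G a b c d → Path4 G d c b a
    reverse (path4 dis ab bc cd) with distinct-≢ dis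
    ... | a≢b , a≢c , a≢d , b≢c , b≢d , c≢d = path4 (distinct4 (c≢d ∘ sym) (b≢d ∘ sym) (a≢d ∘ sym) (b≢c ∘ sym) (a≢c ∘ sym) (a≢b ∘ sym))
      (sym-adj simple cd) (sym-adj simple bc) (sym-adj simple ab)

    decreasing : ∀ {a b c d} → Path4 G a b c d → lev a ≡ suc (lev b) → lev c ≡ suc (lev d)
    decreasing {a} {b} {c} {d} (path4 dis ab bc cd) e with distinct-≢ dis
    ... | _ , a≢c , _ , _ , b≢d , _ with level-adj (lv b) (lv c) bc
    ...   | inj₁ e′ = ⊥-elim (a≢c (same-level (two-neighbours⇒¬leaf simple (sym-adj simple bc) cd b≢d) (trans e (sym e′))))
    ...   | inj₂ e′ with level-adj (lv c) (lv d) cd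
    ...     | inj₂ e″ = e″
    ...     | inj₁ e″ = ⊥-elim (b≢d (sym (same-level (two-neighbours⇒¬leaf simple (sym-adj simple ab) bc a≢c) (trans e″ (sym e′)))))

    windows : ∀ s → H3 G s → Window lev (2 + m) s
    windows s Hs with H3⇒path s Hs
    ... | pathIn {a} {b} {c} {d} P sub only with level-adj (lv a) (lv b) (Path4.ab P)
    ...   | inj₁ e = let c≡ , d≡ = increasing P e in
            window (lev a) (≤-pred (≤-trans (≤-reflexive (sym d≡)) (level≤ (lv d)))) a b c d
              (sub a #0) (sub b #1) (sub c #2) (sub d #3) (λ v v∈ → ∈quad (only v v∈)) refl e c≡ d≡
    ...   | inj₂ e = let e′ = decreasing P e ; b≡ , a≡ = increasing (reverse P) e′ in
            window (lev d) (≤-pred (≤-trans (≤-reflexive (sym a≡)) (level≤ (lv a)))) d c b a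
              (sub d #3) (sub c #2) (sub b #1) (sub a #0) (λ v v∈ → rev (∈quad (only v v∈))) refl e′ b≡ a≡
      where
      rev : ∀ {v} → v ≡ a ⊎ v ≡ b ⊎ v ≡ c ⊎ v ≡ d → v ≡ d ⊎ v ≡ c ⊎ v ≡ b ⊎ v ≡ a
      rev (inj₁ e)               = inj₂ (inj₂ (inj₂ e))
      rev (inj₂ (inj₁ e))        = inj₂ (inj₂ (inj₁ e))
      rev (inj₂ (inj₂ (inj₁ e))) = inj₂ (inj₁ e)
      rev (inj₂ (inj₂ (inj₂ e))) = inj₁ e

    single : ∀ u v → 1 ≤ lev u → lev u ≤ 2 + m → lev u ≡ lev v → u ≡ v
    single u v lo hi e with lev u in eu | lo | hi
    ... | suc i | _ | s≤s i≤ = level-single i≤ (subst (Level u) eu (lv u)) (subst (Level v) (sym e) (lv v))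

    -- For `m = 0` the two centres are adjacent, so every leaf of one forms a path with every leaf
    -- of the other.
    exchange : 2 + m ≡ 2 → ∀ s s′ u u′ → H3 G s → H3 G s′ → u ∈ₛ s → lev u ≡ 0 → u′ ∈ₛ s′ → lev u′ ≡ 3 →
      Σ (Subset n) λ t → H3 G t × (∀ v → v ∈ₛ t → v ≡ u ⊎ v ≡ u′ ⊎ (1 ≤ lev v × lev v ≤ 2))
    exchange r≡2 _ _ u u′ _ _ _ eu _ eu′ = _ , path⇒H3 P , λ v v∈ → at (∈quad (setOf-∈ₛ {xs = quad u (w 1) (w (2 + m)) u′} v∈))
      where
      low : ∀ {v i} → Level v i → i ≡ 0 → IsLeaf G v × Adj G v (w 1)
      low (left leaf a) _ = leaf , a
      high : ∀ {v i} → Level v i → i ≡ 3 → IsLeaf G v × Adj G v (w (2 + m))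
      high (right leaf a) _ = leaf , a
      high (inner .2 i≤ _) refl = ⊥-elim (1+n≰n (≤-trans i≤ (≤-pred (≤-reflexive r≡2))))
      lu = low (lv u) eu
      lu′ = high (lv u′) eu′
      ¬l₁ : ¬ IsLeaf G (w 1)
      ¬l₁ = inner-¬leaf S 0 z≤n
      ¬l₂ : ¬ IsLeaf G (w (2 + m))
      ¬l₂ = inner-¬leaf S (1 + m) ≤-refl
      w₁w₂ : Adj G (w 1) (w (2 + m))
      w₁w₂ = subst (λ l → Adj G (w 1) (w l)) (sym r≡2) (adj 1 (s≤s (s≤s z≤n)))
      P : Path4 G u (w 1) (w (2 + m)) u′
      P = path4 (distinct4 (adj-≢ simple (proj₂ lu)) (λ e → ¬l₂ (subst (IsLeaf G) e (proj₁ lu)))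
            (λ e → contradiction (trans (sym eu) (trans (cong lev e) eu′)) λ ())
            (adj-≢ simple w₁w₂) (λ e → ¬l₁ (subst (IsLeaf G) (sym e) (proj₁ lu′))) (adj-≢ simple (sym-adj simple (proj₂ lu′))))
          (proj₂ lu) w₁w₂ (sym-adj simple (proj₂ lu′))
      mid : ∀ {v} → ¬ IsLeaf G v → 1 ≤ lev v × lev v ≤ 2
      mid {v} ¬leaf with ¬leaf-level ¬leaf (lv v)
      ... | j , e , j≤ = ≤-trans (s≤s z≤n) (≤-reflexive (sym e)) , ≤-trans (≤-reflexive e) (≤-trans (s≤s j≤) (≤-reflexive r≡2))
      at : ∀ {v} → v ≡ u ⊎ v ≡ w 1 ⊎ v ≡ w (2 + m) ⊎ v ≡ u′ → v ≡ u ⊎ v ≡ u′ ⊎ (1 ≤ lev v × lev v ≤ 2)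
      at (inj₁ e)                  = inj₁ e
      at (inj₂ (inj₁ refl))        = inj₂ (inj₂ (mid ¬l₁))
      at (inj₂ (inj₂ (inj₁ refl))) = inj₂ (inj₂ (mid ¬l₂))
      at (inj₂ (inj₂ (inj₂ e)))    = inj₂ (inj₁ e)

    levelled : Levelled (H3 G)
    levelled = record { H? = H3? G ; level = lev ; r = 2 + m ; windows = windows ; single = single ; exchange = exchange }

  solvable : ∀ c → Solvable (H3 G) c
  solvable c with F.any? (λ a → F.any? λ b → F.any? λ c → F.any? λ d → path4? G a b c d)
  ... | yes (_ , _ , _ , _ , P) = levelled-solvable (levelled (proj₂ (spine-of P))) c
  ... | no none = no-edge c λ s Hs _ → none (_ , _ , _ , _ , PathIn.path (H3⇒path s Hs))

-- The cycle on eight vertices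

allBits : ∀ m → (Vec Bool m → Bool) → Bool
allBits zero    f = f []
allBits (suc m) f = allBits m (f ∘ (true ∷_)) ∧ allBits m (f ∘ (false ∷_))

∧-true : ∀ {a b} → a ∧ b ≡ true → a ≡ true × b ≡ true
∧-true {true} e = refl , e

allBits-sound : ∀ m f → allBits m f ≡ true → ∀ b → f b ≡ true
allBits-sound zero    f e []          = e
allBits-sound (suc m) f e (true ∷ b)  = allBits-sound m _ (proj₁ (∧-true e)) b
allBits-sound (suc m) f e (false ∷ b) = allBits-sound m _ (proj₂ (∧-true {allBits m (f ∘ (true ∷_))} e)) b

any-true : ∀ {A : Set} (p : A → Bool) xs → any p xs ≡ true → Σ A λ x → x ∈ xs × p x ≡ true
any-true p (x ∷ xs) e with p x in q
... | true = x , here refl , q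
... | false = let y , y∈ , py = any-true p xs e in y , there y∈ , py

true-any : ∀ {A : Set} (p : A → Bool) {xs x} → x ∈ xs → p x ≡ true → any p xs ≡ true
true-any p {y ∷ xs} (here refl) e rewrite e = refl
true-any p {y ∷ xs} (there x∈) e with p y
... | true  = refl
... | false = true-any p x∈ e

all-true : ∀ {A : Set} (p : A → Bool) {xs x} → all p xs ≡ true → x ∈ xs → p x ≡ true
all-true p {y ∷ xs} e (here refl) = proj₁ (∧-true e)
all-true p {y ∷ xs} e (there x∈)  = all-true p {xs} (proj₂ (∧-true {p y} e)) x∈

true-all : ∀ {A : Set} (p : A → Bool) xs → (∀ x → x ∈ xs → p x ≡ true) → all p xs ≡ true
true-all p []       h = refl
true-all p (x ∷ xs) h rewrite h x (here refl) = true-all p xs (λ y y∈ → h y (there y∈))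

bit : Vec Bool 8 → ℕ → Bool
bit b e = lookup b (e mod 8)

-- A cover of the windows has cyclic gaps at most four. It is minimal exactly when merging two
-- neighbouring gaps exceeds four, which leaves the gaps 4, 4 of a pair and 3, 3, 2 of a triple.
window₈ pair₈ triple₈ : ℕ → List ℕ
window₈ e = e ∷ 1 + e ∷ 2 + e ∷ 3 + e ∷ []
pair₈ e   = e ∷ 4 + e ∷ []
triple₈ e = e ∷ 3 + e ∷ 6 + e ∷ []

0…7 : List ℕ
0…7 = 0 ∷ 1 ∷ 2 ∷ 3 ∷ 4 ∷ 5 ∷ 6 ∷ 7 ∷ []

-- By evaluation on all 2⁸ subsets.
minimal-covers : ∀ b → all (λ e → any (bit b) (window₈ e)) 0…7 ≡ true →
  (any (λ e → all (bit b) (pair₈ e)) (0 ∷ 1 ∷ 2 ∷ 3 ∷ []) ∨ any (λ e → all (bit b) (triple₈ e)) 0…7) ≡ true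
minimal-covers b e = conclude e (allBits-sound 8
    (λ b → not (all (λ e → any (bit b) (window₈ e)) 0…7) ∨
      (any (λ e → all (bit b) (pair₈ e)) (0 ∷ 1 ∷ 2 ∷ 3 ∷ []) ∨ any (λ e → all (bit b) (triple₈ e)) 0…7)) refl b)
  where
  conclude : ∀ {p q} → p ≡ true → not p ∨ q ≡ true → q ≡ true
  conclude refl r = r

module EightCycle {n} {G : Graph n} (simple : IsSimple G) {g : ℕ → Fin n} (C : Cycle G 8 g)
  (chordless : CycleProps.Chordless simple C) (on : ∀ v → CycleProps.On simple C v) where
  open Cycle C
  open CycleProps simple C hiding (On; Chordless)

  H : Hypergraph n
  H = H3 G

  quadAt : ℕ → List (Fin n)
  quadAt i = quad (g i) (g (1 + i)) (g (2 + i)) (g (3 + i))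

  win : ℕ → Subset n
  win k = setOf (quadAt k)

  path-at : ∀ k → Path4 G (g k) (g (1 + k)) (g (2 + k)) (g (3 + k))
  path-at = window-path (s≤s (s≤s (s≤s z≤n)))

  hyperedge-window : ∀ s → H s → Σ ℕ λ i → (∀ v → v ∈ quadAt i → v ∈ₛ s) × (∀ v → v ∈ₛ s → v ∈ quadAt i)
  hyperedge-window s Hs = conclude (H3⇒path s Hs)
    where
    conclude : PathIn G s → Σ ℕ λ i → (∀ v → v ∈ quadAt i → v ∈ₛ s) × (∀ v → v ∈ₛ s → v ∈ quadAt i)
    conclude (pathIn {a} {b} {c} {d} P sub only) with path-window chordless P (on a) (on b) (on c) (on d)
    ... | i , inj₁ (refl , refl , refl , refl) = i , sub , only
    ... | i , inj₂ (refl , refl , refl , refl) = i , (λ v p → sub v (flip p)) , λ v p → flip (only v p)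
      where
      flip : ∀ {v p q r s} → v ∈ quad p q r s → v ∈ quad s r q p
      flip #0 = #3
      flip #1 = #2
      flip #2 = #1
      flip #3 = #0

  -- Without the vertex g z the cycle is a path.
  module Cut (z : ℕ) where
    H′ : Hypergraph n
    H′ s = H s × lookup s (g z) ≡ false

    level : Fin n → ℕ
    level v = proj₁ (offset z (proj₁ (on v)))

    level<8 : ∀ v → level v < 8
    level<8 v = proj₁ (proj₂ (offset z (proj₁ (on v))))

    at-level : ∀ v → v ≡ g (level v + z)
    at-level v = trans (proj₂ (on v)) (proj₂ (proj₂ (offset z (proj₁ (on v)))) 0)

    level-g : ∀ e → e < 8 → level (g (e + z)) ≡ e
    level-g e e<8 = offset-unique z (level<8 _) e<8 (sym (at-level (g (e + z))))

    -- Positions are counted from the removed vertex. Windows at offsets 0, 5, 6 and 7 contain it,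
    -- so only the starts 1 to 4 occur.
    windows : ∀ s → H′ s → Window level 8 s
    windows s (Hs , out) = from-window (hyperedge-window s Hs)
      where
      from-window : (Σ ℕ λ i → (∀ v → v ∈ quadAt i → v ∈ₛ s) × (∀ v → v ∈ₛ s → v ∈ quadAt i)) → Window level 8 s
      from-window (i , sub , only) = let d , d<8 , sh = offset z i in place d d<8 sh
        where
        meets : ∀ {v} → v ∈ quadAt i → v ≡ g z → ⊥
        meets p refl = contradiction (trans (sym (sub _ p)) out) λ ()
        fitting : ∀ d → 3 + d < 8 → (∀ t → g (t + i) ≡ g (t + (d + z))) → Window level 8 s
        fitting d lt sh = window d (≤-trans (n≤1+n _) (≤-trans (n≤1+n _) lt)) (g i) (g (1 + i)) (g (2 + i)) (g (3 + i))
          (sub _ #0) (sub _ #1) (sub _ #2) (sub _ #3) (λ v p → ∈quad (only v p))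
          (trans (cong level (sh 0)) (level-g d (≤-trans (s≤s (m≤n+m d 3)) lt)))
          (trans (cong level (sh 1)) (level-g (1 + d) (≤-trans (s≤s (s≤s (m≤n+m d 2))) lt)))
          (trans (cong level (sh 2)) (level-g (2 + d) (≤-trans (s≤s (s≤s (s≤s (m≤n+m d 1)))) lt)))
          (trans (cong level (sh 3)) (level-g (3 + d) lt))
        place : ∀ d → d < 8 → (∀ t → g (t + i) ≡ g (t + (d + z))) → Window level 8 s
        place 0 _ sh = ⊥-elim (meets #0 (sh 0))
        place 1 _ sh = fitting 1 (toWitness {a? = 4 <? 8} tt) sh
        place 2 _ sh = fitting 2 (toWitness {a? = 5 <? 8} tt) sh
        place 3 _ sh = fitting 3 (toWitness {a? = 6 <? 8} tt) sh
        place 4 _ sh = fitting 4 (toWitness {a? = 7 <? 8} tt) sh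
        place 5 _ sh = ⊥-elim (meets #3 (trans (sh 3) (per z)))
        place 6 _ sh = ⊥-elim (meets #2 (trans (sh 2) (per z)))
        place 7 _ sh = ⊥-elim (meets #1 (trans (sh 1) (per z)))
        place (suc (suc (suc (suc (suc (suc (suc (suc _)))))))) (s≤s (s≤s (s≤s (s≤s (s≤s (s≤s (s≤s (s≤s ())))))))) _

    levelled : Levelled H′
    levelled = record
      { H? = λ s → H3? G s ×-dec (lookup s (g z) B.≟ false) ; level = level ; r = 8 ; windows = windows
      ; single = λ u v _ _ e → trans (at-level u) (trans (cong (λ l → g (l + z)) e) (sym (at-level v)))
      ; exchange = λ () }

    solvable : ∀ c → c (g z) ≡ 0 → Solvable H c
    solvable c cz with levelled-solvable levelled c
    ... | x , y , cov , (sup , cap) , le = (λ v → x v + zeros c v) , y , cover-support c x hit , ((λ s p → proj₁ (sup s p)) , cap) ,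
      ≤-trans (≤-reflexive (trans (cost-+ c x (zeros c)) (trans (cong (cost c x +_) (cost-zeros c)) (+-identityʳ _)))) le
      where
      hit : ∀ s → H s → (∀ v → v ∈ₛ s → 1 ≤ c v) → Σ (Fin n) λ v → v ∈ₛ s × 1 ≤ x v
      hit s Hs sup with lookup s (g z) in e
      ... | false = sumOn-positive s x (cov s (Hs , e))
      ... | true  = contradiction (≤-trans (sup (g z) e) (≤-reflexive cz)) λ ()

  pairAt tripleAt : ℕ → List (Fin n)
  pairAt j   = g j ∷ g (4 + j) ∷ []
  tripleAt j = g j ∷ g (3 + j) ∷ g (6 + j) ∷ []

  meeting⇒cover : ∀ M → (∀ i → Σ (Fin n) λ v → v ∈ M × v ∈ quadAt i) → IsCover H (count M)
  meeting⇒cover M h s Hs with hyperedge-window s Hs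
  ... | i , sub , _ with h i
  ...   | v , v∈M , v∈ = sumOn-hit s (count M) v (sub v v∈) (count-∈ M v v∈M)

  module _ (j i : ℕ) where
    private
      Hit : List (Fin n) → Set
      Hit M = Σ (Fin n) λ v → v ∈ M × v ∈ quadAt i

    pair-meets : Hit (pairAt j)
    pair-meets = at (offset j i)
      where
      at : (Σ ℕ λ d → d < 8 × (∀ t → g (t + i) ≡ g (t + (d + j)))) → Hit (pairAt j)
      at (0 , _ , sh) = g j , #0 , here (sym (sh 0))
      at (1 , _ , sh) = g (4 + j) , #1 , there (there (there (here (sym (sh 3)))))
      at (2 , _ , sh) = g (4 + j) , #1 , there (there (here (sym (sh 2))))
      at (3 , _ , sh) = g (4 + j) , #1 , there (here (sym (sh 1)))
      at (4 , _ , sh) = g (4 + j) , #1 , here (sym (sh 0))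
      at (5 , _ , sh) = g j , #0 , there (there (there (here (sym (trans (sh 3) (per j))))))
      at (6 , _ , sh) = g j , #0 , there (there (here (sym (trans (sh 2) (per j)))))
      at (7 , _ , sh) = g j , #0 , there (here (sym (trans (sh 1) (per j))))
      at (suc (suc (suc (suc (suc (suc (suc (suc _))))))) , s≤s (s≤s (s≤s (s≤s (s≤s (s≤s (s≤s (s≤s ()))))))) , _)

    triple-meets : Hit (tripleAt j)
    triple-meets = at (offset j i)
      where
      at : (Σ ℕ λ d → d < 8 × (∀ t → g (t + i) ≡ g (t + (d + j)))) → Hit (tripleAt j)
      at (0 , _ , sh) = g j , #0 , here (sym (sh 0))
      at (1 , _ , sh) = g (3 + j) , #1 , there (there (here (sym (sh 2))))
      at (2 , _ , sh) = g (3 + j) , #1 , there (here (sym (sh 1)))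
      at (3 , _ , sh) = g (3 + j) , #1 , here (sym (sh 0))
      at (4 , _ , sh) = g (6 + j) , #2 , there (there (here (sym (sh 2))))
      at (5 , _ , sh) = g (6 + j) , #2 , there (here (sym (sh 1)))
      at (6 , _ , sh) = g (6 + j) , #2 , here (sym (sh 0))
      at (7 , _ , sh) = g j , #0 , there (here (sym (trans (sh 1) (per j))))
      at (suc (suc (suc (suc (suc (suc (suc (suc _))))))) , s≤s (s≤s (s≤s (s≤s (s≤s (s≤s (s≤s (s≤s ()))))))) , _)

  pair-cover : ∀ j → IsCover H (count (pairAt j))
  pair-cover j = meeting⇒cover (pairAt j) (pair-meets j)

  triple-cover : ∀ j → IsCover H (count (tripleAt j))
  triple-cover j = meeting⇒cover (tripleAt j) (triple-meets j)

  pair-distinct : ∀ j → Distinct (pairAt j)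
  pair-distinct j = (λ { _ #0 → inj j 4 (s≤s z≤n) (toWitness {a? = 4 <? 8} tt) }) , (λ _ ()) , tt

  triple-distinct : ∀ j → Distinct (tripleAt j)
  triple-distinct j = (λ { _ #0 → inj j 3 (s≤s z≤n) (toWitness {a? = 3 <? 8} tt) ; _ #1 → inj j 6 (s≤s z≤n) (toWitness {a? = 6 <? 8} tt) }) ,
    (λ { _ #0 → inj (3 + j) 3 (s≤s z≤n) (toWitness {a? = 3 <? 8} tt) }) , (λ _ ()) , tt

  module Positive (c : Fin n → ℕ) (c>0 : ∀ v → 1 ≤ c v)
    (ih : ∀ k → Solvable H (λ v → c v ∸ indicator (win k) v)) where

    ν : ℕ → ℕ
    ν k = sumS (proj₁ (proj₂ (ih k)))

    -- Adding the window at `k` to the packing for the reduced weight yields a packing of size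
    -- `suc (ν k)`, so a cover this cheap is optimal.
    finish : ∀ k M → IsCover H (count M) → sumL c M ≤ suc (ν k) → Solvable H c
    finish k M cov le with ih k | le
    ... | x , y , _ , pack , _ | le′ with add-edge {c = c} (win k) (path⇒H3 (path-at k)) (λ v _ → c>0 v) pack
    ...   | y′ , pack′ , tot = count M , y′ , cov , pack′ ,
      ≤-trans (≤-reflexive (trans (sumL-cong (λ v → *-comm (c v) (count M v)) (allFin n)) (sumV-count M c))) (≤-trans le′ (≤-reflexive (sym tot)))

    module _ (k : ℕ) where
      ind : ℕ → ℕ
      ind e = indicator (win k) (g (e + k))

      ind≤1 : ∀ e → ind e ≤ 1
      ind≤1 e with lookup (win k) (g (e + k))
      ... | true  = ≤-refl
      ... | false = z≤n

      ind≤0 : ∀ e → 4 ≤ e % 8 → ind e ≤ 0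
      ind≤0 e far with lookup (win k) (g (e + k)) in eq
      ... | false = z≤n
      ... | true = ⊥-elim (absurd (setOf-∈ₛ {xs = quadAt k} eq))
        where
        near : ∀ t → t < 4 → g (e + k) ≡ g (t + k) → ⊥
        near t t<4 eq′ = <⇒≱ t<4 (≤-trans far (≤-reflexive
          (offset-unique k (m%n<n e 8) (≤-trans t<4 (toWitness {a? = 4 ≤? 8} tt)) (trans (sym (reduce e k)) eq′))))
        absurd : g (e + k) ∈ quadAt k → ⊥
        absurd (here e₀)                         = near 0 (s≤s z≤n) e₀
        absurd (there (here e₁))                 = near 1 (s≤s (s≤s z≤n)) e₁
        absurd (there (there (here e₂)))         = near 2 (s≤s (s≤s (s≤s z≤n))) e₂
        absurd (there (there (there (here e₃)))) = near 3 ≤-refl e₃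

      x : Fin n → ℕ
      x = proj₁ (ih k)

      -- Under the reduced weight `M` costs no more than `x`, as it is contained in the support of
      -- `x`. Returning the window adds one for each vertex of `M` on it.
      estimate : ∀ M → Distinct M → (∀ v → v ∈ M → 1 ≤ x v) → sumL c M ≤ ν k + sumL (indicator (win k)) M
      estimate M dis pos = begin
        sumL c M                                             ≤⟨ sumL-mono (λ v → ≤-trans (m≤n+m∸n (c v) (indicator (win k) v)) (≤-reflexive (+-comm (indicator (win k) v) (c′ v)))) M ⟩
        sumL (λ v → c′ v + indicator (win k) v) M            ≡⟨ sumL-+ c′ (indicator (win k)) M ⟩
        sumL c′ M + sumL (indicator (win k)) M               ≤⟨ +-monoˡ-≤ _ (begin
          sumL c′ M                       ≡⟨ sumV-count M c′ ⟨
          sumV (λ v → count M v * c′ v)   ≤⟨ sumL-mono le (allFin n) ⟩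
          cost c′ x                       ≤⟨ proj₂ (proj₂ (proj₂ (proj₂ (ih k)))) ⟩
          ν k                             ∎) ⟩
        ν k + sumL (indicator (win k)) M                     ∎
        where
        open ≤-Reasoning
        c′ : Fin n → ℕ
        c′ v = c v ∸ indicator (win k) v
        le : ∀ v → count M v * c′ v ≤ c′ v * x v
        le v with v ∈ₗ? M
        ... | yes p = ≤-trans (*-monoˡ-≤ (c′ v) (≤-trans (count≤1 M v dis) (pos v p))) (≤-reflexive (*-comm (x v) (c′ v)))
        ... | no ¬p = ≤-trans (≤-reflexive (cong (_* c′ v) (count-∉ M v ¬p))) z≤n

      abstract
        bits : Vec Bool 8
        bits = tabulate (λ f → does (1 ≤? x (g (toℕ f + k))))

        bit≡ : ∀ e → bit bits e ≡ does (1 ≤? x (g (e + k)))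
        bit≡ e = trans (lookup∘tabulate (λ f → does (1 ≤? x (g (toℕ f + k)))) (e mod 8))
          (cong (λ v → does (1 ≤? x v)) (trans (cong (λ l → g (l + k)) (F.toℕ-fromℕ< (m%n<n e 8))) (sym (reduce e k))))

      bit-sound : ∀ e → bit bits e ≡ true → 1 ≤ x (g (e + k))
      bit-sound e b = does-true (1 ≤? x (g (e + k))) (trans (sym (bit≡ e)) b)
        where
        does-true : ∀ {P : Set} (p : Dec P) → does p ≡ true → P
        does-true (yes p) _ = p

      bit-complete : ∀ e → 1 ≤ x (g (e + k)) → bit bits e ≡ true
      bit-complete e p = trans (bit≡ e) (dec-true (1 ≤? x (g (e + k))) p)

      windows-hit : ∀ e → any (bit bits) (window₈ e) ≡ true
      windows-hit e = at (sumL-hit x {quadAt (e + k)} (cover⇒pathCover (proj₁ (proj₂ (proj₂ (ih k)))) (path-at (e + k))))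
        where
        at : (Σ (Fin n) λ v → v ∈ quadAt (e + k) × 1 ≤ x v) → any (bit bits) (window₈ e) ≡ true
        at (_ , #0 , p) = true-any (bit bits) {window₈ e} #0 (bit-complete e p)
        at (_ , #1 , p) = true-any (bit bits) {window₈ e} #1 (bit-complete (1 + e) p)
        at (_ , #2 , p) = true-any (bit bits) {window₈ e} #2 (bit-complete (2 + e) p)
        at (_ , #3 , p) = true-any (bit bits) {window₈ e} #3 (bit-complete (3 + e) p)

      -- The listed offsets are those at which a triple meets the window in two vertices. All pairs
      -- and the other triples meet it only once, and then `finish` applies.
      Stuck : Set
      Stuck = Σ ℕ λ e → e ∈ 0 ∷ 2 ∷ 3 ∷ 5 ∷ [] × sumL c (tripleAt (e + k)) ≤ 2 + ν k

      from-pair : ∀ e → 4 ≤ (4 + e) % 8 → all (bit bits) (pair₈ e) ≡ true → Solvable H c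
      from-pair e far b = finish k (pairAt (e + k)) (pair-cover (e + k))
        (≤-trans (estimate (pairAt (e + k)) (pair-distinct (e + k)) pos)
          (≤-trans (+-monoʳ-≤ (ν k) (+-mono-≤ (ind≤1 e) (+-monoˡ-≤ 0 (ind≤0 (4 + e) far)))) (≤-reflexive (+-comm (ν k) 1))))
        where
        pos : ∀ v → v ∈ pairAt (e + k) → 1 ≤ x v
        pos _ #0 = bit-sound e (all-true (bit bits) {pair₈ e} b #0)
        pos _ #1 = bit-sound (4 + e) (all-true (bit bits) {pair₈ e} b #1)

      triple-estimate : ∀ e {p q r} → ind e ≤ p → ind (3 + e) ≤ q → ind (6 + e) ≤ r → all (bit bits) (triple₈ e) ≡ true →
        sumL c (tripleAt (e + k)) ≤ (p + (q + (r + 0))) + ν k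
      triple-estimate e p q r b = ≤-trans (estimate (tripleAt (e + k)) (triple-distinct (e + k)) pos)
        (≤-trans (+-monoʳ-≤ (ν k) (+-mono-≤ p (+-mono-≤ q (+-monoˡ-≤ 0 r)))) (≤-reflexive (+-comm (ν k) _)))
        where
        pos : ∀ v → v ∈ tripleAt (e + k) → 1 ≤ x v
        pos _ #0 = bit-sound e (all-true (bit bits) {triple₈ e} b #0)
        pos _ #1 = bit-sound (3 + e) (all-true (bit bits) {triple₈ e} b #1)
        pos _ #2 = bit-sound (6 + e) (all-true (bit bits) {triple₈ e} b #2)

      far : ∀ e {w : True (4 ≤? e % 8)} → ind e ≤ 0
      far e {w} = ind≤0 e (toWitness w)

      done : ∀ e → sumL c (tripleAt (e + k)) ≤ suc (ν k) → Solvable H c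
      done e le = finish k (tripleAt (e + k)) (triple-cover (e + k)) le

      from-triple : ∀ {e} → e ∈ 0…7 → all (bit bits) (triple₈ e) ≡ true → Solvable H c ⊎ Stuck
      from-triple #0 b = inj₂ (0 , #0 , triple-estimate 0 (ind≤1 0) (ind≤1 3) (far 6) b)
      from-triple #1 b = inj₁ (done 1 (triple-estimate 1 (ind≤1 1) (far 4) (far 7) b))
      from-triple #2 b = inj₂ (2 , #1 , triple-estimate 2 (ind≤1 2) (far 5) (ind≤1 8) b)
      from-triple #3 b = inj₂ (3 , #2 , triple-estimate 3 (ind≤1 3) (far 6) (ind≤1 9) b)
      from-triple (there #3) b = inj₁ (done 4 (triple-estimate 4 (far 4) (far 7) (ind≤1 10) b))
      from-triple (there (there #3)) b = inj₂ (5 , #3 , triple-estimate 5 (far 5) (ind≤1 8) (ind≤1 11) b)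
      from-triple (there (there (there #3))) b = inj₁ (done 6 (triple-estimate 6 (far 6) (ind≤1 9) (far 12) b))
      from-triple (there (there (there (there #3)))) b = inj₁ (done 7 (triple-estimate 7 (far 7) (ind≤1 10) (far 13) b))

      attempt : Solvable H c ⊎ Stuck
      attempt = split (minimal-covers bits (true-all (λ e → any (bit bits) (window₈ e)) 0…7 (λ e _ → windows-hit e)))
        where
        pairs : ∀ {e} → e ∈ 0 ∷ 1 ∷ 2 ∷ 3 ∷ [] → all (bit bits) (pair₈ e) ≡ true → Solvable H c
        pairs #0 = from-pair 0 (toWitness {a? = 4 ≤? 4} tt)
        pairs #1 = from-pair 1 (toWitness {a? = 4 ≤? 5} tt)
        pairs #2 = from-pair 2 (toWitness {a? = 4 ≤? 6} tt)
        pairs #3 = from-pair 3 (toWitness {a? = 4 ≤? 7} tt)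
        ∨-true : ∀ {p q} → p ∨ q ≡ true → p ≡ true ⊎ q ≡ true
        ∨-true {true}  _ = inj₁ refl
        ∨-true {false} e = inj₂ e
        split : _ → Solvable H c ⊎ Stuck
        split t with ∨-true {any (λ e → all (bit bits) (pair₈ e)) (0 ∷ 1 ∷ 2 ∷ 3 ∷ [])} t
        ... | inj₁ p = let e , e∈ , b = any-true (λ e → all (bit bits) (pair₈ e)) (0 ∷ 1 ∷ 2 ∷ 3 ∷ []) p in inj₁ (pairs e∈ b)
        ... | inj₂ q = let e , e∈ , b = any-true (λ e → all (bit bits) (triple₈ e)) 0…7 q in from-triple e∈ b

    -- If neither cover were cheap enough for `finish`, they would cost at least `2 + ν k` and
    -- `2 + ν k′`, together no less than `T + T′`.
    uncross : ∀ k k′ M M′ {T T′} → IsCover H (count M) → IsCover H (count M′) → T ≤ 2 + ν k → T′ ≤ 2 + ν k′ →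
      1 + (sumL c M + sumL c M′) ≤ T + T′ → Solvable H c
    uncross k k′ M M′ cov cov′ t t′ le with sumL c M ≤? suc (ν k) | sumL c M′ ≤? suc (ν k′)
    ... | yes p | _ = finish k M cov p
    ... | no _ | yes p = finish k′ M′ cov′ p
    ... | no ¬p | no ¬p′ = ⊥-elim (1+n≰n (≤-trans (s≤s (+-mono-≤ (≰⇒> ¬p) (≰⇒> ¬p′))) (≤-trans le (+-mono-≤ t t′))))

    a : ℕ → ℕ
    a i = c (g i)

    -- Two optimal triples at these distances exchange vertices into two covers, leaving a vertex of positive weight.
    exchange : ∀ j → sumL c (tripleAt j) ≤ 2 + ν 0 → Stuck (4 + j) → Solvable H c
    -- In offsets from `j`, the triple 0, 3, 6 is combined in the four clauses with 4, 7, 10, then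
    -- 6, 9, 12, then 7, 10, 13, then 9, 12, 15. Modulo 8 the last entries 12 and 15 are 4 and 7,
    -- which is where periodicity enters; one vertex of the first triple is always left over.
    exchange j t (_ , #0 , t′) = uncross 0 (4 + j) (pairAt j) (pairAt (3 + j)) (pair-cover j) (pair-cover (3 + j)) t t′
              (≤-trans (+-monoˡ-≤ _ (c>0 (g (6 + j)))) (≤-trans (m≤m+n _ (a (10 + j))) (≤-reflexive (ring (a j) (a (3 + j)) (a (4 + j)) (a (6 + j)) (a (7 + j)) (a (10 + j))))))
      where
      ring : ∀ a0 a3 a4 a6 a7 a10 → a6 + (a0 + (a4 + 0) + (a3 + (a7 + 0))) + a10 ≡ a0 + (a3 + (a6 + 0)) + (a4 + (a7 + (a10 + 0)))
      ring = solve-∀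
    exchange j t (_ , #1 , t′) = uncross 0 (4 + j) (pairAt j) (tripleAt (3 + j)) (pair-cover j) (triple-cover (3 + j)) t t′
              (≤-trans (+-monoˡ-≤ _ (c>0 (g (6 + j)))) (≤-reflexive (trans (ring (a j) (a (3 + j)) (a (4 + j)) (a (6 + j)) (a (9 + j)))
                (cong (λ v → a j + (a (3 + j) + (a (6 + j) + 0)) + (a (6 + j) + (a (9 + j) + (c v + 0)))) (sym (per (4 + j)))))))
      where
      ring : ∀ a0 a3 a4 a6 a9 → a6 + (a0 + (a4 + 0) + (a3 + (a6 + (a9 + 0)))) ≡ a0 + (a3 + (a6 + 0)) + (a6 + (a9 + (a4 + 0)))
      ring = solve-∀
    exchange j t (_ , #2 , t′) = uncross 0 (4 + j) (pairAt (3 + j)) (pairAt (6 + j)) (pair-cover (3 + j)) (pair-cover (6 + j)) t t′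
              (≤-trans (+-monoˡ-≤ _ (c>0 (g j))) (≤-trans (m≤m+n _ (a (13 + j))) (≤-reflexive (ring (a j) (a (3 + j)) (a (6 + j)) (a (7 + j)) (a (10 + j)) (a (13 + j))))))
      where
      ring : ∀ a0 a3 a6 a7 a10 a13 → a0 + (a3 + (a7 + 0) + (a6 + (a10 + 0))) + a13 ≡ a0 + (a3 + (a6 + 0)) + (a7 + (a10 + (a13 + 0)))
      ring = solve-∀
    exchange j t (_ , #3 , t′) = uncross 0 (4 + j) (pairAt j) (pairAt (3 + j)) (pair-cover j) (pair-cover (3 + j)) t t′
              (≤-trans (+-monoˡ-≤ _ (c>0 (g (6 + j)))) (≤-trans (m≤m+n _ (a (9 + j))) (≤-reflexive (trans (ring (a j) (a (3 + j)) (a (4 + j)) (a (6 + j)) (a (7 + j)) (a (9 + j)))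
                (cong₂ (λ u v → a j + (a (3 + j) + (a (6 + j) + 0)) + (a (9 + j) + (c u + (c v + 0)))) (sym (per (4 + j))) (sym (per (7 + j))))))))
      where
      ring : ∀ a0 a3 a4 a6 a7 a9 → a6 + (a0 + (a4 + 0) + (a3 + (a7 + 0))) + a9 ≡ a0 + (a3 + (a6 + 0)) + (a9 + (a4 + (a7 + 0)))
      ring = solve-∀

    solvable : Solvable H c
    -- The second window starts opposite the base of the first triple. That triple has offset 4
    -- there and meets the window only once, so a second failure must come from a different triple.
    solvable = [ id , (λ (e , _ , t) → [ id , exchange (e + 0) t ]′ (attempt (4 + (e + 0)))) ]′ (attempt 0)

  solvable : ∀ c → Solvable H c
  solvable c = go c (<-wellFounded (sumV c))
    where
    go : ∀ c → Acc _<_ (sumV c) → Solvable H c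
    go c (acc rec) with F.any? (λ v → c v ≟ 0)
    ... | yes (v , cv) = let z , e = on v in Cut.solvable z c (trans (cong c (sym e)) cv)
    ... | no none = Positive.solvable c c>0 λ k → go _ (rec (cost-remove-< c (win k) (g k) (∈ₛ-setOf {xs = quadAt k} #0) (c>0 (g k))))
      where
      c>0 : ∀ v → 1 ≤ c v
      c>0 v = n≢0⇒n>0 (λ e → none (v , e))

module FromIso {n} {G : Graph n} (simple : IsSimple G) (iso : Iso G C8) where

  f : Fin n → Fin 8
  f = proj₁ iso

  f-injective : ∀ {u v} → f u ≡ f v → u ≡ v
  f-injective = proj₁ (proj₁ (proj₂ iso))

  -- The inverse of the isomorphism, read periodically.
  g : ℕ → Fin n
  g i = proj₁ (proj₂ (proj₁ (proj₂ iso)) (i mod 8))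

  f-g : ∀ i → toℕ (f (g i)) ≡ i % 8
  f-g i = trans (cong toℕ (proj₂ (proj₂ (proj₁ (proj₂ iso)) (i mod 8)) refl)) (F.toℕ-fromℕ< (m%n<n i 8))

  g-cong : ∀ i j → i % 8 ≡ j % 8 → g i ≡ g j
  g-cong i j e = f-injective (F.toℕ-injective (trans (f-g i) (trans e (sym (f-g j)))))

  Next : ℕ → ℕ → Set
  Next i j = toℕ (f (g j)) ≡ suc (toℕ (f (g i))) % 8

  adjacency : ∀ i j → G (g i) (g j) ≡ ⌊ toℕ (f (g j)) ≟ suc (toℕ (f (g i))) % 8 ⌋ ∨ ⌊ toℕ (f (g i)) ≟ suc (toℕ (f (g j))) % 8 ⌋
  adjacency i j = proj₂ (proj₂ iso) (g i) (g j)

  isYes-true : ∀ {P : Set} (p : Dec P) → P → ⌊ p ⌋ ≡ true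
  isYes-true (yes _) _ = refl
  isYes-true (no ¬p) p = ⊥-elim (¬p p)

  ∨-yes : ∀ {P Q : Set} (p : Dec P) (q : Dec Q) → ⌊ p ⌋ ∨ ⌊ q ⌋ ≡ true → P ⊎ Q
  ∨-yes (yes p) _       _ = inj₁ p
  ∨-yes (no _)  (yes q) _ = inj₂ q

  next⇒≡ : ∀ i j → Next i j → g j ≡ g (suc i)
  next⇒≡ i j e = g-cong j (suc i) (trans (sym (f-g j)) (trans e (trans (cong (λ l → suc l % 8) (f-g i)) (sym (suc-% i 8)))))

  cycle : Cycle G 8 g
  cycle = record
    { per = λ i → g-cong (8 + i) i (trans (cong (_% 8) (+-comm 8 i)) ([m+n]%n≡m%n i 8))
    ; adj = λ i → trans (adjacency i (suc i)) (cong (_∨ ⌊ toℕ (f (g i)) ≟ suc (toℕ (f (g (suc i)))) % 8 ⌋)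
        (isYes-true (toℕ (f (g (suc i))) ≟ suc (toℕ (f (g i))) % 8) (trans (f-g (suc i)) (trans (suc-% i 8) (cong (λ l → suc l % 8) (sym (f-g i)))))))
    ; inj = λ i d pos d<8 e → %-shift-≢ i d 8 pos d<8 (trans (sym (f-g i)) (trans (cong (λ v → toℕ (f v)) e) (f-g (d + i)))) }

  chordless : CycleProps.Chordless simple cycle
  chordless i j a with ∨-yes (toℕ (f (g j)) ≟ suc (toℕ (f (g i))) % 8) (toℕ (f (g i)) ≟ suc (toℕ (f (g j))) % 8) (trans (sym (adjacency i j)) a)
  ... | inj₁ e = inj₁ (next⇒≡ i j e)
  ... | inj₂ e = inj₂ (next⇒≡ j i e)

  on : ∀ v → CycleProps.On simple cycle v
  on v = toℕ (f v) , f-injective (F.toℕ-injective (sym (trans (f-g (toℕ (f v))) (m<n⇒m%n≡m (F.toℕ<n (f v))))))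

  solvable : ∀ c → Solvable (H3 G) c
  solvable = EightCycle.solvable simple cycle chordless on

theorem3p13 : ∀ {n : ℕ} (G : Graph n) → IsSimple G → 4 ≤ n → Connected G →
    Mengerian (H3 G) ⇔ (n ≡ 4 ⊎ Iso G C8 ⊎ PathWithDoubleStars G ⊎ StarPlusEdge G)
theorem3p13 {n} G simple 4≤n connected = mk⇔ to (from G simple connected)
  where
  to : Mengerian (H3 G) → n ≡ 4 ⊎ Iso G C8 ⊎ PathWithDoubleStars G ⊎ StarPlusEdge G
  to men with n ≟ 4
  ... | yes e = inj₁ e
  ... | no n≢4 = inj₂ (Forward.forward simple (≤∧≢⇒< 4≤n (≢-sym n≢4)) connected men)
  from : ∀ {n} (G : Graph n) → IsSimple G → Connected G →
    n ≡ 4 ⊎ Iso G C8 ⊎ PathWithDoubleStars G ⊎ StarPlusEdge G → Mengerian (H3 G)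
  from G simple connected (inj₁ refl) = solvable⇒Mengerian (levelled-solvable (four-vertices G))
  from G simple connected (inj₂ (inj₁ iso)) = solvable⇒Mengerian (FromIso.solvable simple iso)
  from G simple connected (inj₂ (inj₂ (inj₁ ((_ , acyclic) , p , q , supported)))) =
    solvable⇒Mengerian (DoubleStars.solvable simple connected acyclic p q supported)
  from G simple connected (inj₂ (inj₂ (inj₂ star))) = solvable⇒Mengerian (levelled-solvable (star-plus-edge G star))
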